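{- For each positive integer $n$, write the number of tilings of a $2n \times 2n$ square by $1 \times 2$ dominoes as $2^n f(n)^2$, where $f(n)$ is an odd positive integer. Then the function $f$ is uniformly continuous with respect to the $2$-adic metric, and its unique continuous extension to a function $f:\mathbb{Z}_2 \to \mathbb{Z}_2$ satisfies the functional equation $$ f(-1-n) = \begin{cases} f(n) & \text{if } n \equiv 0,3 \pmod 4,\\ -f(n) & \text{if } n \equiv 1,2 \pmod 4.\end{cases} $$
   Context: It is known (and shown in the paper) that for every positive integer $n$ the number of domino tilings of a $2n\times 2n$ square has the form $2^n f(n)^2$ with $f(n)$ an odd positive integer; this defines $f$. Here $\mathbb{Z}_2$ denotes the $2$-adic integers. Uniform continuity in the $2$-adic metric means: for every $k$ there exists $\ell$ such that $n \equiv m \pmod{2^\ell}$ implies $f(n)\equiv f(m) \pmod{2^k}$. -}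

module Defs where

open import Data.Nat using (ℕ; zero; suc; _+_; _*_; _∸_; _^_; _<_; _≤_; _<?_; NonZero)
open import Data.Nat.Properties using (m^n≢0)
open import Data.Nat.DivMod using (_%_)
open import Data.Fin using (Fin; toℕ; fromℕ<; inject₁)
import Data.Fin as F
open import Data.Fin.Properties using (all?)
open import Data.List using (List; []; _∷_; [_]; map; concatMap; filter; length)
open import Data.Maybe using (Maybe; just; nothing)
open import Data.Product using (_×_; _,_; Σ; ∃)
open import Data.Sum using (_⊎_)
open import Data.Empty using (⊥)
open import Data.Unit using (⊤)
open import Relation.Nullary using (Dec; yes; no)
open import Relation.Binary.PropositionalEquality using (_≡_; refl)

-- Domino tilings of an m × m board.
-- A tiling is encoded as an assignment to every cell of the direction in
-- which its partner cell (the other half of its domino) lies; it is a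
-- tiling iff every partner lies on the board and points back.  This is
-- exactly a perfect matching of the grid graph, i.e. a domino tiling.

data Dir : Set where
  up down left right : Dir

opp : Dir → Dir
opp up = down
opp down = up
opp left = right
opp right = left

_≟D_ : (a b : Dir) → Dec (a ≡ b)
up ≟D up = yes refl
up ≟D down = no λ ()
up ≟D left = no λ ()
up ≟D right = no λ ()
down ≟D up = no λ ()
down ≟D down = yes refl
down ≟D left = no λ ()
down ≟D right = no λ ()
left ≟D up = no λ ()
left ≟D down = no λ ()
left ≟D left = yes refl
left ≟D right = no λ ()
right ≟D up = no λ ()
right ≟D down = no λ ()
right ≟D left = no λ ()
right ≟D right = yes refl

next : {m : ℕ} → Fin m → Maybe (Fin m)
next {m} i with suc (toℕ i) <? m
... | yes p = just (fromℕ< p)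
... | no _ = nothing

prev : {m : ℕ} → Fin m → Maybe (Fin m)
prev F.zero = nothing
prev (F.suc i) = just (inject₁ i)

Cell : ℕ → Set
Cell m = Fin m × Fin m

-- cells are (row , column); rows increase downwards
step : {m : ℕ} → Cell m → Dir → Maybe (Cell m)
step (i , j) up with prev i
... | just i' = just (i' , j)
... | nothing = nothing
step (i , j) down with next i
... | just i' = just (i' , j)
... | nothing = nothing
step (i , j) left with prev j
... | just j' = just (i , j')
... | nothing = nothing
step (i , j) right with next j
... | just j' = just (i , j')
... | nothing = nothing

Assignment : ℕ → Set
Assignment m = Fin m → Fin m → Dir

PartnerOK : {m : ℕ} → Assignment m → Maybe (Cell m) → Dir → Set
PartnerOK a nothing d = ⊥
PartnerOK a (just (i' , j')) d = a i' j' ≡ opp d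

partnerOK? : {m : ℕ} (a : Assignment m) (c : Maybe (Cell m)) (d : Dir) → Dec (PartnerOK a c d)
partnerOK? a nothing d = no λ ()
partnerOK? a (just (i' , j')) d = a i' j' ≟D opp d

IsTiling : {m : ℕ} → Assignment m → Set
IsTiling a = ∀ i j → PartnerOK a (step (i , j) (a i j)) (a i j)

isTiling? : {m : ℕ} (a : Assignment m) → Dec (IsTiling a)
isTiling? a = all? λ i → all? λ j → partnerOK? a (step (i , j) (a i j)) (a i j)

allFuns : {A : Set} (k : ℕ) → List A → List (Fin k → A)
allFuns zero as = [ (λ ()) ]
allFuns (suc k) as =
  concatMap (λ x → map (λ g → λ { F.zero → x ; (F.suc i) → g i }) (allFuns k as)) as

allDirs : List Dir
allDirs = up ∷ down ∷ left ∷ right ∷ []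

allAssignments : (m : ℕ) → List (Assignment m)
allAssignments m = allFuns m (allFuns m allDirs)

tilings : ℕ → ℕ
tilings m = length (filter isTiling? (allAssignments m))

pow2 : ℕ → ℕ
pow2 k = 2 ^ k

mod2^ : ℕ → ℕ → ℕ
mod2^ k x = _%_ x (2 ^ k) {{m^n≢0 2 k}}

record ℤ₂ : Set where
  field
    res : ℕ → ℕ
    res-< : ∀ k → res k < 2 ^ k
    res-compat : ∀ k → mod2^ k (res (suc k)) ≡ res k
open ℤ₂ public

_≈₂_ : ℤ₂ → ℤ₂ → Set
x ≈₂ y = ∀ k → res x k ≡ res y k

Agree : ℕ → ℤ₂ → ℤ₂ → Set
Agree k x y = res x k ≡ res y k

ιres : ℕ → ℕ → ℕ
ιres n k = mod2^ k n

negres : ℤ₂ → ℕ → ℕ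
negres x k = mod2^ k (2 ^ k ∸ res x k)

negSucres : ℤ₂ → ℕ → ℕ
negSucres x k = 2 ^ k ∸ 1 ∸ res x k

Continuous : (ℤ₂ → ℤ₂) → Set
Continuous F = ∀ (x : ℤ₂) (k : ℕ) → ∃ λ ℓ → ∀ (y : ℤ₂) → Agree ℓ x y → Agree k (F x) (F y)

Represents : ℤ₂ → ℕ → Set
Represents x n = ∀ k → res x k ≡ ιres n k

IsNegSuc : ℤ₂ → ℤ₂ → Set
IsNegSuc y x = ∀ k → res y k ≡ negSucres x k

IsNeg : ℤ₂ → ℤ₂ → Set
IsNeg y x = ∀ k → res y k ≡ negres x k

Extends : (ℤ₂ → ℤ₂) → (ℕ → ℕ) → Set
Extends F f = ∀ (n : ℕ) → 1 ≤ n → ∀ (x : ℤ₂) → Represents x n → Represents (F x) (f n)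

UniformlyContinuous₂ : (ℕ → ℕ) → Set
UniformlyContinuous₂ f = ∀ (k : ℕ) → ∃ λ ℓ → ∀ (n m : ℕ) → 1 ≤ n → 1 ≤ m →
  mod2^ ℓ n ≡ mod2^ ℓ m → mod2^ k (f n) ≡ mod2^ k (f m)

FunctionalEquation : (ℤ₂ → ℤ₂) → Set
FunctionalEquation F = ∀ (x y : ℤ₂) → IsNegSuc y x →
  ((res x 2 ≡ 0 ⊎ res x 2 ≡ 3) → F y ≈₂ F x) ×
  ((res x 2 ≡ 1 ⊎ res x 2 ≡ 2) → IsNeg (F y) (F x))

Odd : ℕ → Set
Odd a = a % 2 ≡ 1

{-# OPTIONS --safe #-}
module Submission where

-- Let γ₁, …, γₙ be the roots of V_n, where V_n(z + 1/z) = z⁻ⁿ + … + zⁿ, and let βⱼ = 2 + γⱼ. Read row by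
-- row, a domino tiling is a family of non-colliding particles on a line, so the number of tilings of the
-- 2n × 2n square is an n × n determinant, with value ∏_{j,k} (βⱼ + βₖ) = 2ⁿ D² for D = ∏_{j<k} (βⱼ + βₖ).
-- Moreover D is the determinant of e₀, B²e₀, B⁴e₀, … for a totally nonnegative matrix B with eigenvalues
-- βⱼ; hence D ≥ 0 and f(n) = D.
-- The substitution (i, j) ↦ (i + j, i − j) on (ℤ/N)², N = 2n + 1 odd, shows that the γⱼ + γₖ and the γⱼγₖ
-- with j < k have the same power sums. Hence D = ∏_{j<k} (4 + γⱼγₖ) = ± ∏_{j<k} (1 + 4 XⱼXₖ) with
-- Xⱼ = 1/γⱼ and a sign of period 4 in n. Since V_{n+1} = y V_n − V_{n−1}, and so V_{−1−n} = −V_n, the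
-- elementary symmetric functions of the Xⱼ are uniformly 2-adically continuous in n and invariant under
-- n ↦ −1 − n. By Newton's identities so are those of the products XⱼXₖ, and the m-th of them enters the
-- last product with the factor 4ᵐ.

open import Defs
open import Data.Bool using (Bool; true; false; if_then_else_)
open import Data.Empty using (⊥; ⊥-elim)
open import Data.Fin as Fin using (Fin; zero; suc; toℕ)
open import Data.Fin.Properties using (toℕ-fromℕ<; toℕ-inject₁; toℕ-injective; toℕ<n)
open import Data.Integer as ℤ using (ℤ; +_; -[1+_]; ∣_∣)
import Data.Integer.Properties as ℤP
open import Data.Integer.Tactic.RingSolver using (solve-∀)
open import Data.List using (List; []; _∷_; map; concatMap; filter; foldr; length; _++_)
open import Data.List.Properties using (map-∘; map-++; length-map; length-++)
open import Data.Maybe using (Maybe; just; nothing)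
open import Data.Nat as ℕ using (ℕ; zero; suc; z≤n; s≤s; _<?_)
open import Data.Nat.DivMod as ℕD using (_%_; m≡m%n+[m/n]*n; m%n<n)
import Data.Nat.Divisibility as ℕ∣
import Data.Nat.Properties as ℕP
open import Data.Product using (_×_; _,_; proj₁; proj₂; Σ; ∃)
open import Data.Sum using (_⊎_; inj₁; inj₂)
open import Data.Unit using (⊤; tt)
open import Data.Vec as Vec using (Vec; []; _∷_; tabulate; lookup; replicate)
open import Data.Vec.Properties using (lookup∘tabulate; lookup-replicate; tabulate-∘)
open import Function using (_∘_)
open import Relation.Binary using (tri<; tri≈; tri>)
open import Relation.Binary.PropositionalEquality hiding (J)
open import Relation.Nullary using (Dec; yes; no; ¬_)
open import Algebra.Bundles using (CommutativeRing; RawRing)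
open import Algebra.Structures using (IsCommutativeRing)
open import Algebra.Solver.Ring.AlmostCommutativeRing using (fromCommutativeRing; _-Raw-AlmostCommutative⟶_)
import Algebra.Solver.Ring

-- The γⱼ live in a ring obtained from ℤ by adjoining one root after another. It may have zero
-- divisors and carries no order, and both facts shape the proof. Eigenvectors of B would require
-- division by differences of roots; the Newton basis v, (B - β₁)v, (B - β₂)(B - β₁)v, ... makes
-- every polynomial in B triangular without division. Only nonzero integers are ever cancelled, and
-- the retraction onto ℤ carries congruences from the ring back to ℤ. The tilings determine only D²,
-- while the functional equation depends on signs; so D ≥ 0 has to be proved, by exhibiting D as a
-- coordinate computed from 0 and 1 by additions alone. The γⱼ are units because their product is
-- ±1. Passing to inverses turns D, whose number of factors grows with n, into an expansion in
-- powers of 4 that needs a number of terms independent of n for a given 2-adic precision. Dividing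
-- by m in Newton's identities costs a number of binary digits that depends on m alone, so
-- continuity survives it.

-- Commutative rings that are torsion-free over ℤ and retract ℤ-linearly onto it, so that an element
-- with a nonzero multiple in ℤ lies in ℤ.
record Alg : Set₁ where
  infixl 6 _+_
  infixl 7 _*_
  infix 8 -_
  field
    Carrier : Set
    _+_ _*_ : Carrier → Carrier → Carrier
    -_ : Carrier → Carrier
    0# 1# : Carrier
    isCommutativeRing : IsCommutativeRing _≡_ _+_ _*_ -_ 0# 1#
    ι : ℤ → Carrier
    ι-+ : ∀ a b → ι (a ℤ.+ b) ≡ ι a + ι b
    ι-* : ∀ a b → ι (a ℤ.* b) ≡ ι a * ι b
    ι-neg : ∀ a → ι (ℤ.- a) ≡ - ι a
    ι-0 : ι (+ 0) ≡ 0#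
    ι-1 : ι (+ 1) ≡ 1#
    π : Carrier → ℤ
    π-+ : ∀ x y → π (x + y) ≡ π x ℤ.+ π y
    π-ι* : ∀ a x → π (ι a * x) ≡ a ℤ.* π x
    π-1 : π 1# ≡ + 1
    torsion : ∀ m x → ι (+ suc m) * x ≡ 0# → x ≡ 0#

module AlgTheory (S : Alg) where
  open Alg S public
  open IsCommutativeRing isCommutativeRing public
    using (+-assoc; +-comm; +-identityˡ; +-identityʳ; -‿inverseʳ;
           *-assoc; *-comm; *-identityˡ; *-identityʳ; distribˡ; distribʳ; zeroˡ; zeroʳ)

  commutativeRing : CommutativeRing _ _
  commutativeRing = record { isCommutativeRing = isCommutativeRing }

  ℤ-rawRing : RawRing _ _
  ℤ-rawRing = record { Carrier = ℤ ; _≈_ = _≡_ ; _+_ = ℤ._+_ ; _*_ = ℤ._*_ ; -_ = ℤ.-_ ; 0# = + 0 ; 1# = + 1 }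

  ι-morphism : ℤ-rawRing -Raw-AlmostCommutative⟶ fromCommutativeRing commutativeRing
  ι-morphism = record { ⟦_⟧ = ι ; +-homo = ι-+ ; *-homo = ι-* ; -‿homo = ι-neg ; 0-homo = ι-0 ; 1-homo = ι-1 }

  ι-≟ : ∀ a b → Maybe (ι a ≡ ι b)
  ι-≟ a b with a ℤ.≟ b
  ... | yes e = just (cong ι e)
  ... | no _ = nothing

  open Algebra.Solver.Ring ℤ-rawRing (fromCommutativeRing commutativeRing) ι-morphism ι-≟ public
    using (solve; _:=_; _:+_; _:*_; :-_; _:-_; con)

  addˡ : ∀ a {b c} → b ≡ c → a + b ≡ a + c
  addˡ a = cong (λ t → a + t)

  mulˡ : ∀ a {b c} → b ≡ c → a * b ≡ a * c
  mulˡ a = cong (λ t → a * t)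

  π-ι : ∀ a → π (ι a) ≡ a
  π-ι a = trans (cong π (sym (*-identityʳ (ι a)))) (trans (π-ι* a 1#)
    (trans (cong (a ℤ.*_) π-1) (ℤP.*-identityʳ a)))

  ι-injective : ∀ {a b} → ι a ≡ ι b → a ≡ b
  ι-injective {a} {b} e = trans (sym (π-ι a)) (trans (cong π e) (π-ι b))

  cancel : ∀ m x y → ι (+ suc m) * x ≡ ι (+ suc m) * y → x ≡ y
  cancel m x y e = trans (solve 2 (λ x y → x := (x :- y) :+ y) refl x y)
    (trans (cong (_+ y) (torsion m (x + - y)
      (trans (solve 3 (λ c x y → c :* (x :- y) := c :* x :- c :* y) refl (ι (+ suc m)) x y)
        (trans (cong (_+ - (ι (+ suc m) * y)) e) (-‿inverseʳ _)))))
      (+-identityˡ y))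

  -- Applying `π` to the hypothesis shows that `suc m` divides `z` in ℤ; torsion-freeness then
  -- identifies the quotient with `x`.
  pure : ∀ m x z → ι (+ suc m) * x ≡ ι z → x ≡ ι (π x)
  pure m x z e = cancel m _ _ (trans e (trans (cong ι lem) (ι-* (+ suc m) (π x))))
    where
    lem : z ≡ + suc m ℤ.* π x
    lem = trans (sym (π-ι z)) (trans (cong π (sym e)) (π-ι* (+ suc m) x))

  two four : Carrier
  two = ι (+ 2)
  four = ι (+ 4)

ℤ-alg : Alg
ℤ-alg = record
  { Carrier = ℤ ; _+_ = ℤ._+_ ; _*_ = ℤ._*_ ; -_ = ℤ.-_ ; 0# = + 0 ; 1# = + 1
  ; isCommutativeRing = ℤP.+-*-isCommutativeRing
  ; ι = λ a → a ; ι-+ = λ _ _ → refl ; ι-* = λ _ _ → refl ; ι-neg = λ _ → refl ; ι-0 = refl ; ι-1 = refl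
  ; π = λ a → a ; π-+ = λ _ _ → refl ; π-ι* = λ _ _ → refl ; π-1 = refl
  ; torsion = λ m x e → ℤP.*-cancelˡ-≡ (+ suc m) x (+ 0) (trans e (sym (ℤP.*-zeroʳ (+ suc m)))) }

-- Exterior algebra

module Exterior (S : Alg) where
  open AlgTheory S

  infixl 6 _+v_ _⊕_
  infixr 7 _·v_ _·_
  infixr 5 _∣_
  infixr 8 _∧_

  V : ℕ → Set
  V = Vec Carrier

  0v : ∀ {m} → V m
  0v {zero} = []
  0v {suc m} = 0# ∷ 0v

  _+v_ : ∀ {m} → V m → V m → V m
  [] +v [] = []
  (a ∷ u) +v (b ∷ v) = (a + b) ∷ (u +v v)

  _·v_ : ∀ {m} → Carrier → V m → V m
  c ·v [] = []
  c ·v (a ∷ v) = (c * a) ∷ (c ·v v)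

  e₀ : ∀ {m} → V m
  e₀ {zero} = []
  e₀ {suc m} = 1# ∷ 0v

  -- An element of the exterior algebra of V m, split by the monomials free of the first basis vector and
  -- those divisible by it.
  data Λ : ℕ → Set where
    ⟨_⟩ : Carrier → Λ zero
    _∣_ : ∀ {m} → Λ m → Λ m → Λ (suc m)

  𝟘 : ∀ {m} → Λ m
  𝟘 {zero} = ⟨ 0# ⟩
  𝟘 {suc m} = 𝟘 ∣ 𝟘

  𝟙 : ∀ {m} → Λ m
  𝟙 {zero} = ⟨ 1# ⟩
  𝟙 {suc m} = 𝟙 ∣ 𝟘

  volume : ∀ {m} → Λ m
  volume {zero} = ⟨ 1# ⟩
  volume {suc m} = 𝟘 ∣ volume

  top : ∀ {m} → Λ m → Carrier
  top ⟨ x ⟩ = x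
  top (x ∣ y) = top y

  _⊕_ : ∀ {m} → Λ m → Λ m → Λ m
  ⟨ x ⟩ ⊕ ⟨ y ⟩ = ⟨ x + y ⟩
  (x ∣ y) ⊕ (z ∣ w) = (x ⊕ z) ∣ (y ⊕ w)

  _·_ : ∀ {m} → Carrier → Λ m → Λ m
  c · ⟨ x ⟩ = ⟨ c * x ⟩
  c · (x ∣ y) = (c · x) ∣ (c · y)

  m1 : Carrier
  m1 = ι -[1+ 0 ]

  -- The pair `x ∣ y` stands for x + e₀ ∧ y; the factor `m1` comes from moving e₀ to the front of v
  -- ∧ e₀ ∧ y.
  _∧_ : ∀ {m} → V m → Λ m → Λ m
  [] ∧ ⟨ x ⟩ = ⟨ 0# ⟩
  (a ∷ v) ∧ (x ∣ y) = (v ∧ x) ∣ (a · x ⊕ m1 · v ∧ y)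

  ⊕-interchange : ∀ {m} (x y z w : Λ m) → (x ⊕ y) ⊕ (z ⊕ w) ≡ (x ⊕ z) ⊕ (y ⊕ w)
  ⊕-interchange ⟨ x ⟩ ⟨ y ⟩ ⟨ z ⟩ ⟨ w ⟩ =
    cong ⟨_⟩ (solve 4 (λ x y z w → (x :+ y) :+ (z :+ w) := (x :+ z) :+ (y :+ w)) refl x y z w)
  ⊕-interchange (x ∣ x') (y ∣ y') (z ∣ z') (w ∣ w') = cong₂ _∣_ (⊕-interchange x y z w)
    (⊕-interchange x' y' z' w')

  ⊕-identityʳ : ∀ {m} (x : Λ m) → x ⊕ 𝟘 ≡ x
  ⊕-identityʳ ⟨ x ⟩ = cong ⟨_⟩ (+-identityʳ x)
  ⊕-identityʳ (x ∣ y) = cong₂ _∣_ (⊕-identityʳ x) (⊕-identityʳ y)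

  ⊕-identityˡ : ∀ {m} (x : Λ m) → 𝟘 ⊕ x ≡ x
  ⊕-identityˡ ⟨ x ⟩ = cong ⟨_⟩ (+-identityˡ x)
  ⊕-identityˡ (x ∣ y) = cong₂ _∣_ (⊕-identityˡ x) (⊕-identityˡ y)

  ·-⊕ : ∀ {m} c (x y : Λ m) → c · (x ⊕ y) ≡ c · x ⊕ c · y
  ·-⊕ c ⟨ x ⟩ ⟨ y ⟩ = cong ⟨_⟩ (distribˡ c x y)
  ·-⊕ c (x ∣ x') (y ∣ y') = cong₂ _∣_ (·-⊕ c x y) (·-⊕ c x' y')

  +-· : ∀ {m} a b (x : Λ m) → (a + b) · x ≡ a · x ⊕ b · x
  +-· a b ⟨ x ⟩ = cong ⟨_⟩ (distribʳ x a b)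
  +-· a b (x ∣ y) = cong₂ _∣_ (+-· a b x) (+-· a b y)

  *-· : ∀ {m} a b (x : Λ m) → (a * b) · x ≡ a · b · x
  *-· a b ⟨ x ⟩ = cong ⟨_⟩ (*-assoc a b x)
  *-· a b (x ∣ y) = cong₂ _∣_ (*-· a b x) (*-· a b y)

  1-· : ∀ {m} (x : Λ m) → 1# · x ≡ x
  1-· ⟨ x ⟩ = cong ⟨_⟩ (*-identityˡ x)
  1-· (x ∣ y) = cong₂ _∣_ (1-· x) (1-· y)

  0-· : ∀ {m} (x : Λ m) → 0# · x ≡ 𝟘
  0-· ⟨ x ⟩ = cong ⟨_⟩ (zeroˡ x)
  0-· (x ∣ y) = cong₂ _∣_ (0-· x) (0-· y)

  ·-𝟘 : ∀ {m} c → c · 𝟘 {m} ≡ 𝟘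
  ·-𝟘 {zero} c = cong ⟨_⟩ (zeroʳ c)
  ·-𝟘 {suc m} c = cong₂ _∣_ (·-𝟘 c) (·-𝟘 c)

  ·-comm : ∀ {m} a b (x : Λ m) → a · b · x ≡ b · a · x
  ·-comm a b x = trans (sym (*-· a b x)) (trans (cong (_· x) (*-comm a b)) (*-· b a x))

  top-· : ∀ {m} c (x : Λ m) → top (c · x) ≡ c * top x
  top-· c ⟨ x ⟩ = refl
  top-· c (x ∣ y) = top-· c y

  top-volume : ∀ m → top (volume {m}) ≡ 1#
  top-volume zero = refl
  top-volume (suc m) = top-volume m

  ∧-⊕ : ∀ {m} (v : V m) x y → v ∧ (x ⊕ y) ≡ v ∧ x ⊕ v ∧ y
  ∧-⊕ [] ⟨ x ⟩ ⟨ y ⟩ = cong ⟨_⟩ (sym (+-identityʳ 0#))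
  ∧-⊕ (a ∷ v) (x ∣ x') (y ∣ y') = cong₂ _∣_ (∧-⊕ v x y)
    (trans (cong₂ (λ p q → p ⊕ m1 · q) (·-⊕ a x y) (∧-⊕ v x' y'))
    (trans (cong (_ ⊕_) (·-⊕ m1 (v ∧ x') (v ∧ y'))) (⊕-interchange _ _ _ _)))

  ∧-· : ∀ {m} c (v : V m) x → v ∧ (c · x) ≡ c · v ∧ x
  ∧-· c [] ⟨ x ⟩ = cong ⟨_⟩ (sym (zeroʳ c))
  ∧-· c (a ∷ v) (x ∣ y) = cong₂ _∣_ (∧-· c v x)
    (trans (cong₂ _⊕_ (·-comm a c x) (trans (cong (m1 ·_) (∧-· c v y)) (·-comm m1 c (v ∧ y))))
      (sym (·-⊕ c _ _)))

  ∧-𝟘 : ∀ {m} (v : V m) → v ∧ 𝟘 ≡ 𝟘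
  ∧-𝟘 v = trans (cong (v ∧_) (sym (0-· 𝟘))) (trans (∧-· 0# v 𝟘) (0-· (v ∧ 𝟘)))

  +v-∧ : ∀ {m} (u v : V m) x → (u +v v) ∧ x ≡ u ∧ x ⊕ v ∧ x
  +v-∧ [] [] ⟨ x ⟩ = cong ⟨_⟩ (sym (+-identityʳ 0#))
  +v-∧ (a ∷ u) (b ∷ v) (x ∣ y) = cong₂ _∣_ (+v-∧ u v x)
    (trans (cong₂ (λ p q → p ⊕ m1 · q) (+-· a b x) (+v-∧ u v y))
    (trans (cong (_ ⊕_) (·-⊕ m1 _ _)) (⊕-interchange _ _ _ _)))

  ·v-∧ : ∀ {m} c (v : V m) x → (c ·v v) ∧ x ≡ c · v ∧ x
  ·v-∧ c [] ⟨ x ⟩ = cong ⟨_⟩ (sym (zeroʳ c))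
  ·v-∧ c (a ∷ v) (x ∣ y) = cong₂ _∣_ (·v-∧ c v x)
    (trans (cong₂ _⊕_ (*-· c a x) (trans (cong (m1 ·_) (·v-∧ c v y)) (·-comm m1 c (v ∧ y))))
      (sym (·-⊕ c _ _)))

  0v-∧ : ∀ {m} (x : Λ m) → 0v ∧ x ≡ 𝟘
  0v-∧ ⟨ x ⟩ = refl
  0v-∧ (x ∣ y) = cong₂ _∣_ (0v-∧ x)
    (trans (cong₂ _⊕_ (0-· x) (trans (cong (m1 ·_) (0v-∧ y)) (·-𝟘 m1))) (⊕-identityʳ 𝟘))

  e₀-∧ : ∀ {m} (x y : Λ m) → e₀ ∧ (x ∣ y) ≡ 𝟘 ∣ x
  e₀-∧ x y = cong₂ _∣_ (0v-∧ x)
    (trans (cong₂ _⊕_ (1-· x) (trans (cong (m1 ·_) (0v-∧ y)) (·-𝟘 m1))) (⊕-identityʳ x))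

  private
    -- Linear identities in Λ hold coordinate by coordinate, where they are ring identities.
    self-lemma : ∀ {m} a (p r : Λ m) → a · p ⊕ m1 · (a · p ⊕ m1 · r) ≡ r
    self-lemma a ⟨ p ⟩ ⟨ r ⟩ = cong ⟨_⟩
      (solve 3 (λ a p r → a :* p :+ con -[1+ 0 ] :* (a :* p :+ con -[1+ 0 ] :* r) := r) refl a p r)
    self-lemma a (p ∣ p') (r ∣ r') = cong₂ _∣_ (self-lemma a p r) (self-lemma a p' r')

    anti-lemma : ∀ {m} a b (p q r s : Λ m) →
      (a · p ⊕ m1 · (b · q ⊕ m1 · r)) ⊕ (b · q ⊕ m1 · (a · p ⊕ m1 · s)) ≡ r ⊕ s
    anti-lemma a b ⟨ p ⟩ ⟨ q ⟩ ⟨ r ⟩ ⟨ s ⟩ = cong ⟨_⟩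
      (solve 6 (λ a b p q r s → (a :* p :+ con -[1+ 0 ] :* (b :* q :+ con -[1+ 0 ] :* r))
        :+ (b :* q :+ con -[1+ 0 ] :* (a :* p :+ con -[1+ 0 ] :* s)) := r :+ s) refl a b p q r s)
    anti-lemma a b (p ∣ p') (q ∣ q') (r ∣ r') (s ∣ s') = cong₂ _∣_ (anti-lemma a b p q r s)
      (anti-lemma a b p' q' r' s')

    minus-lemma : ∀ {m} (r s : Λ m) → r ≡ (r ⊕ s) ⊕ m1 · s
    minus-lemma ⟨ r ⟩ ⟨ s ⟩ = cong ⟨_⟩ (solve 2 (λ r s → r := (r :+ s) :+ con -[1+ 0 ] :* s) refl r s)
    minus-lemma (r ∣ r') (s ∣ s') = cong₂ _∣_ (minus-lemma r s) (minus-lemma r' s')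

  ∧-linear : ∀ {m} (v : V m) a x b y → v ∧ (a · x ⊕ b · y) ≡ a · v ∧ x ⊕ b · v ∧ y
  ∧-linear v a x b y = trans (∧-⊕ v _ _) (cong₂ _⊕_ (∧-· a v x) (∧-· b v y))

  ∧-self : ∀ {m} (v : V m) x → v ∧ v ∧ x ≡ 𝟘
  ∧-self [] ⟨ x ⟩ = refl
  ∧-self (a ∷ v) (x ∣ y) = cong₂ _∣_ (∧-self v x)
    (trans (cong (λ t → a · v ∧ x ⊕ m1 · t) (∧-linear v a x m1 (v ∧ y)))
    (trans (self-lemma a (v ∧ x) (v ∧ v ∧ y)) (∧-self v y)))

  ∧-anti : ∀ {m} (u v : V m) x → u ∧ v ∧ x ⊕ v ∧ u ∧ x ≡ 𝟘
  ∧-anti [] [] ⟨ x ⟩ = cong ⟨_⟩ (+-identityʳ 0#)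
  ∧-anti (a ∷ u) (b ∷ v) (x ∣ y) = cong₂ _∣_ (∧-anti u v x)
    (trans (cong₂ (λ s t → (a · v ∧ x ⊕ m1 · s) ⊕ (b · u ∧ x ⊕ m1 · t)) (∧-linear u b x m1 (v ∧ y))
      (∧-linear v a x m1 (u ∧ y)))
    (trans (anti-lemma a b (v ∧ x) (u ∧ x) (u ∧ v ∧ y) (v ∧ u ∧ y)) (∧-anti u v y)))

  ∧-swap : ∀ {m} (u v : V m) x → u ∧ v ∧ x ≡ m1 · v ∧ u ∧ x
  ∧-swap u v x = trans (minus-lemma (u ∧ v ∧ x) (v ∧ u ∧ x))
    (trans (cong (_⊕ m1 · v ∧ u ∧ x) (∧-anti u v x)) (⊕-identityˡ _))

  -- H moves particles from the sites 0, 2, 4, … to adjacent empty sites and G moves them from the sites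
  -- 1, 3, 5, …; Gᵖ and Hᵖ are their variants in which a particle enters, respectively leaves, site 0
  -- from, respectively to, the left.
  H G Gᵖ Hᵖ : ∀ {m} → Λ m → Λ m
  H ⟨ x ⟩ = ⟨ x ⟩
  H (x ∣ y) = (G x ⊕ Gᵖ y) ∣ G y
  G ⟨ x ⟩ = ⟨ x ⟩
  G (x ∣ y) = H x ∣ (H y ⊕ Hᵖ x)
  Gᵖ ⟨ x ⟩ = ⟨ 0# ⟩
  Gᵖ (x ∣ y) = 𝟘 ∣ H x
  Hᵖ ⟨ x ⟩ = ⟨ 0# ⟩
  Hᵖ (x ∣ y) = G y ∣ 𝟘

  hd : ∀ {m} → V m → Carrier
  hd [] = 0#
  hd (a ∷ v) = a

  h g : ∀ {m} → V m → V m
  h [] = []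
  h (a ∷ v) = a ∷ ((a ·v e₀) +v g v)
  g [] = []
  g (a ∷ v) = (a + hd v) ∷ h v

  Gᵖ-∧ : ∀ {m} (x : Λ m) → Gᵖ x ≡ e₀ ∧ G x
  Gᵖ-∧ ⟨ x ⟩ = refl
  Gᵖ-∧ (x ∣ y) = sym (e₀-∧ (H x) (H y ⊕ Hᵖ x))

  H-⊕ : ∀ {m} (x y : Λ m) → H (x ⊕ y) ≡ H x ⊕ H y
  G-⊕ : ∀ {m} (x y : Λ m) → G (x ⊕ y) ≡ G x ⊕ G y
  Gᵖ-⊕ : ∀ {m} (x y : Λ m) → Gᵖ (x ⊕ y) ≡ Gᵖ x ⊕ Gᵖ y
  Hᵖ-⊕ : ∀ {m} (x y : Λ m) → Hᵖ (x ⊕ y) ≡ Hᵖ x ⊕ Hᵖ y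
  H-⊕ ⟨ x ⟩ ⟨ y ⟩ = refl
  H-⊕ (x ∣ x') (y ∣ y') = cong₂ _∣_ (trans (cong₂ _⊕_ (G-⊕ x y) (Gᵖ-⊕ x' y')) (⊕-interchange _ _ _ _))
    (G-⊕ x' y')
  G-⊕ ⟨ x ⟩ ⟨ y ⟩ = refl
  G-⊕ (x ∣ x') (y ∣ y') = cong₂ _∣_ (H-⊕ x y) (trans (cong₂ _⊕_ (H-⊕ x' y') (Hᵖ-⊕ x y)) (⊕-interchange _ _ _ _))
  Gᵖ-⊕ ⟨ x ⟩ ⟨ y ⟩ = cong ⟨_⟩ (sym (+-identityʳ 0#))
  Gᵖ-⊕ (x ∣ x') (y ∣ y') = cong₂ _∣_ (sym (⊕-identityʳ 𝟘)) (H-⊕ x y)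
  Hᵖ-⊕ ⟨ x ⟩ ⟨ y ⟩ = cong ⟨_⟩ (sym (+-identityʳ 0#))
  Hᵖ-⊕ (x ∣ x') (y ∣ y') = cong₂ _∣_ (G-⊕ x' y') (sym (⊕-identityʳ 𝟘))

  H-· : ∀ {m} c (x : Λ m) → H (c · x) ≡ c · H x
  G-· : ∀ {m} c (x : Λ m) → G (c · x) ≡ c · G x
  Gᵖ-· : ∀ {m} c (x : Λ m) → Gᵖ (c · x) ≡ c · Gᵖ x
  Hᵖ-· : ∀ {m} c (x : Λ m) → Hᵖ (c · x) ≡ c · Hᵖ x
  H-· c ⟨ x ⟩ = refl
  H-· c (x ∣ y) = cong₂ _∣_ (trans (cong₂ _⊕_ (G-· c x) (Gᵖ-· c y)) (sym (·-⊕ c _ _))) (G-· c y)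
  G-· c ⟨ x ⟩ = refl
  G-· c (x ∣ y) = cong₂ _∣_ (H-· c x) (trans (cong₂ _⊕_ (H-· c y) (Hᵖ-· c x)) (sym (·-⊕ c _ _)))
  Gᵖ-· c ⟨ x ⟩ = cong ⟨_⟩ (sym (zeroʳ c))
  Gᵖ-· c (x ∣ y) = cong₂ _∣_ (sym (·-𝟘 c)) (H-· c x)
  Hᵖ-· c ⟨ x ⟩ = cong ⟨_⟩ (sym (zeroʳ c))
  Hᵖ-· c (x ∣ y) = cong₂ _∣_ (G-· c y) (sym (·-𝟘 c))

  H-𝟘 : ∀ {m} → H (𝟘 {m}) ≡ 𝟘
  H-𝟘 = trans (cong H (sym (0-· 𝟘))) (trans (H-· 0# 𝟘) (0-· _))
  G-𝟘 : ∀ {m} → G (𝟘 {m}) ≡ 𝟘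
  G-𝟘 = trans (cong G (sym (0-· 𝟘))) (trans (G-· 0# 𝟘) (0-· _))
  Gᵖ-𝟘 : ∀ {m} → Gᵖ (𝟘 {m}) ≡ 𝟘
  Gᵖ-𝟘 = trans (cong Gᵖ (sym (0-· 𝟘))) (trans (Gᵖ-· 0# 𝟘) (0-· _))

  H-𝟙 : ∀ {m} → H (𝟙 {m}) ≡ 𝟙
  G-𝟙 : ∀ {m} → G (𝟙 {m}) ≡ 𝟙
  Hᵖ-𝟙 : ∀ {m} → Hᵖ (𝟙 {m}) ≡ 𝟘
  H-𝟙 {zero} = refl
  H-𝟙 {suc m} = cong₂ _∣_ (trans (cong₂ _⊕_ G-𝟙 Gᵖ-𝟘) (⊕-identityʳ 𝟙)) G-𝟘
  G-𝟙 {zero} = refl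
  G-𝟙 {suc m} = cong₂ _∣_ H-𝟙 (trans (cong₂ _⊕_ H-𝟘 Hᵖ-𝟙) (⊕-identityʳ 𝟘))
  Hᵖ-𝟙 {zero} = refl
  Hᵖ-𝟙 {suc m} = cong₂ _∣_ G-𝟘 refl

  private
    H-lemma₁ : ∀ {m} a (p q r s t : Λ m) → s ≡ 𝟘 → t ≡ m1 · r →
      p ⊕ (a · q ⊕ m1 · r) ≡ a · (q ⊕ s) ⊕ (p ⊕ t)
    H-lemma₁ a ⟨ p ⟩ ⟨ q ⟩ ⟨ r ⟩ _ _ refl refl = cong ⟨_⟩
      (trans (solve 4 (λ a p q r → p :+ (a :* q :+ con -[1+ 0 ] :* r) := a :* (q :+ con (+ 0)) :+
        (p :+ con -[1+ 0 ] :* r)) refl a p q r)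
        (cong (λ z → a * (q + z) + (p + m1 * r)) ι-0))
    H-lemma₁ a (p ∣ p') (q ∣ q') (r ∣ r') _ _ refl refl = cong₂ _∣_ (H-lemma₁ a p q r _ _ refl refl)
      (H-lemma₁ a p' q' r' _ _ refl refl)

    Hᵖ-lemma : ∀ {m} a (p : Λ m) → 𝟘 ≡ a · p ⊕ m1 · (a · p ⊕ m1 · 𝟘)
    Hᵖ-lemma a p = sym (self-lemma a p 𝟘)

  H-lemma₂ : ∀ {m} a (p q r : Λ m) → a · p ⊕ m1 · q ≡ a · (p ⊕ r) ⊕ m1 · (a · r ⊕ q)
  H-lemma₂ a ⟨ p ⟩ ⟨ q ⟩ ⟨ r ⟩ = cong ⟨_⟩
    (solve 4 (λ a p q r → a :* p :+ con -[1+ 0 ] :* q := a :* (p :+ r) :+ con -[1+ 0 ] :* (a :* r :+ q)) refl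
      a p q r)
  H-lemma₂ a (p ∣ p') (q ∣ q') (r ∣ r') = cong₂ _∣_ (H-lemma₂ a p q r) (H-lemma₂ a p' q' r')

  G-lemma : ∀ {m} a b (p q r : Λ m) → (a · p ⊕ m1 · q) ⊕ (b · p ⊕ m1 · r) ≡ (a + b) · p ⊕ m1 · (q ⊕ r)
  G-lemma a b ⟨ p ⟩ ⟨ q ⟩ ⟨ r ⟩ = cong ⟨_⟩
    (solve 5 (λ a b p q r → (a :* p :+ con -[1+ 0 ] :* q) :+ (b :* p :+ con -[1+ 0 ] :* r) :=
      (a :+ b) :* p :+ con -[1+ 0 ] :* (q :+ r)) refl a b p q r)
  G-lemma a b (p ∣ p') (q ∣ q') (r ∣ r') = cong₂ _∣_ (G-lemma a b p q r) (G-lemma a b p' q' r')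

  H-linear : ∀ {m} a (x y : Λ m) → H (a · x ⊕ m1 · y) ≡ a · H x ⊕ m1 · H y
  H-linear a x y = trans (H-⊕ _ _) (cong₂ _⊕_ (H-· a x) (H-· m1 y))

  G-linear : ∀ {m} a (x y : Λ m) → G (a · x ⊕ m1 · y) ≡ a · G x ⊕ m1 · G y
  G-linear a x y = trans (G-⊕ _ _) (cong₂ _⊕_ (G-· a x) (G-· m1 y))

  add-e₀-∧ : ∀ {m} a (u : V m) x → ((a ·v e₀) +v u) ∧ x ≡ a · e₀ ∧ x ⊕ u ∧ x
  add-e₀-∧ a u x = trans (+v-∧ (a ·v e₀) u x) (cong (_⊕ u ∧ x) (·v-∧ a e₀ x))

  -- `H` and `G` are induced on the exterior algebra by `h` and `g`: a move onto an occupied site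
  -- produces a square, which vanishes, and particles moving to adjacent sites keep their order, so
  -- no signs arise. This turns families of non-colliding particles into determinants. `Hᵖ` is the
  -- contraction with the first coordinate followed by `H`, hence a twisted antiderivation.
  H-∧ : ∀ {m} (v : V m) x → H (v ∧ x) ≡ h v ∧ H x
  G-∧ : ∀ {m} (v : V m) x → G (v ∧ x) ≡ g v ∧ G x
  Hᵖ-∧ : ∀ {m} (v : V m) x → Hᵖ (v ∧ x) ≡ hd v · H x ⊕ m1 · h v ∧ Hᵖ x
  H-∧ [] ⟨ x ⟩ = refl
  H-∧ (a ∷ v) (x ∣ y) = cong₂ _∣_
    (trans (cong₂ _⊕_ (G-∧ v x) (trans (Gᵖ-∧ _) (cong (e₀ ∧_)
      (trans (G-linear a x (v ∧ y)) (cong (λ t → a · G x ⊕ m1 · t) (G-∧ v y))))))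
    (trans (cong (g v ∧ G x ⊕_) (∧-linear e₀ a (G x) m1 (g v ∧ G y)))
    (trans (H-lemma₁ a (g v ∧ G x) (e₀ ∧ G x) (e₀ ∧ g v ∧ G y) (e₀ ∧ e₀ ∧ G y) (g v ∧ e₀ ∧ G y) (∧-self e₀ _)
      (∧-swap (g v) e₀ _))
    (sym (trans (add-e₀-∧ a (g v) _)
      (cong₂ (λ s t → a · s ⊕ t)
        (trans (∧-⊕ e₀ _ _) (cong (λ t → e₀ ∧ G x ⊕ e₀ ∧ t) (Gᵖ-∧ y)))
        (trans (∧-⊕ (g v) _ _) (cong (λ t → g v ∧ G x ⊕ g v ∧ t) (Gᵖ-∧ y)))))))))
    (trans (G-linear a x (v ∧ y)) (trans (cong (λ t → a · G x ⊕ m1 · t) (G-∧ v y))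
    (trans (H-lemma₂ a (G x) (g v ∧ G y) (Gᵖ y))
      (cong (λ t → a · (G x ⊕ Gᵖ y) ⊕ m1 · t) (trans (cong (λ t → a · t ⊕ g v ∧ G y) (Gᵖ-∧ y))
        (sym (add-e₀-∧ a (g v) (G y))))))))
  G-∧ [] ⟨ x ⟩ = refl
  G-∧ (a ∷ v) (x ∣ y) = cong₂ _∣_ (H-∧ v x)
    (trans (cong₂ _⊕_ (trans (H-linear a x (v ∧ y)) (cong (λ t → a · H x ⊕ m1 · t) (H-∧ v y))) (Hᵖ-∧ v x))
    (trans (G-lemma a (hd v) (H x) (h v ∧ H y) (h v ∧ Hᵖ x))
      (cong (λ t → (a + hd v) · H x ⊕ m1 · t) (sym (∧-⊕ (h v) (H y) (Hᵖ x))))))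
  Hᵖ-∧ [] ⟨ x ⟩ = cong ⟨_⟩ (sym (trans (cong₂ _+_ (zeroˡ x) (zeroʳ m1)) (+-identityʳ 0#)))
  Hᵖ-∧ (a ∷ v) (x ∣ y) = cong₂ _∣_
    (trans (G-linear a x (v ∧ y)) (trans (cong (λ t → a · G x ⊕ m1 · t) (G-∧ v y))
    (trans (H-lemma₂ a (G x) (g v ∧ G y) (Gᵖ y))
      (cong (λ t → a · (G x ⊕ Gᵖ y) ⊕ m1 · t) (trans (cong (λ t → a · t ⊕ g v ∧ G y) (Gᵖ-∧ y))
        (sym (add-e₀-∧ a (g v) (G y))))))))
    (trans (Hᵖ-lemma a (G y)) (cong (λ t → a · G y ⊕ m1 · (a · G y ⊕ m1 · t)) (sym (∧-𝟘 ((a ·v e₀) +v g v)))))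

-- Tilings and the transfer operators

isUp isDown isLeft isRight : Dir → Bool
isUp up = true
isUp _ = false
isDown down = true
isDown _ = false
isLeft left = true
isLeft _ = false
isRight right = true
isRight _ = false

isUp⁻ : ∀ d → isUp d ≡ true → d ≡ up
isUp⁻ up _ = refl
isDown⁻ : ∀ d → isDown d ≡ true → d ≡ down
isDown⁻ down _ = refl
isLeft⁻ : ∀ d → isLeft d ≡ true → d ≡ left
isLeft⁻ left _ = refl
isRight⁻ : ∀ d → isRight d ≡ true → d ≡ right
isRight⁻ right _ = refl

-- `P` marks the cells whose domino continues into the next cell, `Q` those whose domino comes from
-- the preceding cell, and `p` plays the role of `P` for a cell before the line. The base case
-- forbids a domino to leave the line.
Chain : ∀ {m} → Bool → (Fin m → Bool) → (Fin m → Bool) → Set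
Chain {zero} p P Q = p ≡ false
Chain {suc m} p P Q = (Q zero ≡ p) × Chain (P zero) (P ∘ suc) (Q ∘ suc)

-- The same condition by positions, as `step` yields it. `start` provides the cell for a domino that
-- enters from before the line; with it the condition passes to the tail, where `P zero` becomes the
-- new `p`.
record Linked {m} (p : Bool) (P Q : Fin m → Bool) : Set where
  field
    forward : ∀ j → P j ≡ true → ∃ λ k → toℕ k ≡ suc (toℕ j) × Q k ≡ true
    backward : ∀ k → Q k ≡ true → (toℕ k ≡ 0 × p ≡ true) ⊎ ∃ λ j → toℕ k ≡ suc (toℕ j) × P j ≡ true
    start : p ≡ true → ∃ λ k → toℕ k ≡ 0 × Q k ≡ true
open Linked

linked⇒chain : ∀ {m} p (P Q : Fin m → Bool) → Linked p P Q → Chain p P Q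
linked⇒chain {zero} false P Q l = refl
linked⇒chain {zero} true P Q l with start l refl
... | () , _
linked⇒chain {suc m} p P Q l = Qp p l , linked⇒chain (P zero) (P ∘ suc) (Q ∘ suc) tail
  where
  Qp : ∀ p → Linked p P Q → Q zero ≡ p
  Qp true l with start l refl
  ... | zero , _ , q = q
  Qp false l with Q zero in eq
  ... | false = refl
  ... | true with backward l zero eq
  ... | inj₁ (_ , ())
  ... | inj₂ (_ , () , _)
  tail : Linked (P zero) (P ∘ suc) (Q ∘ suc)
  forward tail j Pj with forward l (suc j) Pj
  ... | suc k , e , q = k , ℕP.suc-injective e , q
  backward tail k Qk with backward l (suc k) Qk
  ... | inj₂ (zero , e , Pj) = inj₁ (ℕP.suc-injective e , Pj)
  ... | inj₂ (suc j , e , Pj) = inj₂ (j , ℕP.suc-injective e , Pj)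
  start tail Pz with forward l zero Pz
  ... | suc k , e , q = k , ℕP.suc-injective e , q

chain⇒linked : ∀ {m} p (P Q : Fin m → Bool) → Chain p P Q → Linked p P Q
forward (chain⇒linked {suc m} p P Q (_ , c)) zero Pz with start (chain⇒linked _ _ _ c) Pz
... | k , e , q = suc k , cong suc e , q
forward (chain⇒linked {suc m} p P Q (_ , c)) (suc j) Pj with forward (chain⇒linked _ _ _ c) j Pj
... | k , e , q = suc k , cong suc e , q
backward (chain⇒linked {suc m} p P Q (e , c)) zero Qz = inj₁ (refl , trans (sym e) Qz)
backward (chain⇒linked {suc m} p P Q (_ , c)) (suc k) Qk with backward (chain⇒linked _ _ _ c) k Qk
... | inj₁ (e , Pz) = inj₂ (zero , cong suc e , Pz)
... | inj₂ (j , e , Pj) = inj₂ (suc j , cong suc e , Pj)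
start (chain⇒linked {zero} true P Q ()) refl
start (chain⇒linked {suc m} p P Q (e , c)) refl = zero , refl , e

next-just : ∀ {m} (i k : Fin m) → next i ≡ just k → toℕ k ≡ suc (toℕ i)
next-just {m} i k e with suc (toℕ i) <? m
next-just i _ refl | yes p = toℕ-fromℕ< p

next-exists : ∀ {m} (i k : Fin m) → toℕ k ≡ suc (toℕ i) → next i ≡ just k
next-exists {m} i k e with suc (toℕ i) <? m
... | yes p = cong just (toℕ-injective (trans (toℕ-fromℕ< p) (sym e)))
... | no ¬p = ⊥-elim (¬p (subst (ℕ._< m) e (toℕ<n k)))

prev-just : ∀ {m} (k i : Fin m) → prev k ≡ just i → toℕ k ≡ suc (toℕ i)
prev-just (suc k) _ refl = cong suc (sym (toℕ-inject₁ k))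

prev-exists : ∀ {m} (k i : Fin m) → toℕ k ≡ suc (toℕ i) → prev k ≡ just i
prev-exists (suc k) i e = cong just (toℕ-injective (trans (toℕ-inject₁ k) (ℕP.suc-injective e)))

module _ {m : ℕ} (a : Assignment m) where

  Rows Columns : Set
  Rows = ∀ i → Chain false (λ j → isRight (a i j)) (λ j → isLeft (a i j))
  Columns = ∀ j → Chain false (λ i → isDown (a i j)) (λ i → isUp (a i j))

  private
    PartnerAt : Fin m → Fin m → Dir → Set
    PartnerAt i j d = PartnerOK a (step (i , j) d) d

    right-partner : ∀ i j → PartnerAt i j right → ∃ λ k → toℕ k ≡ suc (toℕ j) × isLeft (a i k) ≡ true
    right-partner i j p with next j in eq
    ... | just k = k , next-just j k eq , cong isLeft p
    left-partner : ∀ i j → PartnerAt i j left → ∃ λ k → toℕ j ≡ suc (toℕ k) × isRight (a i k) ≡ true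
    left-partner i j p with prev j in eq
    ... | just k = k , prev-just j k eq , cong isRight p
    down-partner : ∀ i j → PartnerAt i j down → ∃ λ k → toℕ k ≡ suc (toℕ i) × isUp (a k j) ≡ true
    down-partner i j p with next i in eq
    ... | just k = k , next-just i k eq , cong isUp p
    up-partner : ∀ i j → PartnerAt i j up → ∃ λ k → toℕ i ≡ suc (toℕ k) × isDown (a k j) ≡ true
    up-partner i j p with prev i in eq
    ... | just k = k , prev-just i k eq , cong isDown p

    partner-right : ∀ i j k → toℕ k ≡ suc (toℕ j) → isLeft (a i k) ≡ true → PartnerAt i j right
    partner-right i j k e q rewrite next-exists j k e = isLeft⁻ _ q
    partner-left : ∀ i j k → toℕ j ≡ suc (toℕ k) → isRight (a i k) ≡ true → PartnerAt i j left
    partner-left i j k e q rewrite prev-exists j k e = isRight⁻ _ q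
    partner-down : ∀ i j k → toℕ k ≡ suc (toℕ i) → isUp (a k j) ≡ true → PartnerAt i j down
    partner-down i j k e q rewrite next-exists i k e = isUp⁻ _ q
    partner-up : ∀ i j k → toℕ i ≡ suc (toℕ k) → isDown (a k j) ≡ true → PartnerAt i j up
    partner-up i j k e q rewrite prev-exists i k e = isDown⁻ _ q

  tiling⇒rows : IsTiling a → Rows
  tiling⇒rows t i = linked⇒chain false _ _ record
    { forward = λ j e → right-partner i j (subst (PartnerAt i j) (isRight⁻ _ e) (t i j))
    ; backward = λ j e → inj₂ (left-partner i j (subst (PartnerAt i j) (isLeft⁻ _ e) (t i j)))
    ; start = λ () }

  tiling⇒columns : IsTiling a → Columns
  tiling⇒columns t j = linked⇒chain false _ _ record
    { forward = λ i e → down-partner i j (subst (PartnerAt i j) (isDown⁻ _ e) (t i j))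
    ; backward = λ i e → inj₂ (up-partner i j (subst (PartnerAt i j) (isUp⁻ _ e) (t i j)))
    ; start = λ () }

  chains⇒tiling : Rows → Columns → IsTiling a
  chains⇒tiling r c i j with a i j in eq
  ... | up with backward (chain⇒linked _ _ _ (c j)) i (cong isUp eq)
  ... | inj₂ (k , e , q) = partner-up i j k e q
  chains⇒tiling r c i j | down with forward (chain⇒linked _ _ _ (c j)) i (cong isDown eq)
  ... | k , e , q = partner-down i j k e q
  chains⇒tiling r c i j | left with backward (chain⇒linked _ _ _ (r i)) j (cong isLeft eq)
  ... | inj₂ (k , e , q) = partner-left i j k e q
  chains⇒tiling r c i j | right with forward (chain⇒linked _ _ _ (r i)) j (cong isRight eq)
  ... | k , e , q = partner-right i j k e q

module Transfer (S : Alg) where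
  open AlgTheory S
  open Exterior S

  sumL : {A : Set} → List A → (A → Carrier) → Carrier
  sumL [] f = 0#
  sumL (x ∷ xs) f = f x + sumL xs f

  sumV : {A : Set} (k : ℕ) → List A → (Vec A k → Carrier) → Carrier
  sumV zero as q = q []
  sumV (suc k) as q = sumL as (λ x → sumV k as (λ v → q (x ∷ v)))

  sumL-cong : {A : Set} (xs : List A) {f f' : A → Carrier} → (∀ x → f x ≡ f' x) → sumL xs f ≡ sumL xs f'
  sumL-cong [] e = refl
  sumL-cong (x ∷ xs) e = cong₂ _+_ (e x) (sumL-cong xs e)

  sumL-zero : {A : Set} (xs : List A) → sumL xs (λ _ → 0#) ≡ 0#
  sumL-zero [] = refl
  sumL-zero (x ∷ xs) = trans (+-identityˡ _) (sumL-zero xs)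

  sumV-zero : {A : Set} (k : ℕ) (as : List A) → sumV k as (λ _ → 0#) ≡ 0#
  sumV-zero zero as = refl
  sumV-zero (suc k) as = trans (sumL-cong as (λ _ → sumV-zero k as)) (sumL-zero as)

  sumL-++ : {A : Set} (xs ys : List A) (f : A → Carrier) → sumL (xs ++ ys) f ≡ sumL xs f + sumL ys f
  sumL-++ [] ys f = sym (+-identityˡ _)
  sumL-++ (x ∷ xs) ys f = trans (addˡ (f x) (sumL-++ xs ys f)) (sym (+-assoc _ _ _))

  sumL-map : {A B : Set} (c : A → B) (xs : List A) (f : B → Carrier) → sumL (map c xs) f ≡ sumL xs (f ∘ c)
  sumL-map c [] f = refl
  sumL-map c (x ∷ xs) f = addˡ _ (sumL-map c xs f)

  sumL-concatMap : {A B C : Set} (c : A → B → C) (xs : List A) (ys : List B) (f : C → Carrier) →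
    sumL (concatMap (λ x → map (c x) ys) xs) f ≡ sumL xs (λ x → sumL ys (λ y → f (c x y)))
  sumL-concatMap c [] ys f = refl
  sumL-concatMap c (x ∷ xs) ys f = trans (sumL-++ (map (c x) ys) _ f)
    (cong₂ _+_ (sumL-map (c x) ys f) (sumL-concatMap c xs ys f))

  -- The summand depends on a function only through its table, since functions with equal values
  -- need not be propositionally equal.
  sumL-allFuns : {A : Set} (k : ℕ) (as : List A) (q : Vec A k → Carrier) →
    sumL (allFuns k as) (λ f → q (tabulate f)) ≡ sumV k as q
  sumL-allFuns zero as q = +-identityʳ _
  sumL-allFuns (suc k) as q = trans (sumL-concatMap _ as (allFuns k as) (λ f → q (tabulate f)))
    (sumL-cong as (λ x → sumL-allFuns k as (λ v → q (x ∷ v))))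

  -- The state after a cell with entry d whose predecessor does (does not) point right and that is (is
  -- not) the lower end of a vertical domino: whether it points right, and whether it points down.
  cell : Bool → Bool → Dir → Maybe (Bool × Bool)
  cell false true up = just (false , false)
  cell false false down = just (false , true)
  cell false false right = just (true , false)
  cell true false left = just (false , false)
  cell _ _ _ = nothing

  guarded : Maybe (Bool × Bool) → (Bool → Bool → Carrier) → Carrier
  guarded nothing f = 0#
  guarded (just (p , b)) f = f p b

  -- In continuation style: `φ` is evaluated at the pattern of downward cells handed to the next
  -- row, and a row that does not fit contributes 0.
  rowWeight : ∀ {m} → Bool → Vec Bool m → Vec Dir m → (Vec Bool m → Carrier) → Carrier
  rowWeight p [] [] φ = if p then 0# else φ []
  rowWeight p (b ∷ s) (d ∷ w) φ = guarded (cell p b d) (λ p' b' → rowWeight p' s w (φ ∘ (b' ∷_)))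

  noneSet : ∀ {m} → Vec Bool m → Carrier
  noneSet [] = 1#
  noneSet (true ∷ s) = 0#
  noneSet (false ∷ s) = noneSet s

  weight : ∀ {m k} → Vec Bool m → Vec (Vec Dir m) k → Carrier
  weight s [] = noneSet s
  weight s (w ∷ ws) = rowWeight false s w (λ s' → weight s' ws)

  RowFits : ∀ {m} → Bool → Vec Bool m → (Fin m → Dir) → Set
  RowFits p s r = Chain p (isRight ∘ r) (isLeft ∘ r) × (∀ j → isUp (r j) ≡ lookup s j)

  rowWeight-yes : ∀ {m} p (s : Vec Bool m) (r : Fin m → Dir) φ → RowFits p s r →
    rowWeight p s (tabulate r) φ ≡ φ (tabulate (isDown ∘ r))
  rowWeight-yes {zero} .false [] r φ (refl , _) = refl
  rowWeight-yes {suc m} p (b ∷ s) r φ ((e , c) , u) with r zero | u zero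
  rowWeight-yes {suc m} .false (.true ∷ s) r φ ((refl , c) , u) | up | refl = rowWeight-yes false s
    (r ∘ suc) _ (c , u ∘ suc)
  rowWeight-yes {suc m} .false (.false ∷ s) r φ ((refl , c) , u) | down | refl = rowWeight-yes false s
    (r ∘ suc) _ (c , u ∘ suc)
  rowWeight-yes {suc m} .true (.false ∷ s) r φ ((refl , c) , u) | left | refl = rowWeight-yes false s
    (r ∘ suc) _ (c , u ∘ suc)
  rowWeight-yes {suc m} .false (.false ∷ s) r φ ((refl , c) , u) | right | refl = rowWeight-yes true s
    (r ∘ suc) _ (c , u ∘ suc)

  cell-just : ∀ p b d {p' b'} → cell p b d ≡ just (p' , b') → isLeft d ≡ p × isUp d ≡ b × isRight d ≡ p'
  cell-just false true up refl = refl , refl , refl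
  cell-just false false down refl = refl , refl , refl
  cell-just false false right refl = refl , refl , refl
  cell-just true false left refl = refl , refl , refl

  rowWeight-dichotomy : ∀ {m} p (s : Vec Bool m) (r : Fin m → Dir) →
    RowFits p s r ⊎ (∀ φ → rowWeight p s (tabulate r) φ ≡ 0#)
  rowWeight-dichotomy {zero} false [] r = inj₁ (refl , λ ())
  rowWeight-dichotomy {zero} true [] r = inj₂ (λ φ → refl)
  rowWeight-dichotomy {suc m} p (b ∷ s) r with cell p b (r zero) in eq
  ... | nothing = inj₂ (λ φ → refl)
  ... | just (p' , b') with cell-just p b (r zero) eq | rowWeight-dichotomy p' s (r ∘ suc)
  ... | _ | inj₂ z = inj₂ (λ φ → z _)
  ... | l , u , refl | inj₁ (c , us) = inj₁ ((l , c) , λ { zero → u ; (suc j) → us j })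

  words : ∀ {m k} → (Fin k → Fin m → Dir) → Vec (Vec Dir m) k
  words a = tabulate (λ i → tabulate (a i))

  Fits : ∀ {m k} → Vec Bool m → (Fin k → Fin m → Dir) → Set
  Fits s a = (∀ i → Chain false (λ j → isRight (a i j)) (λ j → isLeft (a i j))) ×
             (∀ j → Chain (lookup s j) (λ i → isDown (a i j)) (λ i → isUp (a i j)))

  noneSet-yes : ∀ {m} (s : Vec Bool m) → (∀ j → lookup s j ≡ false) → noneSet s ≡ 1#
  noneSet-yes [] e = refl
  noneSet-yes (false ∷ s) e = noneSet-yes s (e ∘ suc)
  noneSet-yes (true ∷ s) e with e zero
  ... | ()

  noneSet-dichotomy : ∀ {m} (s : Vec Bool m) → (∀ j → lookup s j ≡ false) ⊎ noneSet s ≡ 0#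
  noneSet-dichotomy [] = inj₁ λ ()
  noneSet-dichotomy (true ∷ s) = inj₂ refl
  noneSet-dichotomy (false ∷ s) with noneSet-dichotomy s
  ... | inj₁ e = inj₁ λ { zero → refl ; (suc j) → e j }
  ... | inj₂ z = inj₂ z

  weight-yes : ∀ {m k} (s : Vec Bool m) (a : Fin k → Fin m → Dir) → Fits s a → weight s (words a) ≡ 1#
  weight-yes {k = zero} s a (_ , c) = noneSet-yes s c
  weight-yes {k = suc k} s a (r , c) = trans (rowWeight-yes false s (a zero) _ (r zero , proj₁ ∘ c))
    (weight-yes _ (a ∘ suc) (r ∘ suc , λ j → subst (λ b → Chain b _ _)
      (sym (lookup∘tabulate (isDown ∘ a zero) j)) (proj₂ (c j))))

  weight-dichotomy : ∀ {m k} (s : Vec Bool m) (a : Fin k → Fin m → Dir) → Fits s a ⊎ weight s (words a) ≡ 0#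
  weight-dichotomy {k = zero} s a with noneSet-dichotomy s
  ... | inj₁ e = inj₁ ((λ ()) , e)
  ... | inj₂ z = inj₂ z
  weight-dichotomy {k = suc k} s a with rowWeight-dichotomy false s (a zero)
  ... | inj₂ z = inj₂ (z _)
  ... | inj₁ (r , u) with weight-dichotomy (tabulate (isDown ∘ a zero)) (a ∘ suc)
  ... | inj₁ (rs , c) = inj₁ ((λ { zero → r ; (suc i) → rs i }) ,
    λ j → u j , subst (λ b → Chain b _ _) (lookup∘tabulate (isDown ∘ a zero) j) (c j))
  ... | inj₂ z = inj₂ (trans (rowWeight-yes false s (a zero) _ (r , u)) z)

  count-filter : {A : Set} {P : A → Set} (P? : ∀ x → Dec (P x)) (w : A → Carrier) →
    (∀ x → P x → w x ≡ 1#) → (∀ x → ¬ P x → w x ≡ 0#) →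
    ∀ xs → ι (+ length (filter P? xs)) ≡ sumL xs w
  count-filter P? w w1 w0 [] = ι-0
  count-filter P? w w1 w0 (x ∷ xs) with P? x
  ... | yes p = trans (ι-+ (+ 1) (+ length (filter P? xs)))
    (cong₂ _+_ (trans ι-1 (sym (w1 x p))) (count-filter P? w w1 w0 xs))
  ... | no ¬p = trans (count-filter P? w w1 w0 xs) (trans (sym (+-identityˡ _))
    (cong (_+ sumL xs w) (sym (w0 x ¬p))))

  completions : ∀ {m} → ℕ → Vec Bool m → Carrier
  completions zero s = noneSet s
  completions {m} (suc k) s = sumV m allDirs (λ w → rowWeight false s w (completions k))

  rowWeight-cong : ∀ {m} p (s : Vec Bool m) w {φ ψ : Vec Bool m → Carrier} → (∀ s' → φ s' ≡ ψ s') →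
    rowWeight p s w φ ≡ rowWeight p s w ψ
  rowWeight-cong false [] [] e = e []
  rowWeight-cong true [] [] e = refl
  rowWeight-cong p (b ∷ s) (d ∷ w) e with cell p b d
  ... | nothing = refl
  ... | just (p' , b') = rowWeight-cong p' s w (λ s' → e _)

  rowWeight-sum : ∀ {A : Set} {m} k (as : List A) p (s : Vec Bool m) w (F : Vec A k → Vec Bool m → Carrier) →
    sumV k as (λ v → rowWeight p s w (F v)) ≡ rowWeight p s w (λ s' → sumV k as (λ v → F v s'))
  rowWeight-sum k as false [] [] F = refl
  rowWeight-sum k as true [] [] F = sumV-zero k as
  rowWeight-sum k as p (b ∷ s) (d ∷ w) F with cell p b d
  ... | nothing = sumV-zero k as
  ... | just (p' , b') = rowWeight-sum k as p' s w _

  -- The sum over the later rows moves into the continuation of the first row, because `rowWeight`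
  -- is linear in it. This is the transfer-matrix recursion.
  sum-weights : ∀ {m} k (s : Vec Bool m) →
    sumV k (allFuns m allDirs) (λ v → weight s (Vec.map tabulate v)) ≡ completions k s
  sum-weights zero s = refl
  sum-weights {m} (suc k) s = trans
    (sumL-cong (allFuns m allDirs) (λ r → trans
      (rowWeight-sum k (allFuns m allDirs) false s (tabulate r) (λ v s' → weight s' (Vec.map tabulate v)))
      (rowWeight-cong false s (tabulate r) (sum-weights k))))
    (sumL-allFuns m allDirs (λ w → rowWeight false s w (completions k)))

  tilings-completions : ∀ m → ι (+ tilings m) ≡ completions m (replicate m false)
  tilings-completions m = trans
    (count-filter isTiling? (λ a → weight (replicate m false) (Vec.map tabulate (tabulate a)))
      (λ a t → trans (weight-tabulate a) (weight-yes _ a (tiling⇒rows a t ,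
        λ j → subst (λ b → Chain b _ _) (sym (lookup-replicate j false)) (tiling⇒columns a t j))))
      (λ a ¬t → trans (weight-tabulate a) (weight-no a ¬t))
      (allAssignments m))
    (trans (sumL-allFuns m (allFuns m allDirs) (λ v → weight (replicate m false) (Vec.map tabulate v)))
      (sum-weights m (replicate m false)))
    where
    weight-tabulate : ∀ a → weight (replicate m false) (Vec.map tabulate (tabulate a)) ≡ weight
      (replicate m false) (words a)
    weight-tabulate a = cong (weight (replicate m false)) (sym (tabulate-∘ tabulate a))
    weight-no : ∀ a → ¬ IsTiling a → weight (replicate m false) (words a) ≡ 0#
    weight-no a ¬t with weight-dichotomy (replicate m false) a
    ... | inj₂ z = z
    ... | inj₁ (r , c) = ⊥-elim (¬t (chains⇒tiling a r
      (λ j → subst (λ b → Chain b _ _) (lookup-replicate j false) (c j))))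

  -- Particle configurations: in encE the sites 0, 2, 4, … carry a particle when set and the sites
  -- 1, 3, 5, … when not set; in encO the roles are exchanged.
  encE encO : ∀ {m} → (Vec Bool m → Carrier) → Λ m
  encE {zero} φ = ⟨ φ [] ⟩
  encE {suc m} φ = encO (φ ∘ (false ∷_)) ∣ encO (φ ∘ (true ∷_))
  encO {zero} φ = ⟨ φ [] ⟩
  encO {suc m} φ = encE (φ ∘ (true ∷_)) ∣ encE (φ ∘ (false ∷_))

  encE-cong : ∀ {m} {φ ψ : Vec Bool m → Carrier} → (∀ s → φ s ≡ ψ s) → encE φ ≡ encE ψ
  encO-cong : ∀ {m} {φ ψ : Vec Bool m → Carrier} → (∀ s → φ s ≡ ψ s) → encO φ ≡ encO ψ
  encE-cong {zero} e = cong ⟨_⟩ (e [])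
  encE-cong {suc m} e = cong₂ _∣_ (encO-cong (λ s → e _)) (encO-cong (λ s → e _))
  encO-cong {zero} e = cong ⟨_⟩ (e [])
  encO-cong {suc m} e = cong₂ _∣_ (encE-cong (λ s → e _)) (encE-cong (λ s → e _))

  encE-+ : ∀ {m} (φ ψ : Vec Bool m → Carrier) → encE (λ s → φ s + ψ s) ≡ encE φ ⊕ encE ψ
  encO-+ : ∀ {m} (φ ψ : Vec Bool m → Carrier) → encO (λ s → φ s + ψ s) ≡ encO φ ⊕ encO ψ
  encE-+ {zero} φ ψ = refl
  encE-+ {suc m} φ ψ = cong₂ _∣_ (encO-+ _ _) (encO-+ _ _)
  encO-+ {zero} φ ψ = refl
  encO-+ {suc m} φ ψ = cong₂ _∣_ (encE-+ _ _) (encE-+ _ _)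

  encE-0 : ∀ {m} → encE {m} (λ _ → 0#) ≡ 𝟘
  encO-0 : ∀ {m} → encO {m} (λ _ → 0#) ≡ 𝟘
  encE-0 {zero} = refl
  encE-0 {suc m} = cong₂ _∣_ encO-0 encO-0
  encO-0 {zero} = refl
  encO-0 {suc m} = cong₂ _∣_ encE-0 encE-0

  rowSum : ∀ {m} → Bool → (Vec Bool m → Carrier) → Vec Bool m → Carrier
  rowSum {m} p φ s = sumV m allDirs (λ w → rowWeight p s w φ)

  private
    four-sum : ∀ {a b c d a' b' c' d'} → a ≡ a' → b ≡ b' → c ≡ c' → d ≡ d' →
      a + (b + (c + (d + 0#))) ≡ a' + (b' + (c' + d'))
    four-sum refl refl refl refl = cong (λ t → _ + (_ + (_ + t))) (+-identityʳ _)

  rowSum-up : ∀ {m} (φ : Vec Bool (suc m) → Carrier) s → rowSum false φ (true ∷ s) ≡ rowSum false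
    (φ ∘ (false ∷_)) s
  rowSum-up {m} φ s = trans (four-sum refl (sumV-zero m _) (sumV-zero m _) (sumV-zero m _))
    (trans (addˡ _ (trans (+-identityˡ _) (+-identityˡ _))) (+-identityʳ _))

  rowSum-free : ∀ {m} (φ : Vec Bool (suc m) → Carrier) s →
    rowSum false φ (false ∷ s) ≡ rowSum false (φ ∘ (true ∷_)) s + rowSum true (φ ∘ (false ∷_)) s
  rowSum-free {m} φ s = trans (four-sum (sumV-zero m _) refl (sumV-zero m _) refl)
    (trans (+-identityˡ _) (addˡ _ (+-identityˡ _)))

  rowSum-left : ∀ {m} (φ : Vec Bool (suc m) → Carrier) s → rowSum true φ (false ∷ s) ≡ rowSum false
    (φ ∘ (false ∷_)) s
  rowSum-left {m} φ s = trans (four-sum (sumV-zero m _) (sumV-zero m _) refl (sumV-zero m _))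
    (trans (+-identityˡ _) (trans (+-identityˡ _) (+-identityʳ _)))

  rowSum-blocked : ∀ {m} (φ : Vec Bool (suc m) → Carrier) s → rowSum true φ (true ∷ s) ≡ 0#
  rowSum-blocked {m} φ s = trans (four-sum (sumV-zero m _) (sumV-zero m _) (sumV-zero m _) (sumV-zero m _))
    (trans (+-identityˡ _) (trans (+-identityˡ _) (+-identityˡ _)))

  -- The encoding alternates from row to row, so a vertical domino leaves its site unchanged, while
  -- a horizontal one, covering a particle and a hole, moves the particle by one site. `rowSum`
  -- pulls functions of the next state back to the present one, so the particles move from the sites
  -- of the next state to those of the present state: from even sites under `H`, from odd sites
  -- under `G`.
  encE-rowSum : ∀ {m} (φ : Vec Bool m → Carrier) → encE (rowSum false φ) ≡ H (encO φ)
  encO-rowSum : ∀ {m} (φ : Vec Bool m → Carrier) → encO (rowSum false φ) ≡ G (encE φ)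
  encE-rowSumᵖ : ∀ {m} (φ : Vec Bool m → Carrier) → encE (rowSum true φ) ≡ Hᵖ (encO φ)
  encO-rowSumᵖ : ∀ {m} (φ : Vec Bool m → Carrier) → encO (rowSum true φ) ≡ Gᵖ (encE φ)
  encE-rowSum {zero} φ = refl
  encE-rowSum {suc m} φ = cong₂ _∣_
    (trans (encO-cong (rowSum-free φ)) (trans (encO-+ _ _) (cong₂ _⊕_ (encO-rowSum _) (encO-rowSumᵖ _))))
    (trans (encO-cong (rowSum-up φ)) (encO-rowSum _))
  encO-rowSum {zero} φ = refl
  encO-rowSum {suc m} φ = cong₂ _∣_
    (trans (encE-cong (rowSum-up φ)) (encE-rowSum _))
    (trans (encE-cong (rowSum-free φ)) (trans (encE-+ _ _) (cong₂ _⊕_ (encE-rowSum _) (encE-rowSumᵖ _))))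
  encE-rowSumᵖ {zero} φ = refl
  encE-rowSumᵖ {suc m} φ = cong₂ _∣_
    (trans (encO-cong (rowSum-left φ)) (encO-rowSum _))
    (trans (encO-cong (rowSum-blocked φ)) encO-0)
  encO-rowSumᵖ {zero} φ = refl
  encO-rowSumᵖ {suc m} φ = cong₂ _∣_
    (trans (encE-cong (rowSum-blocked φ)) encE-0)
    (trans (encE-cong (rowSum-left φ)) (encE-rowSum _))

-- Reduction to the even sites and an n × n determinant

dbl : ℕ → ℕ
dbl zero = zero
dbl (suc n) = suc (suc (dbl n))

dbl≡2* : ∀ n → dbl n ≡ 2 ℕ.* n
dbl≡2* zero = refl
dbl≡2* (suc n) = cong suc (trans (cong suc (dbl≡2* n)) (sym (ℕP.+-suc n (n ℕ.+ 0))))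

module Square (S : Alg) where
  open AlgTheory S
  open Exterior S
  open Transfer S

  +v-assoc : ∀ {m} (u v w : V m) → (u +v v) +v w ≡ u +v (v +v w)
  +v-assoc [] [] [] = refl
  +v-assoc (a ∷ u) (b ∷ v) (c ∷ w) = cong₂ _∷_ (+-assoc a b c) (+v-assoc u v w)

  +v-comm : ∀ {m} (u v : V m) → u +v v ≡ v +v u
  +v-comm [] [] = refl
  +v-comm (a ∷ u) (b ∷ v) = cong₂ _∷_ (+-comm a b) (+v-comm u v)

  +v-identityˡ : ∀ {m} (u : V m) → 0v +v u ≡ u
  +v-identityˡ [] = refl
  +v-identityˡ (a ∷ u) = cong₂ _∷_ (+-identityˡ a) (+v-identityˡ u)

  +v-identityʳ : ∀ {m} (u : V m) → u +v 0v ≡ u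
  +v-identityʳ u = trans (+v-comm u 0v) (+v-identityˡ u)

  +v-interchange : ∀ {m} (x y z w : V m) → (x +v y) +v (z +v w) ≡ (x +v z) +v (y +v w)
  +v-interchange [] [] [] [] = refl
  +v-interchange (x ∷ x') (y ∷ y') (z ∷ z') (w ∷ w') = cong₂ _∷_
    (solve 4 (λ x y z w → (x :+ y) :+ (z :+ w) := (x :+ z) :+ (y :+ w)) refl x y z w)
      (+v-interchange x' y' z' w')

  ·v-0v : ∀ {m} c → c ·v 0v {m} ≡ 0v
  ·v-0v {zero} c = refl
  ·v-0v {suc m} c = cong₂ _∷_ (zeroʳ c) (·v-0v c)

  ·v-+v : ∀ {m} c (u v : V m) → c ·v (u +v v) ≡ (c ·v u) +v (c ·v v)
  ·v-+v c [] [] = refl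
  ·v-+v c (a ∷ u) (b ∷ v) = cong₂ _∷_ (distribˡ c a b) (·v-+v c u v)

  +-·v : ∀ {m} a b (v : V m) → (a + b) ·v v ≡ (a ·v v) +v (b ·v v)
  +-·v a b [] = refl
  +-·v a b (x ∷ v) = cong₂ _∷_ (distribʳ x a b) (+-·v a b v)

  *-·v : ∀ {m} a b (v : V m) → (a * b) ·v v ≡ a ·v b ·v v
  *-·v a b [] = refl
  *-·v a b (x ∷ v) = cong₂ _∷_ (*-assoc a b x) (*-·v a b v)

  ·v-comm : ∀ {m} a b (v : V m) → a ·v b ·v v ≡ b ·v a ·v v
  ·v-comm a b v = trans (sym (*-·v a b v)) (trans (cong (_·v v) (*-comm a b)) (*-·v b a v))

  1-·v : ∀ {m} (v : V m) → 1# ·v v ≡ v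
  1-·v [] = refl
  1-·v (x ∷ v) = cong₂ _∷_ (*-identityˡ x) (1-·v v)

  0-·v : ∀ {m} (v : V m) → 0# ·v v ≡ 0v
  0-·v [] = refl
  0-·v (x ∷ v) = cong₂ _∷_ (zeroˡ x) (0-·v v)

  -- `K` and `J` are the blocks of `h` and `g` between even and odd sites. Their product B is
  -- tridiagonal, with ones beside the diagonal and twos on it except for a one in the first place;
  -- V_n is the characteristic polynomial of B - 2.
  J K B : ∀ {m} → V m → V m
  J [] = []
  J (a ∷ v) = a ∷ ((a ·v e₀) +v J v)
  K [] = []
  K (a ∷ v) = (a + hd v) ∷ K v
  B v = J (K v)

  hd-+ : ∀ {m} (u v : V m) → hd (u +v v) ≡ hd u + hd v
  hd-+ [] [] = sym (+-identityʳ 0#)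
  hd-+ (a ∷ u) (b ∷ v) = refl

  hd-· : ∀ {m} c (v : V m) → hd (c ·v v) ≡ c * hd v
  hd-· c [] = sym (zeroʳ c)
  hd-· c (a ∷ v) = refl

  J-+ : ∀ {m} (u v : V m) → J (u +v v) ≡ J u +v J v
  J-+ [] [] = refl
  J-+ (a ∷ u) (b ∷ v) = cong ((a + b) ∷_)
    (trans (cong₂ _+v_ (+-·v a b e₀) (J-+ u v)) (+v-interchange _ _ _ _))

  K-+ : ∀ {m} (u v : V m) → K (u +v v) ≡ K u +v K v
  K-+ [] [] = refl
  K-+ (a ∷ u) (b ∷ v) = cong₂ _∷_
    (trans (addˡ (a + b) (hd-+ u v)) (solve 4 (λ x y z w → (x :+ y) :+ (z :+ w) := (x :+ z) :+ (y :+ w)) refl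
      a b (hd u) (hd v)))
    (K-+ u v)

  J-· : ∀ {m} c (v : V m) → J (c ·v v) ≡ c ·v J v
  J-· c [] = refl
  J-· c (a ∷ v) = cong ((c * a) ∷_)
    (trans (cong₂ _+v_ (*-·v c a e₀) (J-· c v)) (sym (·v-+v c _ _)))

  K-· : ∀ {m} c (v : V m) → K (c ·v v) ≡ c ·v K v
  K-· c [] = refl
  K-· c (a ∷ v) = cong₂ _∷_ (trans (addˡ (c * a) (hd-· c v)) (sym (distribˡ c a (hd v)))) (K-· c v)

  B-+ : ∀ {m} (u v : V m) → B (u +v v) ≡ B u +v B v
  B-+ u v = trans (cong J (K-+ u v)) (J-+ _ _)

  B-· : ∀ {m} c (v : V m) → B (c ·v v) ≡ c ·v B v
  B-· c v = trans (cong J (K-· c v)) (J-· c _)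

  mix : ∀ {n} → V n → V n → V (dbl n)
  mix [] [] = []
  mix (a ∷ w) (b ∷ c) = a ∷ b ∷ mix w c

  hd-mix : ∀ {n} (w b : V n) → hd (mix w b) ≡ hd w
  hd-mix [] [] = refl
  hd-mix (a ∷ w) (b ∷ c) = refl

  mix-e₀ : ∀ {n} a (u c : V n) → (a ·v e₀) +v mix u c ≡ mix ((a ·v e₀) +v u) c
  mix-e₀ a [] [] = refl
  mix-e₀ {suc n} a (x ∷ u) (y ∷ c) = cong₂ _∷_ refl (cong₂ _∷_ (trans (cong (_+ y) (zeroʳ a)) (+-identityˡ y))
    (trans (cong (_+v mix u c) (·v-0v {dbl n} a)) (trans (+v-identityˡ _)
      (cong (λ t → mix t c) (sym (trans (cong (_+v u) (·v-0v a)) (+v-identityˡ u)))))))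

  h-mix : ∀ {n} (w b : V n) → h (mix w b) ≡ mix w (b +v K w)
  h-mix [] [] = refl
  h-mix {suc n} (a ∷ w) (b ∷ c) = cong₂ _∷_ refl (cong₂ _∷_
    (trans (cong (λ t → a * 1# + (b + t)) (hd-mix w c))
      (trans (cong (_+ (b + hd w)) (*-identityʳ a))
        (solve 3 (λ a b k → a :+ (b :+ k) := b :+ (a :+ k)) refl a b (hd w))))
    (trans (cong (_+v h (mix w c)) (·v-0v {dbl n} a)) (trans (+v-identityˡ _) (h-mix w c))))

  g-mix : ∀ {n} (w b : V n) → g (mix w b) ≡ mix (w +v J b) b
  g-mix [] [] = refl
  g-mix (a ∷ w) (b ∷ c) = cong₂ _∷_ refl (cong₂ _∷_ refl
    (trans (cong ((b ·v e₀) +v_) (g-mix w c)) (trans (mix-e₀ b (w +v J c) c)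
      (cong (λ t → mix t c) (trans (sym (+v-assoc _ w _))
        (trans (cong (_+v J c) (+v-comm _ w)) (+v-assoc w _ _)))))))

  spread : ∀ {n} → Λ n → Λ (dbl n)
  spread ⟨ x ⟩ = ⟨ x ⟩
  spread (x ∣ y) = (spread x ∣ 𝟘) ∣ (spread y ∣ 𝟘)

  spread-𝟘 : ∀ {n} → spread (𝟘 {n}) ≡ 𝟘
  spread-𝟘 {zero} = refl
  spread-𝟘 {suc n} = cong₂ _∣_ (cong₂ _∣_ spread-𝟘 refl) (cong₂ _∣_ spread-𝟘 refl)

  spread-𝟙 : ∀ {n} → spread (𝟙 {n}) ≡ 𝟙
  spread-𝟙 {zero} = refl
  spread-𝟙 {suc n} = cong₂ _∣_ (cong₂ _∣_ spread-𝟙 refl) (cong₂ _∣_ spread-𝟘 refl)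

  spread-⊕ : ∀ {n} (x y : Λ n) → spread (x ⊕ y) ≡ spread x ⊕ spread y
  spread-⊕ ⟨ x ⟩ ⟨ y ⟩ = refl
  spread-⊕ (x ∣ x') (y ∣ y') = cong₂ _∣_ (cong₂ _∣_ (spread-⊕ x y) (sym (⊕-identityʳ 𝟘)))
    (cong₂ _∣_ (spread-⊕ x' y') (sym (⊕-identityʳ 𝟘)))

  spread-· : ∀ {n} c (x : Λ n) → spread (c · x) ≡ c · spread x
  spread-· c ⟨ x ⟩ = refl
  spread-· c (x ∣ y) = cong₂ _∣_ (cong₂ _∣_ (spread-· c x) (sym (·-𝟘 c)))
    (cong₂ _∣_ (spread-· c y) (sym (·-𝟘 c)))

  private
    zero-tail : ∀ {m} (u : V m) (x : Λ m) → 0# · x ⊕ m1 · u ∧ 𝟘 ≡ 𝟘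
    zero-tail u x = trans (cong₂ _⊕_ (0-· x) (trans (cong (m1 ·_) (∧-𝟘 u)) (·-𝟘 m1))) (⊕-identityʳ 𝟘)

  spread-∧ : ∀ {n} (v : V n) x → spread (v ∧ x) ≡ mix v 0v ∧ spread x
  spread-∧ [] ⟨ x ⟩ = refl
  spread-∧ (a ∷ v) (x ∣ y) = cong₂ _∣_
    (cong₂ _∣_ (spread-∧ v x) (sym (zero-tail _ _)))
    (cong₂ _∣_
      (trans (spread-⊕ _ _) (cong₂ _⊕_ (spread-· a x) (trans (spread-· m1 _) (cong (m1 ·_) (spread-∧ v y)))))
      (sym (trans (cong₂ _⊕_ (·-𝟘 a) (trans (cong (m1 ·_) (zero-tail _ _)) (·-𝟘 m1))) (⊕-identityʳ 𝟘))))

  extract : ∀ {n} → Λ (dbl n) → Λ n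
  extract {zero} x = x
  extract {suc n} ((x ∣ _) ∣ (y ∣ _)) = extract x ∣ extract y

  extract-⊕ : ∀ {n} (x y : Λ (dbl n)) → extract {n} (x ⊕ y) ≡ extract x ⊕ extract y
  extract-⊕ {zero} x y = refl
  extract-⊕ {suc n} ((x ∣ _) ∣ (x' ∣ _)) ((y ∣ _) ∣ (y' ∣ _)) = cong₂ _∣_ (extract-⊕ x y) (extract-⊕ x' y')

  extract-· : ∀ {n} c (x : Λ (dbl n)) → extract {n} (c · x) ≡ c · extract x
  extract-· {zero} c x = refl
  extract-· {suc n} c ((x ∣ _) ∣ (y ∣ _)) = cong₂ _∣_ (extract-· c x) (extract-· c y)

  extract-𝟘 : ∀ {n} → extract {n} 𝟘 ≡ 𝟘
  extract-𝟘 {zero} = refl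
  extract-𝟘 {suc n} = cong₂ _∣_ extract-𝟘 extract-𝟘

  extract-𝟙 : ∀ {n} → extract {n} 𝟙 ≡ 𝟙
  extract-𝟙 {zero} = refl
  extract-𝟙 {suc n} = cong₂ _∣_ extract-𝟙 extract-𝟘

  extract-∧ : ∀ {n} (v w : V n) x → extract (mix v w ∧ x) ≡ v ∧ extract x
  extract-∧ [] [] ⟨ x ⟩ = refl
  extract-∧ (a ∷ v) (b ∷ w) ((x ∣ _) ∣ (y ∣ _)) = cong₂ _∣_ (extract-∧ v w x)
    (trans (extract-⊕ _ _) (cong₂ _⊕_ (extract-· a x) (trans (extract-· m1 _)
      (cong (m1 ·_) (extract-∧ v w y)))))

  wedge : ∀ {m} → List (V m) → Λ m
  wedge = foldr _∧_ 𝟙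

  wedge-hom : ∀ {m k} (F : Λ m → Λ k) (f : V m → V k) → F 𝟙 ≡ 𝟙 → (∀ v x → F (v ∧ x) ≡ f v ∧ F x) →
    ∀ vs → F (wedge vs) ≡ wedge (map f vs)
  wedge-hom F f F1 F∧ [] = F1
  wedge-hom F f F1 F∧ (v ∷ vs) = trans (F∧ v _) (cong (f v ∧_) (wedge-hom F f F1 F∧ vs))

  GH : ∀ {m} → ℕ → Λ m → Λ m
  GH zero x = x
  GH (suc k) x = G (H (GH k x))

  gh : ∀ {m} → ℕ → V m → V m
  gh zero v = v
  gh (suc k) v = g (h (gh k v))

  GH-𝟙 : ∀ {m} k → GH k (𝟙 {m}) ≡ 𝟙
  GH-𝟙 zero = refl
  GH-𝟙 (suc k) = trans (cong (λ t → G (H t)) (GH-𝟙 k)) (trans (cong G H-𝟙) G-𝟙)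

  GH-∧ : ∀ {m} k (v : V m) x → GH k (v ∧ x) ≡ gh k v ∧ GH k x
  GH-∧ zero v x = refl
  GH-∧ (suc k) v x = trans (cong (λ t → G (H t)) (GH-∧ k v x)) (trans (cong G (H-∧ _ _)) (G-∧ _ _))

  -- The even and odd parts of (gh)ᵏ applied to a vector supported on the even sites.
  walk : ∀ {n} → ℕ → V n → V n × V n
  walk zero v = v , 0v
  walk (suc k) v = proj₁ (walk k v) +v J (proj₂ (walk k v) +v K (proj₁ (walk k v))) , proj₂ (walk k v) +v K
    (proj₁ (walk k v))

  gh-mix : ∀ {n} k (v : V n) → gh k (mix v 0v) ≡ mix (proj₁ (walk k v)) (proj₂ (walk k v))
  gh-mix zero v = refl
  gh-mix (suc k) v = trans (cong (λ t → g (h t)) (gh-mix k v)) (trans (cong g (h-mix _ _)) (g-mix _ _))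

  -- With no cell set, exactly the even sites carry particles. This holds above the first row and
  -- below the last, so only the even-even block of the transfer enters the count.
  encO-noneSet : ∀ n → encO {dbl n} noneSet ≡ spread volume
  encO-noneSet zero = refl
  encO-noneSet (suc n) = cong₂ _∣_
    (trans encE-0 (cong₂ _∣_ (sym spread-𝟘) refl))
    (cong₂ _∣_ (encO-noneSet n) encO-0)

  encO-completions : ∀ {m} k → encO {m} (completions (dbl k)) ≡ GH k (encO noneSet)
  encO-completions zero = refl
  encO-completions (suc k) = trans (encO-rowSum _) (cong G
    (trans (encE-rowSum _) (cong H (encO-completions k))))

  top-extract : ∀ n (φ : Vec Bool (dbl n) → Carrier) → top (extract {n} (encO φ)) ≡ φ (replicate (dbl n) false)
  top-extract zero φ = refl
  top-extract (suc n) φ = top-extract n (λ s → φ (false ∷ false ∷ s))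

  extract-walk : ∀ {n} k (vs : List (V n)) → extract (wedge (map (λ v → gh k (mix v 0v)) vs)) ≡ wedge
    (map (λ v → proj₁ (walk k v)) vs)
  extract-walk k [] = extract-𝟙
  extract-walk {n} k (v ∷ vs) = trans (cong (λ t → extract {n} (t ∧ wedge (map (λ v → gh k (mix v 0v)) vs)))
    (gh-mix k v))
    (trans (extract-∧ (proj₁ (walk k v)) (proj₂ (walk k v)) _) (cong (_ ∧_) (extract-walk k vs)))

  -- The basis is left free so that the Newton basis can be inserted later.
  tilings-wedge : ∀ n (vs : List (V n)) → wedge vs ≡ volume →
    ι (+ tilings (2 ℕ.* n)) ≡ top (wedge (map (λ v → proj₁ (walk n v)) vs))
  tilings-wedge n vs e = trans (cong (λ m → ι (+ tilings m)) (sym (dbl≡2* n)))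
    (trans (tilings-completions (dbl n))
    (trans (sym (top-extract n (completions (dbl n))))
    (cong top (trans (cong (extract {n})
      (trans (encO-completions n) (trans (cong (GH n) (trans (encO-noneSet n) (cong spread (sym e))))
        (wedge-hom (λ x → GH n (spread x)) (λ v → gh n (mix v 0v))
          (trans (cong (GH n) spread-𝟙) (GH-𝟙 n))
          (λ v x → trans (cong (GH n) (spread-∧ v x)) (GH-∧ n _ _)) vs))))
      (extract-walk n vs)))))

  walk-zero : ∀ {n} (v : V n) → proj₁ (walk 1 v) ≡ v +v B v
  walk-zero v = cong (λ t → v +v J t) (+v-identityˡ (K v))

  -- Eliminating the odd part leaves w_{k+2} = (2 + B) w_{k+1} - w_k, the three-term recurrence of
  -- the V_k.
  walk-step : ∀ {n} k (v : V n) →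
    proj₁ (walk (suc (suc k)) v) +v proj₁ (walk k v) ≡ (proj₁ (walk (suc k) v) +v proj₁ (walk (suc k) v)) +v B
      (proj₁ (walk (suc k) v))
  walk-step k v = trans (cong (λ t → (w₁ +v t) +v w₀) (J-+ b₁ (K w₁))) (rearrange w₁ (J b₁) (B w₁) w₀)
    where
    w₀ w₁ b₁ : V _
    w₀ = proj₁ (walk k v)
    w₁ = proj₁ (walk (suc k) v)
    b₁ = proj₂ (walk (suc k) v)
    rearrange : ∀ {m} (x y z w : V m) → (x +v (y +v z)) +v w ≡ (x +v (w +v y)) +v z
    rearrange [] [] [] [] = refl
    rearrange (x ∷ x') (y ∷ y') (z ∷ z') (w ∷ w') = cong₂ _∷_
      (solve 4 (λ x y z w → (x :+ (y :+ z)) :+ w := (x :+ (w :+ y)) :+ z) refl x y z w) (rearrange x' y' z' w')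

-- The polynomials V_n

δℤ : ℕ → ℤ
δℤ zero = + 1
δℤ (suc i) = + 0

shiftℤ : (ℕ → ℤ) → ℕ → ℤ
shiftℤ P zero = + 0
shiftℤ P (suc i) = P i

-- chebV n i is the coefficient of yⁱ in the polynomial V_n with V_n(z + 1/z) = z⁻ⁿ + … + zⁿ.
chebV : ℕ → ℕ → ℤ
chebV zero i = δℤ i
chebV (suc zero) i = δℤ i ℤ.+ shiftℤ δℤ i
chebV (suc (suc n)) i = shiftℤ (chebV (suc n)) i ℤ.- chebV n i

chebV-degree : ∀ n i → n ℕ.< i → chebV n i ≡ + 0
chebV-degree zero (suc i) (s≤s p) = refl
chebV-degree (suc zero) (suc (suc i)) (s≤s p) = refl
chebV-degree (suc (suc n)) (suc i) (s≤s p) =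
  cong₂ ℤ._-_ (chebV-degree (suc n) i p) (chebV-degree n (suc i)
    (ℕP.≤-trans (ℕP.n≤1+n _) (ℕP.≤-trans p (ℕP.n≤1+n _))))

module Roots (S : Alg) where
  open AlgTheory S

  δ : ℕ → Carrier
  δ zero = 1#
  δ (suc i) = 0#

  shift : (ℕ → Carrier) → ℕ → Carrier
  shift P zero = 0#
  shift P (suc i) = P i

  mulRoot : Carrier → (ℕ → Carrier) → ℕ → Carrier
  mulRoot γ P i = shift P i + (- γ) * P i

  prodRoots : List Carrier → ℕ → Carrier
  prodRoots [] = δ
  prodRoots (γ ∷ γs) = mulRoot γ (prodRoots γs)

  prodRoots-degree : ∀ γs i → length γs ℕ.< i → prodRoots γs i ≡ 0#
  prodRoots-degree [] (suc i) p = refl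
  prodRoots-degree (γ ∷ γs) (suc i) (s≤s p) = trans
    (cong₂ (λ s t → s + (- γ) * t) (prodRoots-degree γs i p)
      (prodRoots-degree γs (suc i) (ℕP.≤-trans p (ℕP.n≤1+n i))))
    (trans (+-identityˡ _) (zeroʳ _))

  IsRoots : List Carrier → Set
  IsRoots γs = ∀ i → prodRoots γs i ≡ ι (chebV (length γs) i)

  prodL : List Carrier → Carrier
  prodL = foldr _*_ 1#

  -- A module with two commuting endomorphisms, on which homogeneous polynomials in `a` and `b` act.
  -- It is used for the pairs B - 2 and 1, B + 2 and -1, the scalars 2 and -1, and 1 + u² and u on
  -- power series. Equality is a parameter because power series are compared coefficientwise.
  record LinMod : Set₁ where
    infix 4 _≈_
    infixl 6 _⊞_
    infixr 7 _⊡_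
    field
      X : Set
      _≈_ : X → X → Set
      ≈-refl : ∀ {x} → x ≈ x
      ≈-sym : ∀ {x y} → x ≈ y → y ≈ x
      ≈-trans : ∀ {x y z} → x ≈ y → y ≈ z → x ≈ z
      _⊞_ : X → X → X
      _⊡_ : Carrier → X → X
      𝟎 : X
      ⊞-cong : ∀ {x x' y y'} → x ≈ x' → y ≈ y' → x ⊞ y ≈ x' ⊞ y'
      ⊡-cong : ∀ c {x x'} → x ≈ x' → c ⊡ x ≈ c ⊡ x'
      ⊞-comm : ∀ x y → x ⊞ y ≈ y ⊞ x
      ⊞-interchange : ∀ x y z w → (x ⊞ y) ⊞ (z ⊞ w) ≈ (x ⊞ z) ⊞ (y ⊞ w)
      ⊞-identityˡ : ∀ x → 𝟎 ⊞ x ≈ x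
      ⊡-⊞ : ∀ c x y → c ⊡ (x ⊞ y) ≈ c ⊡ x ⊞ c ⊡ y
      +-⊡ : ∀ a b x → (a + b) ⊡ x ≈ a ⊡ x ⊞ b ⊡ x
      *-⊡ : ∀ a b x → (a * b) ⊡ x ≈ a ⊡ b ⊡ x
      1-⊡ : ∀ x → 1# ⊡ x ≈ x
      0-⊡ : ∀ x → 0# ⊡ x ≈ 𝟎
      a b : X → X
      a-cong : ∀ {x y} → x ≈ y → a x ≈ a y
      b-cong : ∀ {x y} → x ≈ y → b x ≈ b y
      a-⊞ : ∀ x y → a (x ⊞ y) ≈ a x ⊞ a y
      b-⊞ : ∀ x y → b (x ⊞ y) ≈ b x ⊞ b y
      a-⊡ : ∀ c x → a (c ⊡ x) ≈ c ⊡ a x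
      b-⊡ : ∀ c x → b (c ⊡ x) ≈ c ⊡ b x
      ab-comm : ∀ x → b (a x) ≈ a (b x)

  module Evaluation (M : LinMod) where
    open LinMod M

    pow : ℕ → X → X
    pow zero x = x
    pow (suc k) x = a (pow k x)

    -- The sum of P i · bⁿ⁻ⁱ aⁱ x over i ≤ n, the homogenization of P in degree n.
    eval : (ℕ → Carrier) → ℕ → X → X
    eval P zero x = P 0 ⊡ x
    eval P (suc n) x = b (eval P n x) ⊞ P (suc n) ⊡ pow (suc n) x

    ≡⇒≈ : ∀ {x y} → x ≡ y → x ≈ y
    ≡⇒≈ refl = ≈-refl

    eval-cong : ∀ {P Q} → (∀ i → P i ≡ Q i) → ∀ n x → eval P n x ≈ eval Q n x
    eval-cong e zero x = ≡⇒≈ (cong (_⊡ x) (e 0))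
    eval-cong e (suc n) x = ⊞-cong (b-cong (eval-cong e n x)) (≡⇒≈ (cong (_⊡ pow (suc n) x) (e (suc n))))

    eval-shift : ∀ P n x → eval (shift P) (suc n) x ≈ a (eval P n x)
    eval-shift P zero x = ≈-trans (⊞-cong (≈-trans (b-⊡ 0# x) (0-⊡ _)) ≈-refl)
      (≈-trans (⊞-identityˡ _) (≈-sym (a-⊡ (P 0) x)))
    eval-shift P (suc n) x = ≈-trans
      (⊞-cong (≈-trans (b-cong (eval-shift P n x)) (ab-comm _)) (≈-sym (a-⊡ _ _))) (≈-sym (a-⊞ _ _))

    eval-linear : ∀ P c Q n x → eval (λ i → P i + c * Q i) n x ≈ eval P n x ⊞ c ⊡ eval Q n x
    eval-linear P c Q zero x = ≈-trans (+-⊡ _ _ x) (⊞-cong ≈-refl (*-⊡ c _ x))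
    eval-linear P c Q (suc n) x = ≈-trans
      (⊞-cong (≈-trans (b-cong (eval-linear P c Q n x)) (≈-trans (b-⊞ _ _) (⊞-cong ≈-refl (b-⊡ c _))))
              (≈-trans (+-⊡ _ _ _) (⊞-cong ≈-refl (*-⊡ c _ _))))
      (≈-trans (⊞-interchange _ _ _ _) (⊞-cong ≈-refl (≈-sym (⊡-⊞ c _ _))))

    eval-degree : ∀ P n x → P (suc n) ≡ 0# → eval P (suc n) x ≈ b (eval P n x)
    eval-degree P n x e = ≈-trans (⊞-cong ≈-refl (≈-trans (≡⇒≈ (cong (_⊡ pow (suc n) x) e)) (0-⊡ _)))
      (≈-trans (⊞-comm _ _) (⊞-identityˡ _))

    applyRoots : List Carrier → X → X
    applyRoots [] x = x
    applyRoots (γ ∷ γs) x = a (applyRoots γs x) ⊞ (- γ) ⊡ b (applyRoots γs x)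

    applyRoots-eval : ∀ γs x → applyRoots γs x ≈ eval (prodRoots γs) (length γs) x
    applyRoots-eval [] x = ≈-sym (1-⊡ x)
    applyRoots-eval (γ ∷ γs) x = ≈-sym (≈-trans
      (eval-linear (shift (prodRoots γs)) (- γ) (prodRoots γs) (suc (length γs)) x)
      (⊞-cong (≈-trans (eval-shift (prodRoots γs) (length γs) x) (a-cong (≈-sym (applyRoots-eval γs x))))
        (⊡-cong (- γ) (≈-trans (eval-degree (prodRoots γs) (length γs) x (prodRoots-degree γs _ ℕP.≤-refl))
          (b-cong (≈-sym (applyRoots-eval γs x)))))))

    -- The homogenization bⁿ V_n(a / b).
    cheb : ℕ → X → X
    cheb zero x = x
    cheb (suc zero) x = a x ⊞ b x
    cheb (suc (suc n)) x = a (cheb (suc n) x) ⊞ ι -[1+ 0 ] ⊡ b (b (cheb n x))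

    ι-shift : ∀ P i → ι (shiftℤ P i) ≡ shift (λ i → ι (P i)) i
    ι-shift P zero = ι-0
    ι-shift P (suc i) = refl

    eval-chebV : ∀ n x → eval (λ i → ι (chebV n i)) n x ≈ cheb n x
    eval-chebV zero x = ≈-trans (≡⇒≈ (cong (_⊡ x) ι-1)) (1-⊡ x)
    eval-chebV (suc zero) x = ≈-trans (⊞-cong (b-cong (≈-trans (≡⇒≈ (cong (_⊡ x) ι-1)) (1-⊡ x)))
      (≈-trans (≡⇒≈ (cong (_⊡ a x) ι-1)) (1-⊡ _))) (⊞-comm _ _)
    eval-chebV (suc (suc n)) x = ≈-trans
      (eval-cong {Q = λ i → shift (λ j → ι (chebV (suc n) j)) i + ι -[1+ 0 ] * ι (chebV n i)} coeff
        (suc (suc n)) x)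
      (≈-trans (eval-linear _ (ι -[1+ 0 ]) _ (suc (suc n)) x)
      (⊞-cong (≈-trans (eval-shift _ (suc n) x) (a-cong (eval-chebV (suc n) x)))
        (⊡-cong _ (≈-trans (eval-degree _ (suc n) x (trans (cong ι (chebV-degree n _ (ℕP.n≤1+n _))) ι-0))
          (b-cong (≈-trans (eval-degree _ n x (trans (cong ι (chebV-degree n _ ℕP.≤-refl)) ι-0))
            (b-cong (eval-chebV n x))))))))
      where
      coeff : ∀ i → ι (chebV (suc (suc n)) i) ≡ shift (λ j → ι (chebV (suc n) j)) i + ι -[1+ 0 ] * ι (chebV n i)
      coeff i = trans (ι-+ (shiftℤ (chebV (suc n)) i) (ℤ.- chebV n i))
        (cong₂ _+_ (ι-shift _ i) (trans (ι-neg _) (solve 1 (λ x → :- x := con -[1+ 0 ] :* x) refl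
          (ι (chebV n i)))))

    applyRoots-cheb : ∀ γs → IsRoots γs → ∀ x → applyRoots γs x ≈ cheb (length γs) x
    applyRoots-cheb γs r x = ≈-trans (applyRoots-eval γs x)
      (≈-trans (eval-cong r (length γs) x) (eval-chebV (length γs) x))

-- Determinants in the Newton basis

module Determinants (S : Alg) where
  open AlgTheory S
  open Exterior S
  open Transfer S
  open Square S
  open Roots S

  0v-const : ∀ {m} (f : V m → V m) → (∀ c v → f (c ·v v) ≡ c ·v f v) → f 0v ≡ 0v
  0v-const f f-· = trans (cong f (sym (0-·v 0v))) (trans (f-· 0# 0v) (0-·v _))

  vecMod : ∀ {m} (a b : V m → V m) →
    (∀ x y → a (x +v y) ≡ a x +v a y) → (∀ x y → b (x +v y) ≡ b x +v b y) →
    (∀ c x → a (c ·v x) ≡ c ·v a x) → (∀ c x → b (c ·v x) ≡ c ·v b x) →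
    (∀ x → b (a x) ≡ a (b x)) → LinMod
  vecMod {m} a b a+ b+ a· b· ab = record
    { X = V m ; _≈_ = _≡_ ; ≈-refl = refl ; ≈-sym = sym ; ≈-trans = trans
    ; _⊞_ = _+v_ ; _⊡_ = _·v_ ; 𝟎 = 0v
    ; ⊞-cong = cong₂ _+v_ ; ⊡-cong = λ c → cong (c ·v_)
    ; ⊞-comm = +v-comm ; ⊞-interchange = +v-interchange ; ⊞-identityˡ = +v-identityˡ
    ; ⊡-⊞ = ·v-+v ; +-⊡ = +-·v ; *-⊡ = *-·v ; 1-⊡ = 1-·v ; 0-⊡ = 0-·v
    ; a = a ; b = b ; a-cong = cong a ; b-cong = cong b
    ; a-⊞ = a+ ; b-⊞ = b+ ; a-⊡ = a· ; b-⊡ = b· ; ab-comm = ab }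

  infixl 6 _+B_
  _+B_ : ∀ {m} → Carrier → V m → V m
  c +B v = B v +v c ·v v

  +B-+ : ∀ {m} c (u v : V m) → c +B (u +v v) ≡ (c +B u) +v (c +B v)
  +B-+ c u v = trans (cong₂ _+v_ (B-+ u v) (·v-+v c u v)) (+v-interchange _ _ _ _)

  +B-· : ∀ {m} c d (v : V m) → c +B (d ·v v) ≡ d ·v (c +B v)
  +B-· c d v = trans (cong₂ _+v_ (B-· d v) (·v-comm c d v)) (sym (·v-+v d _ _))

  +B-comm : ∀ {m} c d (v : V m) → c +B (d +B v) ≡ d +B (c +B v)
  +B-comm c d v = trans (+B-+ c (B v) (d ·v v)) (trans (cong ((B (B v) +v c ·v B v) +v_) (+B-· c d v))
    (trans (rearrange c d (B (B v)) (B v) v) (sym (trans (+B-+ d (B v) (c ·v v))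
      (cong ((B (B v) +v d ·v B v) +v_) (+B-· d c v))))))
    where
    rearrange : ∀ {m} c d (p q r : V m) → (p +v c ·v q) +v d ·v (q +v c ·v r) ≡ (p +v d ·v q) +v c ·v
      (q +v d ·v r)
    rearrange c d [] [] [] = refl
    rearrange c d (p ∷ p') (q ∷ q') (r ∷ r') = cong₂ _∷_
      (solve 5 (λ c d p q r → (p :+ c :* q) :+ d :* (q :+ c :* r) := (p :+ d :* q) :+ c :* (q :+ d :* r)) refl
        c d p q r)
      (rearrange c d p' q' r')

  act : ∀ {m} → List Carrier → V m → V m
  act [] v = v
  act (b ∷ bs) v = b +B act bs v

  act-+B : ∀ {m} bs c (v : V m) → act bs (c +B v) ≡ c +B act bs v
  act-+B [] c v = refl
  act-+B (b ∷ bs) c v = trans (cong (b +B_) (act-+B bs c v)) (+B-comm b c _)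

  annihilate : ∀ {m} → List Carrier → V m → V m
  annihilate [] v = v
  annihilate (β ∷ βs) v = annihilate βs ((- β) +B v)

  newton : ∀ {m} → List Carrier → V m → List (V m)
  newton [] v = []
  newton (β ∷ βs) v = v ∷ newton βs ((- β) +B v)

  InSpan : ∀ {m} → List Carrier → V m → V m → Set
  InSpan [] v x = x ≡ 0v
  InSpan (β ∷ βs) v x = ∃ λ a → ∃ λ r → x ≡ a ·v v +v r × InSpan βs ((- β) +B v) r

  span-0 : ∀ {m} βs (v : V m) → InSpan βs v 0v
  span-0 [] v = refl
  span-0 (β ∷ βs) v = 0# , 0v , sym (trans (+v-identityʳ _) (0-·v v)) , span-0 βs _

  span-+ : ∀ {m} βs (v : V m) {x y} → InSpan βs v x → InSpan βs v y → InSpan βs v (x +v y)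
  span-+ [] v refl refl = +v-identityˡ 0v
  span-+ (β ∷ βs) v (a , r , refl , p) (b , s , refl , q) =
    a + b , r +v s , trans (+v-interchange _ _ _ _) (cong (_+v (r +v s)) (sym (+-·v a b v))) , span-+ βs _ p q

  span-· : ∀ {m} βs (v : V m) c {x} → InSpan βs v x → InSpan βs v (c ·v x)
  span-· [] v c refl = ·v-0v c
  span-· (β ∷ βs) v c (a , r , refl , p) = c * a , c ·v r , trans (·v-+v c _ _)
    (cong (_+v c ·v r) (sym (*-·v c a v))) , span-· βs _ c p

  span-self : ∀ {m} βs (v : V m) → annihilate βs v ≡ 0v → InSpan βs v v
  span-self [] v k = k
  span-self (β ∷ βs) v k = 1# , 0v , sym (trans (+v-identityʳ _) (1-·v v)) , span-0 βs _

  B-split : ∀ {m} β (v : V m) → B v ≡ β ·v v +v ((- β) +B v)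
  B-split β v = rearrange β (B v) v
    where
    rearrange : ∀ {m} β (p v : V m) → p ≡ β ·v v +v (p +v (- β) ·v v)
    rearrange β [] [] = refl
    rearrange β (p ∷ p') (v ∷ v') = cong₂ _∷_ (solve 3 (λ β p v → p := β :* v :+ (p :+ (:- β) :* v)) refl β p
      v) (rearrange β p' v')

  -- B v = β v + (B - β) v expresses B on each Newton vector by that vector and the next; the vector
  -- after the last one is 0 by the annihilation hypothesis.
  span-B : ∀ {m} βs (v : V m) {x} → annihilate βs v ≡ 0v → InSpan βs v x → InSpan βs v (B x)
  span-B [] v k refl = 0v-const B B-·
  span-B (β ∷ βs) v k (a , r , refl , p) =
    a * β , a ·v ((- β) +B v) +v B r ,
    trans (B-+ _ r) (trans (cong (_+v B r) (trans (B-· a v)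
      (trans (cong (a ·v_) (B-split β v)) (trans (·v-+v a _ _)
        (cong (_+v a ·v ((- β) +B v)) (sym (*-·v a β v)))))))
      (+v-assoc _ _ _)) ,
    span-+ βs _ (span-· βs _ a (span-self βs _ k)) (span-B βs _ k p)

  span-wedge : ∀ {m} βs (v : V m) {x} → InSpan βs v x → x ∧ wedge (newton βs v) ≡ 𝟘
  span-wedge [] v refl = 0v-∧ 𝟙
  span-wedge (β ∷ βs) v (a , r , refl , p) = trans (+v-∧ _ r _)
    (trans (cong₂ _⊕_ (trans (·v-∧ a v _) (trans (cong (a ·_) (∧-self v _)) (·-𝟘 a)))
      (trans (∧-swap r v _) (trans (cong (λ t → m1 · v ∧ t) (span-wedge βs _ p))
        (trans (cong (m1 ·_) (∧-𝟘 v)) (·-𝟘 m1)))))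
    (⊕-identityʳ 𝟘))

  values : List Carrier → Carrier → Carrier
  values bs β = prodL (map (λ b → β + b) bs)

  -- Modulo the span of the later Newton vectors B acts on v as β, so ∏ (B + b) acts as ∏ (β + b).
  -- These are the diagonal entries of a triangular matrix.
  act-head : ∀ {m} bs β βs (v : V m) → annihilate (β ∷ βs) v ≡ 0v →
    ∃ λ r → act bs v ≡ values bs β ·v v +v r × InSpan βs ((- β) +B v) r
  act-head [] β βs v k = 0v , sym (trans (+v-identityʳ _) (1-·v v)) , span-0 βs _
  act-head (b ∷ bs) β βs v k with act-head bs β βs v k
  ... | r , e , p = c ·v ((- β) +B v) +v (b +B r) ,
    trans (cong (b +B_) e) (trans (+B-+ b (c ·v v) r) (trans (cong (_+v (b +B r)) lem) (+v-assoc _ _ _))) ,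
    span-+ βs _ (span-· βs _ c (span-self βs _ k)) (span-+ βs _ (span-B βs _ k p) (span-· βs _ b p))
    where
    c : Carrier
    c = values bs β
    rearrange : ∀ {m} β b c (p v : V m) → c ·v (p +v b ·v v) ≡ ((β + b) * c) ·v v +v c ·v (p +v (- β) ·v v)
    rearrange β b c [] [] = refl
    rearrange β b c (p ∷ p') (v ∷ v') = cong₂ _∷_
      (solve 5 (λ β b c p v → c :* (p :+ b :* v) := ((β :+ b) :* c) :* v :+ c :* (p :+ (:- β) :* v)) refl β b
        c p v)
      (rearrange β b c p' v')
    lem : b +B (c ·v v) ≡ ((β + b) * c) ·v v +v c ·v ((- β) +B v)
    lem = trans (+B-· b c v) (rearrange β b c (B v) v)

  act-wedge : ∀ {m} bs β βs (v : V m) → annihilate (β ∷ βs) v ≡ 0v →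
    act bs v ∧ wedge (newton βs ((- β) +B v)) ≡ values bs β · wedge (newton (β ∷ βs) v)
  act-wedge bs β βs v k with act-head bs β βs v k
  ... | r , e , p = trans (cong (_∧ wedge (newton βs ((- β) +B v))) e) (trans (+v-∧ _ r _)
    (trans (cong₂ _⊕_ (·v-∧ _ v _) (span-wedge βs _ p)) (⊕-identityʳ _)))

  determinant-act : ∀ {m} bs βs (v : V m) → annihilate βs v ≡ 0v →
    wedge (map (act bs) (newton βs v)) ≡ prodL (map (values bs) βs) · wedge (newton βs v)
  determinant-act bs [] v k = sym (1-· 𝟙)
  determinant-act bs (β ∷ βs) v k = trans (cong (act bs v ∧_) (determinant-act bs βs _ k))
    (trans (∧-· _ (act bs v) _) (trans (cong (prodL (map (values bs) βs) ·_) (act-wedge bs β βs v k))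
      (trans (·-comm _ _ _) (sym (*-· _ _ _)))))

  krylov : ∀ {m} → ℕ → V m → List (V m)
  krylov zero v = []
  krylov (suc k) v = v ∷ krylov k (B (B v))

  differences : ∀ {m} → Carrier → V m → List (V m) → List (V m)
  differences a u [] = []
  differences a u (w ∷ ws) = (w +v a ·v u) ∷ differences a w ws

  -- Each vector is changed by a multiple of its predecessor in the original list, and the wedge
  -- with that predecessor removes the change.
  wedge-differences : ∀ {m} a (u : V m) us → u ∧ wedge (differences a u us) ≡ u ∧ wedge us
  wedge-differences a u [] = refl
  wedge-differences a u (w ∷ ws) = trans (cong (u ∧_) (+v-∧ w (a ·v u) _)) (trans (∧-⊕ u _ _)
    (trans (cong₂ _⊕_ (cong (u ∧_) (wedge-differences a w ws))
      (trans (cong (u ∧_) (·v-∧ a u _)) (trans (∧-· a u _) (trans (cong (a ·_) (∧-self u _)) (·-𝟘 a)))))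
        (⊕-identityʳ _)))

  krylov-differences : ∀ {m} k a (u : V m) → krylov k (B (B u) +v a ·v u) ≡ differences a u (krylov k (B (B u)))
  krylov-differences zero a u = refl
  krylov-differences (suc k) a u = cong ((B (B u) +v a ·v u) ∷_)
    (trans (cong (krylov k) (trans (cong B (B-+ _ _)) (trans (B-+ _ _)
      (cong (B (B (B (B u))) +v_) (trans (cong B (B-· a u)) (B-· a _))))))
      (krylov-differences k a (B (B u))))

  -- Subtracting multiples of the preceding vectors turns B²ⁱ v into ∏_{l<i} (B² − βₗ²) v, which is
  -- ∏_{l<i} (B + βₗ) applied to the i-th vector of the Newton basis.
  krylov-value : List Carrier → List Carrier → Carrier
  krylov-value pre [] = 1#
  krylov-value pre (β ∷ βs) = values pre β * krylov-value (β ∷ pre) βs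

  act-square : ∀ {m} pre β (v : V m) →
    B (B (act pre v)) +v (- (β * β)) ·v act pre v ≡ act (β ∷ pre) ((- β) +B v)
  act-square pre β v = sym (trans (cong (β +B_) (act-+B pre (- β) v))
    (trans (+B-+ β _ _) (trans (cong ((β +B B (act pre v)) +v_) (+B-· β (- β) _)) (rearrange β _ _ _))))
    where
    rearrange : ∀ {m} β (p q r : V m) → (p +v β ·v q) +v (- β) ·v (q +v β ·v r) ≡ p +v (- (β * β)) ·v r
    rearrange β [] [] [] = refl
    rearrange β (p ∷ p') (q ∷ q') (r ∷ r') = cong₂ _∷_
      (solve 4 (λ β p q r → (p :+ β :* q) :+ (:- β) :* (q :+ β :* r) := p :+ (:- (β :* β)) :* r) refl β p q r)
      (rearrange β p' q' r')

  determinant-krylov : ∀ {m} pre βs (v : V m) → annihilate βs v ≡ 0v →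
    wedge (krylov (length βs) (act pre v)) ≡ krylov-value pre βs · wedge (newton βs v)
  determinant-krylov pre [] v k = sym (1-· 𝟙)
  determinant-krylov pre (β ∷ βs) v k =
    trans (sym (trans (cong (λ us → w ∧ wedge us) (krylov-differences (length βs) (- (β * β)) w))
      (wedge-differences (- (β * β)) w (krylov (length βs) (B (B w))))))
    (trans (cong (λ t → w ∧ wedge (krylov (length βs) t)) (act-square pre β v))
    (trans (cong (w ∧_) (determinant-krylov (β ∷ pre) βs _ k))
    (trans (∧-· _ w _) (trans (cong (krylov-value (β ∷ pre) βs ·_) (act-wedge pre β βs v k))
      (trans (·-comm _ _ _) (sym (*-· _ _ _)))))))
    where
    w : V _
    w = act pre v

  -- Entry 1 at position `i` and 0 beyond it; the earlier entries are arbitrary.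
  Monic : ∀ {m} → ℕ → V m → Set
  Monic i [] = ⊥
  Monic zero (a ∷ v) = a ≡ 1# × v ≡ 0v
  Monic (suc i) (a ∷ v) = Monic i v

  AllMonic : ∀ {m} → ℕ → List (V m) → Set
  AllMonic i [] = ⊤
  AllMonic i (v ∷ vs) = Monic i v × AllMonic (suc i) vs

  tailv : ∀ {m} → V (suc m) → V m
  tailv (a ∷ v) = v

  wedge-tails : ∀ {m} (vs : List (V (suc m))) → ∃ λ y → wedge vs ≡ wedge (map tailv vs) ∣ y
  wedge-tails [] = 𝟘 , refl
  wedge-tails ((a ∷ v) ∷ vs) with wedge-tails vs
  ... | y , e = _ , cong ((a ∷ v) ∧_) e

  monic-tails : ∀ {m} i (vs : List (V (suc m))) → AllMonic (suc i) vs → AllMonic i (map tailv vs)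
  monic-tails i [] _ = tt
  monic-tails i ((a ∷ v) ∷ vs) (p , q) = p , monic-tails (suc i) vs q

  wedge-monic : ∀ {m} (vs : List (V m)) → length vs ≡ m → AllMonic 0 vs → wedge vs ≡ volume
  wedge-monic {zero} [] e p = refl
  wedge-monic {suc m} ((a ∷ v) ∷ vs) e ((refl , refl) , q) with wedge-tails vs
  ... | y , e' = trans (cong ((1# ∷ 0v) ∧_) e') (trans (e₀-∧ _ y)
    (cong (𝟘 ∣_) (wedge-monic (map tailv vs) (trans (length-map tailv vs) (ℕP.suc-injective e))
      (monic-tails 0 vs q))))

  hd-0v : ∀ m → hd (0v {m}) ≡ 0#
  hd-0v zero = refl
  hd-0v (suc m) = refl

  K-0v : ∀ {m} → K (0v {m}) ≡ 0v
  K-0v = 0v-const K K-·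

  J-0v : ∀ {m} → J (0v {m}) ≡ 0v
  J-0v = 0v-const J J-·

  monic-K : ∀ {m} i (v : V m) → Monic i v → Monic i (K v)
  monic-K {suc m} zero (a ∷ v) (refl , refl) = trans (addˡ 1# (hd-0v m)) (+-identityʳ 1#) , K-0v
  monic-K (suc i) (a ∷ v) p = monic-K i v p

  monic-add-e₀ : ∀ {m} i a (v : V m) → Monic (suc i) v → Monic (suc i) (a ·v e₀ +v v)
  monic-add-e₀ i a (b ∷ v) p = subst (Monic i) (sym (trans (cong (_+v v) (·v-0v a)) (+v-identityˡ v))) p

  monic-J : ∀ {m} i (v : V m) → suc i ℕ.< m → Monic i v → Monic (suc i) (J v)
  monic-J {suc (suc m)} zero (a ∷ v) (s≤s (s≤s q)) (refl , refl) =
    subst (Monic {suc m} 0) {e₀} (sym (trans (cong₂ _+v_ (1-·v e₀) J-0v) (+v-identityʳ e₀))) (refl , refl)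
  monic-J (suc i) (a ∷ v) (s≤s q) p = monic-add-e₀ i a (J v) (monic-J i v q p)

  monic-lower : ∀ {m} i c (u v : V m) → Monic (suc i) u → Monic i v → Monic (suc i) (u +v c ·v v)
  monic-lower zero c (_ ∷ b ∷ u) (_ ∷ v) (refl , refl) (refl , refl) =
    trans (addˡ 1# (zeroʳ c)) (+-identityʳ 1#) , trans (cong (0v +v_) (·v-0v c)) (+v-identityˡ 0v)
  monic-lower (suc i) c (_ ∷ u) (_ ∷ v) p q = monic-lower i c u v p q

  monic-+B : ∀ {m} i c (v : V m) → suc i ℕ.< m → Monic i v → Monic (suc i) (c +B v)
  monic-+B i c v q p = monic-lower i c (B v) v (monic-J i (K v) q (monic-K i v p)) p

  newton-monic : ∀ {m} i βs (v : V m) → i ℕ.+ length βs ≡ m → Monic i v → AllMonic i (newton βs v)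
  newton-monic i [] v e p = tt
  newton-monic i (β ∷ []) v e p = p , tt
  newton-monic i (β ∷ β' ∷ βs) v e p = p , newton-monic (suc i) (β' ∷ βs) _ (trans (sym (ℕP.+-suc i _)) e)
    (monic-+B i (- β) v (subst (suc (suc i) ℕ.≤_) (trans
      (sym (trans (ℕP.+-suc i _) (cong suc (ℕP.+-suc i _)))) e) (s≤s (s≤s (ℕP.m≤m+n i _)))) p)

  newton-length : ∀ {m} βs (v : V m) → length (newton βs v) ≡ length βs
  newton-length [] v = refl
  newton-length (β ∷ βs) v = cong suc (newton-length βs _)

  -- B has ones below its diagonal, so each factor B - β raises the leading position by one: the
  -- Newton vectors of e₀ are unitriangular over any coefficient ring.
  newton-volume : ∀ βs m → length βs ≡ m → wedge (newton βs (e₀ {m})) ≡ volume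
  newton-volume [] .zero refl = refl
  newton-volume (β ∷ βs) .(suc (length βs)) refl =
    wedge-monic _ (newton-length (β ∷ βs) e₀) (newton-monic 0 (β ∷ βs) e₀ refl (refl , refl))

  unit : ∀ {m} → ℕ → V m
  unit zero = e₀
  unit {zero} (suc i) = []
  unit {suc m} (suc i) = 0# ∷ unit i

  unit-end : ∀ m → unit {m} m ≡ 0v
  unit-end zero = refl
  unit-end (suc m) = cong (0# ∷_) (unit-end m)

  K-e₀ : ∀ {m} → K (e₀ {m}) ≡ e₀
  K-e₀ {zero} = refl
  K-e₀ {suc m} = cong₂ _∷_ (trans (addˡ 1# (hd-0v m)) (+-identityʳ 1#)) K-0v

  K-unit : ∀ {m} i → suc i ℕ.< m → K (unit {m} (suc i)) ≡ unit (suc i) +v unit i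
  K-unit {suc zero} zero (s≤s ())
  K-unit {suc (suc m)} zero q = cong ((0# + 1#) ∷_) (trans K-e₀ (sym (+v-identityʳ e₀)))
  K-unit {suc (suc m)} (suc i) (s≤s q) = cong ((0# + 0#) ∷_) (K-unit i q)

  J-unit : ∀ {m} i → J (unit {m} i) ≡ unit i +v unit (suc i)
  J-unit {zero} zero = refl
  J-unit {zero} (suc i) = refl
  J-unit {suc m} zero = cong₂ _∷_ (sym (+-identityʳ 1#))
    (trans (cong₂ _+v_ (1-·v e₀) J-0v) (+v-comm e₀ 0v))
  J-unit {suc m} (suc i) = cong₂ _∷_ (sym (+-identityʳ 0#))
    (trans (cong (_+v J (unit i)) (0-·v e₀)) (trans (+v-identityˡ _) (J-unit i)))

  shifted : ∀ m → LinMod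
  shifted m = vecMod {m} (ι -[1+ 1 ] +B_) (λ v → v) (+B-+ _) (λ _ _ → refl) (λ d v → +B-· _ d v)
    (λ _ _ → refl) (λ _ → refl)

  reflected : ∀ m → LinMod
  reflected m = vecMod {m} (two +B_) (m1 ·v_) (+B-+ _) (·v-+v m1) (λ d v → +B-· _ d v) (·v-comm m1)
    (λ x → sym (+B-· two m1 x))

  -- The tridiagonal form of B - 2 reproduces the recurrence of the V_i, so V_i(B - 2) e₀ is the
  -- i-th basis vector. At i = m that vector is 0, whence V_m(B - 2) kills e₀.
  cheb-unit : ∀ {m} i → i ℕ.≤ m → Evaluation.cheb (shifted m) i e₀ ≡ unit i
  cheb-unit zero q = refl
  cheb-unit (suc zero) q = trans (cong (λ t → (t +v ι -[1+ 1 ] ·v e₀) +v e₀) (trans (cong J K-e₀) (J-unit 0)))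
    (rearrange e₀ (unit 1))
    where
    rearrange : ∀ {m} (p q : V m) → ((p +v q) +v ι -[1+ 1 ] ·v p) +v p ≡ q
    rearrange [] [] = refl
    rearrange (p ∷ p') (q ∷ q') = cong₂ _∷_ (solve 2 (λ p q → ((p :+ q) :+ con -[1+ 1 ] :* p) :+ p := q) refl
      p q) (rearrange p' q')
  cheb-unit {m} (suc (suc i)) q = trans
    (cong₂ (λ s t → (ι -[1+ 1 ] +B s) +v m1 ·v t) (cheb-unit (suc i) (ℕP.<⇒≤ q))
      (cheb-unit i (ℕP.<⇒≤ (ℕP.<⇒≤ q))))
    (trans (cong (λ t → (t +v ι -[1+ 1 ] ·v unit (suc i)) +v m1 ·v unit i)
      (trans (cong J (K-unit i q)) (trans (J-+ _ _) (cong₂ _+v_ (J-unit (suc i)) (J-unit i)))))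
      (rearrange (unit i) (unit (suc i)) (unit (suc (suc i)))))
    where
    rearrange : ∀ {m} (p q r : V m) → (((q +v r) +v (p +v q)) +v ι -[1+ 1 ] ·v q) +v m1 ·v p ≡ r
    rearrange [] [] [] = refl
    rearrange (p ∷ p') (q ∷ q') (r ∷ r') = cong₂ _∷_
      (solve 3 (λ p q r → (((q :+ r) :+ (p :+ q)) :+ con -[1+ 1 ] :* q) :+ con -[1+ 0 ] :* p := r) refl p q r)
        (rearrange p' q' r')

  -- Here a = 2 + B and b = -1, so `cheb` is (-1)ᵏ V_k(-2 - B). For k = n, factoring over the roots
  -- gives ∏ (B + 2 + γ) = ∏ (B + β).
  cheb-walk : ∀ {m} k (v : V m) → Evaluation.cheb (reflected m) k v ≡ proj₁ (walk k v)
  cheb-walk zero v = refl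
  cheb-walk (suc zero) v = trans (rearrange (B v) v) (sym (walk-zero v))
    where
    rearrange : ∀ {m} (p v : V m) → (p +v two ·v v) +v m1 ·v v ≡ v +v p
    rearrange [] [] = refl
    rearrange (p ∷ p') (v ∷ v') = cong₂ _∷_ (solve 2 (λ p v →
      (p :+ con (+ 2) :* v) :+ con -[1+ 0 ] :* v := v :+ p) refl p v) (rearrange p' v')
  cheb-walk (suc (suc k)) v = trans
    (cong₂ (λ s t → (two +B s) +v m1 ·v m1 ·v m1 ·v t) (cheb-walk (suc k) v) (cheb-walk k v))
    (rearrange (proj₁ (walk k v)) (proj₁ (walk (suc k) v)) (B (proj₁ (walk (suc k) v)))
      (proj₁ (walk (suc (suc k)) v)) (walk-step k v))
    where
    rearrange : ∀ {m} (p q r s : V m) → s +v p ≡ (q +v q) +v r → (r +v two ·v q) +v m1 ·v m1 ·v m1 ·v p ≡ s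
    rearrange [] [] [] [] e = refl
    rearrange (p ∷ p') (q ∷ q') (r ∷ r') (s ∷ s') e = cong₂ _∷_
      (trans (solve 3 (λ p q r → (r :+ con (+ 2) :* q) :+ con -[1+ 0 ] :*
        (con -[1+ 0 ] :* (con -[1+ 0 ] :* p)) := ((q :+ q) :+ r) :+ con -[1+ 0 ] :* p) refl p q r)
        (trans (cong (_+ m1 * p) (sym (cong hd e))) (solve 2
          (λ s p → (s :+ p) :+ con -[1+ 0 ] :* p := s) refl s p)))
      (rearrange p' q' r' s' (cong tailv e))

  betas : List Carrier → List Carrier
  betas = map (λ γ → two + γ)

  annihilate-roots : ∀ {m} γs (v : V m) → annihilate (betas γs) v ≡ Evaluation.applyRoots (shifted m) γs v
  annihilate-roots [] v = refl
  annihilate-roots {m} (γ ∷ γs) v = trans (annihilate-roots γs _) (trans (commute γs) (rearrange γ (B w) w))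
    where
    w : V m
    w = Evaluation.applyRoots (shifted m) γs v
    rearrange : ∀ {m} γ (p v : V m) → p +v (- (two + γ)) ·v v ≡ (p +v ι -[1+ 1 ] ·v v) +v (- γ) ·v v
    rearrange γ [] [] = refl
    rearrange γ (p ∷ p') (v ∷ v') = cong₂ _∷_
      (solve 3 (λ γ p v → p :+ (:- (con (+ 2) :+ γ)) :* v := (p :+ con -[1+ 1 ] :* v) :+ (:- γ) :* v) refl γ p
        v) (rearrange γ p' v')
    commute : ∀ γs {c v} → Evaluation.applyRoots (shifted m) γs (c +B v) ≡ c +B Evaluation.applyRoots
      (shifted m) γs v
    commute [] = refl
    commute (γ ∷ γs) {c} {v} = trans (cong (λ t → (ι -[1+ 1 ] +B t) +v (- γ) ·v t) (commute γs))
      (sym (trans (+B-+ c _ _) (cong₂ _+v_ (+B-comm c _ _) (+B-· c _ _))))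

  act-roots : ∀ {m} γs (v : V m) → act (betas γs) v ≡ Evaluation.applyRoots (reflected m) γs v
  act-roots [] v = refl
  act-roots {m} (γ ∷ γs) v = trans (cong ((two + γ) +B_) (act-roots γs v)) (rearrange γ _ _)
    where
    rearrange : ∀ {m} γ (p v : V m) → p +v (two + γ) ·v v ≡ (p +v two ·v v) +v (- γ) ·v m1 ·v v
    rearrange γ [] [] = refl
    rearrange γ (p ∷ p') (v ∷ v') = cong₂ _∷_
      (solve 3 (λ γ p v → p :+ (con (+ 2) :+ γ) :* v := (p :+ con (+ 2) :* v) :+ (:- γ) :*
        (con -[1+ 0 ] :* v)) refl γ p v) (rearrange γ p' v')

  module _ (γs : List Carrier) (roots : IsRoots γs) where

    n : ℕ
    n = length γs

    βs : List Carrier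
    βs = betas γs

    annihilate-e₀ : annihilate βs (e₀ {n}) ≡ 0v
    annihilate-e₀ = trans (annihilate-roots γs e₀) (trans (Evaluation.applyRoots-cheb (shifted n) γs roots e₀)
      (trans (cheb-unit n ℕP.≤-refl) (unit-end n)))

    basis-volume : wedge (newton βs (e₀ {n})) ≡ volume
    basis-volume = newton-volume βs n (length-map _ γs)

    tilings-product : ι (+ tilings (2 ℕ.* n)) ≡ prodL (map (values βs) βs)
    tilings-product = trans (tilings-wedge n (newton βs e₀) basis-volume)
      (trans (cong (λ us → top (wedge us)) (map-walk (newton βs e₀)))
      (trans (cong top (trans (determinant-act βs βs e₀ annihilate-e₀)
        (cong (prodL (map (values βs) βs) ·_) basis-volume)))
      (trans (top-· _ (volume {n})) (trans (mulˡ _ (top-volume n)) (*-identityʳ _)))))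
      where
      map-walk : ∀ (us : List (V n)) → map (λ v → proj₁ (walk n v)) us ≡ map (act βs) us
      map-walk [] = refl
      map-walk (u ∷ us) = cong₂ _∷_ (sym (trans (act-roots γs u)
        (trans (Evaluation.applyRoots-cheb (reflected n) γs roots u) (cheb-walk n u)))) (map-walk us)

    krylov-top : top (wedge (krylov n (e₀ {n}))) ≡ krylov-value [] βs
    krylov-top = trans (cong (λ k → top (wedge (krylov k (e₀ {n})))) (sym (length-map _ γs)))
      (trans (cong top (trans (determinant-krylov [] βs e₀ annihilate-e₀)
        (cong (krylov-value [] βs ·_) basis-volume)))
      (trans (top-· _ (volume {n})) (trans (mulˡ _ (top-volume n)) (*-identityʳ _))))

-- Nonnegativity of the Krylov determinant

module Positivity (S : Alg) where
  open AlgTheory S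
  open Exterior S
  open Square S
  open Determinants S

  -- The maps of exterior algebras induced by J and K; these matrices being bidiagonal with nonnegative
  -- entries, no signs occur. κ is the part of ΛK that moves a particle from site 0 to the left.
  ΛJ ΛK κ : ∀ {m} → Λ m → Λ m
  ΛJ ⟨ x ⟩ = ⟨ x ⟩
  ΛJ (x ∣ y) = (ΛJ x ⊕ e₀ ∧ ΛJ y) ∣ ΛJ y
  ΛK ⟨ x ⟩ = ⟨ x ⟩
  ΛK (x ∣ y) = ΛK x ∣ (ΛK y ⊕ κ x)
  κ ⟨ x ⟩ = ⟨ 0# ⟩
  κ (x ∣ y) = ΛK y ∣ κ y

  ΛJ-⊕ : ∀ {m} (x y : Λ m) → ΛJ (x ⊕ y) ≡ ΛJ x ⊕ ΛJ y
  ΛJ-⊕ ⟨ x ⟩ ⟨ y ⟩ = refl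
  ΛJ-⊕ (x ∣ x') (y ∣ y') = cong₂ _∣_
    (trans (cong₂ (λ s t → s ⊕ e₀ ∧ t) (ΛJ-⊕ x y) (ΛJ-⊕ x' y'))
      (trans (cong ((ΛJ x ⊕ ΛJ y) ⊕_) (∧-⊕ e₀ _ _)) (⊕-interchange _ _ _ _)))
    (ΛJ-⊕ x' y')

  ΛK-⊕ : ∀ {m} (x y : Λ m) → ΛK (x ⊕ y) ≡ ΛK x ⊕ ΛK y
  κ-⊕ : ∀ {m} (x y : Λ m) → κ (x ⊕ y) ≡ κ x ⊕ κ y
  ΛK-⊕ ⟨ x ⟩ ⟨ y ⟩ = refl
  ΛK-⊕ (x ∣ x') (y ∣ y') = cong₂ _∣_ (ΛK-⊕ x y) (trans (cong₂ _⊕_ (ΛK-⊕ x' y') (κ-⊕ x y))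
    (⊕-interchange _ _ _ _))
  κ-⊕ ⟨ x ⟩ ⟨ y ⟩ = cong ⟨_⟩ (sym (+-identityʳ 0#))
  κ-⊕ (x ∣ x') (y ∣ y') = cong₂ _∣_ (ΛK-⊕ x' y') (κ-⊕ x' y')

  ΛJ-· : ∀ {m} c (x : Λ m) → ΛJ (c · x) ≡ c · ΛJ x
  ΛJ-· c ⟨ x ⟩ = refl
  ΛJ-· c (x ∣ y) = cong₂ _∣_
    (trans (cong₂ (λ s t → s ⊕ e₀ ∧ t) (ΛJ-· c x) (ΛJ-· c y))
      (trans (cong (c · ΛJ x ⊕_) (∧-· c e₀ _)) (sym (·-⊕ c _ _))))
    (ΛJ-· c y)

  ΛK-· : ∀ {m} c (x : Λ m) → ΛK (c · x) ≡ c · ΛK x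
  κ-· : ∀ {m} c (x : Λ m) → κ (c · x) ≡ c · κ x
  ΛK-· c ⟨ x ⟩ = refl
  ΛK-· c (x ∣ y) = cong₂ _∣_ (ΛK-· c x) (trans (cong₂ _⊕_ (ΛK-· c y) (κ-· c x)) (sym (·-⊕ c _ _)))
  κ-· c ⟨ x ⟩ = cong ⟨_⟩ (sym (zeroʳ c))
  κ-· c (x ∣ y) = cong₂ _∣_ (ΛK-· c y) (κ-· c y)

  ΛJ-linear : ∀ {m} a (x y : Λ m) → ΛJ (a · x ⊕ m1 · y) ≡ a · ΛJ x ⊕ m1 · ΛJ y
  ΛJ-linear a x y = trans (ΛJ-⊕ _ _) (cong₂ _⊕_ (ΛJ-· a x) (ΛJ-· m1 y))

  ΛK-linear : ∀ {m} a (x y : Λ m) → ΛK (a · x ⊕ m1 · y) ≡ a · ΛK x ⊕ m1 · ΛK y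
  ΛK-linear a x y = trans (ΛK-⊕ _ _) (cong₂ _⊕_ (ΛK-· a x) (ΛK-· m1 y))

  κ-linear : ∀ {m} a (x y : Λ m) → κ (a · x ⊕ m1 · y) ≡ a · κ x ⊕ m1 · κ y
  κ-linear a x y = trans (κ-⊕ _ _) (cong₂ _⊕_ (κ-· a x) (κ-· m1 y))

  ΛJ-𝟘 : ∀ {m} → ΛJ (𝟘 {m}) ≡ 𝟘
  ΛJ-𝟘 = trans (cong ΛJ (sym (0-· 𝟘))) (trans (ΛJ-· 0# 𝟘) (0-· _))
  ΛK-𝟘 : ∀ {m} → ΛK (𝟘 {m}) ≡ 𝟘
  ΛK-𝟘 = trans (cong ΛK (sym (0-· 𝟘))) (trans (ΛK-· 0# 𝟘) (0-· _))
  κ-𝟘 : ∀ {m} → κ (𝟘 {m}) ≡ 𝟘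
  κ-𝟘 = trans (cong κ (sym (0-· 𝟘))) (trans (κ-· 0# 𝟘) (0-· _))

  ΛJ-𝟙 : ∀ {m} → ΛJ (𝟙 {m}) ≡ 𝟙
  ΛJ-𝟙 {zero} = refl
  ΛJ-𝟙 {suc m} = cong₂ _∣_ (trans (cong₂ (λ s t → s ⊕ e₀ ∧ t) ΛJ-𝟙 ΛJ-𝟘)
    (trans (cong (𝟙 ⊕_) (∧-𝟘 e₀)) (⊕-identityʳ 𝟙))) ΛJ-𝟘

  κ-𝟙 : ∀ {m} → κ (𝟙 {m}) ≡ 𝟘
  κ-𝟙 {zero} = refl
  κ-𝟙 {suc m} = cong₂ _∣_ ΛK-𝟘 κ-𝟘

  ΛK-𝟙 : ∀ {m} → ΛK (𝟙 {m}) ≡ 𝟙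
  ΛK-𝟙 {zero} = refl
  ΛK-𝟙 {suc m} = cong₂ _∣_ ΛK-𝟙 (trans (cong₂ _⊕_ ΛK-𝟘 κ-𝟙) (⊕-identityʳ 𝟘))

  private
    J-lemma : ∀ {m} a (p q r : Λ m) → p ⊕ (a · q ⊕ m1 · r) ≡ a · q ⊕ (p ⊕ m1 · r)
    J-lemma a ⟨ p ⟩ ⟨ q ⟩ ⟨ r ⟩ = cong ⟨_⟩
      (solve 4 (λ a p q r → p :+ (a :* q :+ con -[1+ 0 ] :* r) := a :* q :+ (p :+ con -[1+ 0 ] :* r)) refl a p
        q r)
    J-lemma a (p ∣ p') (q ∣ q') (r ∣ r') = cong₂ _∣_ (J-lemma a p q r) (J-lemma a p' q' r')

    κ-lemma : ∀ {m} a b (p q r : Λ m) → a · q ⊕ m1 · (b · p ⊕ m1 · r) ≡ a · (p ⊕ q) ⊕ m1 ·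
      ((a + b) · p ⊕ m1 · r)
    κ-lemma a b ⟨ p ⟩ ⟨ q ⟩ ⟨ r ⟩ = cong ⟨_⟩
      (solve 5 (λ a b p q r → a :* q :+ con -[1+ 0 ] :* (b :* p :+ con -[1+ 0 ] :* r) := a :*
        (p :+ q) :+ con -[1+ 0 ] :* ((a :+ b) :* p :+ con -[1+ 0 ] :* r)) refl a b p q r)
    κ-lemma a b (p ∣ p') (q ∣ q') (r ∣ r') = cong₂ _∣_ (κ-lemma a b p q r) (κ-lemma a b p' q' r')

  ΛJ-∧ : ∀ {m} (v : V m) x → ΛJ (v ∧ x) ≡ J v ∧ ΛJ x
  ΛJ-∧ [] ⟨ x ⟩ = refl
  ΛJ-∧ (a ∷ v) (x ∣ y) = cong₂ _∣_
    (trans (cong₂ (λ s t → s ⊕ e₀ ∧ t) (ΛJ-∧ v x) image)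
      (trans (cong (J v ∧ ΛJ x ⊕_) (∧-linear e₀ a (ΛJ x) m1 (J v ∧ ΛJ y)))
    (trans (J-lemma a _ _ _)
    (sym (trans (add-e₀-∧ a (J v) _) (cong₂ (λ s t → a · s ⊕ t)
      (trans (∧-⊕ e₀ _ _) (trans (cong (e₀ ∧ ΛJ x ⊕_) (∧-self e₀ _)) (⊕-identityʳ _)))
      (trans (∧-⊕ (J v) _ _) (cong (J v ∧ ΛJ x ⊕_) (∧-swap (J v) e₀ _)))))))))
    (trans image (trans (H-lemma₂ a (ΛJ x) (J v ∧ ΛJ y) (e₀ ∧ ΛJ y))
      (cong (λ t → a · (ΛJ x ⊕ e₀ ∧ ΛJ y) ⊕ m1 · t) (sym (add-e₀-∧ a (J v) (ΛJ y))))))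
    where
    image : ΛJ (a · x ⊕ m1 · v ∧ y) ≡ a · ΛJ x ⊕ m1 · J v ∧ ΛJ y
    image = trans (ΛJ-linear a x (v ∧ y)) (cong (λ t → a · ΛJ x ⊕ m1 · t) (ΛJ-∧ v y))

  ΛK-∧ : ∀ {m} (v : V m) x → ΛK (v ∧ x) ≡ K v ∧ ΛK x
  κ-∧ : ∀ {m} (v : V m) x → κ (v ∧ x) ≡ hd v · ΛK x ⊕ m1 · K v ∧ κ x
  ΛK-∧ [] ⟨ x ⟩ = refl
  ΛK-∧ (a ∷ v) (x ∣ y) = cong₂ _∣_ (ΛK-∧ v x)
    (trans (cong₂ _⊕_ (trans (ΛK-linear a x (v ∧ y)) (cong (λ t → a · ΛK x ⊕ m1 · t) (ΛK-∧ v y))) (κ-∧ v x))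
    (trans (G-lemma a (hd v) (ΛK x) (K v ∧ ΛK y) (K v ∧ κ x))
      (cong (λ t → (a + hd v) · ΛK x ⊕ m1 · t) (sym (∧-⊕ (K v) (ΛK y) (κ x))))))
  κ-∧ [] ⟨ x ⟩ = cong ⟨_⟩ (sym (trans (cong₂ _+_ (zeroˡ x) (zeroʳ m1)) (+-identityʳ 0#)))
  κ-∧ (a ∷ v) (x ∣ y) = cong₂ _∣_
    (trans (ΛK-linear a x (v ∧ y)) (cong (λ t → a · ΛK x ⊕ m1 · t) (ΛK-∧ v y)))
    (trans (κ-linear a x (v ∧ y)) (trans (cong (λ t → a · κ x ⊕ m1 · t) (κ-∧ v y))
      (κ-lemma a (hd v) (ΛK y) (κ x) (K v ∧ κ y))))

  -- Stands in for nonnegativity in a ring without order.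
  IsNat : Carrier → Set
  IsNat s = ∃ λ k → s ≡ ι (+ k)

  nat-0 : IsNat 0#
  nat-0 = 0 , sym ι-0

  nat-1 : IsNat 1#
  nat-1 = 1 , sym ι-1

  nat-+ : ∀ {s t} → IsNat s → IsNat t → IsNat (s + t)
  nat-+ (j , refl) (k , refl) = j ℕ.+ k , sym (ι-+ (+ j) (+ k))

  AllNat : ∀ {m} → Λ m → Set
  AllNat ⟨ x ⟩ = IsNat x
  AllNat (x ∣ y) = AllNat x × AllNat y

  nat-𝟘 : ∀ {m} → AllNat (𝟘 {m})
  nat-𝟘 {zero} = nat-0
  nat-𝟘 {suc m} = nat-𝟘 , nat-𝟘

  nat-𝟙 : ∀ {m} → AllNat (𝟙 {m})
  nat-𝟙 {zero} = nat-1
  nat-𝟙 {suc m} = nat-𝟙 , nat-𝟘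

  nat-⊕ : ∀ {m} (x y : Λ m) → AllNat x → AllNat y → AllNat (x ⊕ y)
  nat-⊕ ⟨ x ⟩ ⟨ y ⟩ p q = nat-+ p q
  nat-⊕ (x ∣ x') (y ∣ y') (p , p') (q , q') = nat-⊕ x y p q , nat-⊕ x' y' p' q'

  nat-e₀ : ∀ {m} (x : Λ m) → AllNat x → AllNat (e₀ ∧ x)
  nat-e₀ ⟨ x ⟩ p = nat-0
  nat-e₀ (x ∣ y) (p , q) = subst AllNat (sym (e₀-∧ x y)) (nat-𝟘 , p)

  nat-ΛJ : ∀ {m} (x : Λ m) → AllNat x → AllNat (ΛJ x)
  nat-ΛJ ⟨ x ⟩ p = p
  nat-ΛJ (x ∣ y) (p , q) = nat-⊕ _ _ (nat-ΛJ x p) (nat-e₀ _ (nat-ΛJ y q)) , nat-ΛJ y q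

  nat-ΛK : ∀ {m} (x : Λ m) → AllNat x → AllNat (ΛK x)
  nat-κ : ∀ {m} (x : Λ m) → AllNat x → AllNat (κ x)
  nat-ΛK ⟨ x ⟩ p = p
  nat-ΛK (x ∣ y) (p , q) = nat-ΛK x p , nat-⊕ _ _ (nat-ΛK y q) (nat-κ x p)
  nat-κ ⟨ x ⟩ p = nat-0
  nat-κ (x ∣ y) (p , q) = nat-ΛK y q , nat-κ y q

  nat-top : ∀ {m} (x : Λ m) → AllNat x → IsNat (top x)
  nat-top ⟨ x ⟩ p = p
  nat-top (x ∣ y) (p , q) = nat-top y q

  ΛB² : ∀ {m} → Λ m → Λ m
  ΛB² x = ΛJ (ΛK (ΛJ (ΛK x)))

  ΛB²-𝟙 : ∀ {m} → ΛB² (𝟙 {m}) ≡ 𝟙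
  ΛB²-𝟙 = trans (cong (λ t → ΛJ (ΛK (ΛJ t))) ΛK-𝟙) (trans (cong (λ t → ΛJ (ΛK t)) ΛJ-𝟙)
    (trans (cong ΛJ ΛK-𝟙) ΛJ-𝟙))

  ΛB²-∧ : ∀ {m} (v : V m) x → ΛB² (v ∧ x) ≡ B (B v) ∧ ΛB² x
  ΛB²-∧ v x = trans (cong (λ t → ΛJ (ΛK (ΛJ t))) (ΛK-∧ v x))
    (trans (cong (λ t → ΛJ (ΛK t)) (ΛJ-∧ _ _)) (trans (cong ΛJ (ΛK-∧ _ _)) (ΛJ-∧ _ _)))

  krylov-map : ∀ {m} k (v : V m) → krylov k (B (B v)) ≡ map (λ u → B (B u)) (krylov k v)
  krylov-map zero v = refl
  krylov-map (suc k) v = cong (B (B v) ∷_) (krylov-map k (B (B v)))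

  -- The list e₀, B²e₀, B⁴e₀, ... is e₀ followed by the image under B² of a shorter such list, so
  -- its wedge is e₀ ∧ `ΛB²` of the shorter wedge. Wedging with the first basis vector from the left
  -- produces no sign.
  nat-krylov : ∀ {m} k → AllNat (wedge (krylov k (e₀ {m})))
  nat-krylov zero = nat-𝟙
  nat-krylov (suc k) = nat-e₀ _ (subst AllNat
    (trans (wedge-hom ΛB² (λ u → B (B u)) ΛB²-𝟙 ΛB²-∧ (krylov k e₀)) (cong wedge (sym (krylov-map k e₀))))
    (nat-ΛJ _ (nat-ΛK _ (nat-ΛJ _ (nat-ΛK _ (nat-krylov k))))))

-- Products and power sums

pairs : {A B : Set} → (A → A → B) → List A → List B
pairs f [] = []
pairs f (x ∷ xs) = map (f x) xs ++ pairs f xs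

pairs-length : {A B C : Set} (f : A → A → B) (g : A → A → C) → ∀ xs → length (pairs f xs) ≡ length (pairs g xs)
pairs-length f g [] = refl
pairs-length f g (x ∷ xs) = trans (length-++ (map (f x) xs)) (trans
  (cong₂ ℕ._+_ (trans (length-map (f x) xs) (sym (length-map (g x) xs))) (pairs-length f g xs))
  (sym (length-++ (map (g x) xs))))

module Series (S : Alg) where
  open AlgTheory S
  open Transfer S using (sumL; sumL-cong; sumL-++; sumL-map; sumL-zero)
  open Roots S

  infixr 8 _^_
  _^_ : Carrier → ℕ → Carrier
  x ^ zero = 1#
  x ^ suc k = x * x ^ k

  ^-* : ∀ x y k → (x * y) ^ k ≡ x ^ k * y ^ k
  ^-* x y zero = sym (*-identityˡ 1#)
  ^-* x y (suc k) = trans (mulˡ _ (^-* x y k))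
    (solve 4 (λ x y p q → (x :* y) :* (p :* q) := (x :* p) :* (y :* q)) refl x y (x ^ k) (y ^ k))

  add-sub : ∀ c x → (c + x) + - c ≡ x
  add-sub c x = solve 2 (λ c x → (c :+ x) :- c := x) refl c x

  negate-twice : ∀ x → ι -[1+ 0 ] * (ι -[1+ 0 ] * x) ≡ x
  negate-twice x = solve 1 (λ x → con -[1+ 0 ] :* (con -[1+ 0 ] :* x) := x) refl x

  prodL-++ : ∀ xs ys → prodL (xs ++ ys) ≡ prodL xs * prodL ys
  prodL-++ [] ys = sym (*-identityˡ _)
  prodL-++ (x ∷ xs) ys = trans (mulˡ x (prodL-++ xs ys)) (sym (*-assoc _ _ _))

  prodL-map-* : {A : Set} (f g : A → Carrier) (xs : List A) → prodL (map (λ x → f x * g x) xs) ≡ prodL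
    (map f xs) * prodL (map g xs)
  prodL-map-* f g [] = sym (*-identityˡ 1#)
  prodL-map-* f g (x ∷ xs) = trans (mulˡ _ (prodL-map-* f g xs))
    (solve 4 (λ x y p q → (x :* y) :* (p :* q) := (x :* p) :* (y :* q)) refl (f x) (g x) _ _)

  prodL-cong : {A : Set} {f g : A → Carrier} → (∀ x → f x ≡ g x) → (xs : List A) → prodL (map f xs) ≡ prodL
    (map g xs)
  prodL-cong e [] = refl
  prodL-cong e (x ∷ xs) = cong₂ _*_ (e x) (prodL-cong e xs)

  prodPairs : {A : Set} → (A → A → Carrier) → List A → Carrier
  prodPairs f [] = 1#
  prodPairs f (x ∷ xs) = prodL (map (f x) xs) * prodPairs f xs

  prodL-pairs : {A B : Set} (F : B → Carrier) (f : A → A → B) → ∀ xs → prodL (map F (pairs f xs)) ≡ prodPairs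
    (λ x y → F (f x y)) xs
  prodL-pairs F f [] = refl
  prodL-pairs F f (x ∷ xs) = trans (cong prodL (map-++ F (map (f x) xs) (pairs f xs)))
    (trans (prodL-++ (map F (map (f x) xs)) _) (cong₂ _*_ (cong prodL (sym (map-∘ xs))) (prodL-pairs F f xs)))

  module _ (f : Carrier → Carrier → Carrier) (f-sym : ∀ x y → f x y ≡ f y x) where

    prod-square : ∀ xs → prodL (map (λ x → prodL (map (f x) xs)) xs) ≡
      prodL (map (λ x → f x x) xs) * (prodPairs f xs * prodPairs f xs)
    prod-square [] = sym (trans (*-identityˡ _) (*-identityˡ 1#))
    prod-square (x ∷ xs) = trans (mulˡ _ (trans (prodL-map-* (λ y → f y x) (λ y → prodL (map (f y) xs)) xs)
      (cong₂ _*_ (prodL-cong (λ y → f-sym y x) xs) (prod-square xs))))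
      (solve 4 (λ d r p q → (d :* r) :* (r :* (p :* (q :* q))) := (d :* p) :* ((r :* q) :* (r :* q))) refl
        (f x x) (prodL (map (f x) xs)) _ _)

  conv : (ℕ → Carrier) → (ℕ → Carrier) → ℕ → Carrier
  conv p E zero = 0#
  conv p E (suc m) = p 0 * E m + conv (p ∘ suc) E m

  conv-cong : ∀ {p q E F} m → (∀ i → i ℕ.< m → p i ≡ q i) → (∀ i → i ℕ.< m → E i ≡ F i) → conv p E m ≡
    conv q F m
  conv-cong zero ep eE = refl
  conv-cong (suc m) ep eE = cong₂ _+_ (cong₂ _*_ (ep 0 (s≤s z≤n)) (eE m ℕP.≤-refl))
    (conv-cong m (λ i l → ep (suc i) (s≤s l)) (λ i l → eE i (ℕP.m<n⇒m<1+n l)))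

  conv-+ : ∀ p q E m → conv (λ i → p i + q i) E m ≡ conv p E m + conv q E m
  conv-+ p q E zero = sym (+-identityʳ 0#)
  conv-+ p q E (suc m) = trans (addˡ _ (conv-+ (p ∘ suc) (q ∘ suc) E m))
    (solve 5 (λ p q e x y → (p :+ q) :* e :+ (x :+ y) := (p :* e :+ x) :+ (q :* e :+ y)) refl (p 0) (q 0)
      (E m) _ _)

  conv-linear : ∀ p E c F m → conv p (λ i → E i + c * F i) m ≡ conv p E m + c * conv p F m
  conv-linear p E c F zero = sym (trans (+-identityˡ _) (zeroʳ c))
  conv-linear p E c F (suc m) = trans (addˡ _ (conv-linear (p ∘ suc) E c F m))
    (solve 6 (λ p e c f x y → p :* (e :+ c :* f) :+ (x :+ c :* y) := (p :* e :+ x) :+ c :* (p :* f :+ y)) refl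
      (p 0) (E m) c (F m) _ _)

  conv-scale : ∀ c p E m → conv (λ i → c * p i) E m ≡ c * conv p E m
  conv-scale c p E zero = sym (zeroʳ c)
  conv-scale c p E (suc m) = trans (addˡ _ (conv-scale c (p ∘ suc) E m))
    (solve 4 (λ c p e x → (c :* p) :* e :+ c :* x := c :* (p :* e :+ x)) refl c (p 0) (E m) _)

  conv-shift : ∀ p E m → conv p (shift E) (suc m) ≡ conv p E m
  conv-shift p E zero = trans (+-identityʳ _) (zeroʳ (p 0))
  conv-shift p E (suc m) = addˡ _ (conv-shift (p ∘ suc) E m)

  conv-last : ∀ p E m → conv p E (suc m) ≡ conv p (E ∘ suc) m + p m * E 0
  conv-last p E zero = +-comm _ _
  conv-last p E (suc m) = trans (addˡ _ (conv-last (p ∘ suc) E m)) (sym (+-assoc _ _ _))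

  conv-δ : ∀ p m → conv p δ (suc m) ≡ p m
  conv-δ p zero = trans (+-identityʳ _) (*-identityʳ _)
  conv-δ p (suc m) = trans (cong (_+ conv (p ∘ suc) δ (suc m)) (zeroʳ (p 0)))
    (trans (+-identityˡ _) (conv-δ (p ∘ suc) m))

  -- u E′(u) = p(u) E(u), where p i is the coefficient of uⁱ⁺¹.
  LogDeriv : (ℕ → Carrier) → (ℕ → Carrier) → Set
  LogDeriv p E = ∀ m → ι (+ m) * E m ≡ conv p E m

  mulFactor : Carrier → (ℕ → Carrier) → ℕ → Carrier
  mulFactor x E i = E i + x * shift E i

  prodFactors : List Carrier → ℕ → Carrier
  prodFactors [] = δ
  prodFactors (x ∷ xs) = mulFactor x (prodFactors xs)

  altPower : Carrier → ℕ → Carrier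
  altPower x zero = x
  altPower x (suc i) = (- x) * altPower x i

  altSum : List Carrier → ℕ → Carrier
  altSum [] i = 0#
  altSum (x ∷ xs) i = altPower x i + altSum xs i

  ι-suc : ∀ m → ι (+ suc m) ≡ 1# + ι (+ m)
  ι-suc m = trans (ι-+ (+ 1) (+ m)) (cong (_+ ι (+ m)) ι-1)

  conv-altPower : ∀ x E m → conv (altPower x) (mulFactor x E) m ≡ x * shift E m
  conv-altPower x E zero = sym (zeroʳ x)
  conv-altPower x E (suc m) = trans (addˡ _ (trans (conv-scale (- x) (altPower x) (mulFactor x E) m)
    (mulˡ (- x) (conv-altPower x E m))))
    (solve 3 (λ x e s → x :* (e :+ x :* s) :+ (:- x) :* (x :* s) := x :* e) refl x (E m) (shift E m))

  logDeriv-factor : ∀ x {p E} → LogDeriv p E → LogDeriv (λ i → altPower x i + p i) (mulFactor x E)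
  logDeriv-factor x {p} {E} l zero = trans (cong (_* mulFactor x E 0) ι-0) (zeroˡ _)
  logDeriv-factor x {p} {E} l (suc m) = trans
    (trans (solve 4 (λ k x e f → k :* (e :+ x :* f) := k :* e :+ x :* (k :* f)) refl (ι (+ suc m)) x
      (E (suc m)) (E m))
      (cong₂ (λ s t → s + x * t) (l (suc m)) (trans (cong (_* E m) (ι-suc m))
        (trans (distribʳ (E m) 1# (ι (+ m))) (cong₂ _+_ (*-identityˡ _) (l m))))))
    (sym (trans (conv-+ (altPower x) p (mulFactor x E) (suc m))
      (trans (cong₂ _+_ (conv-altPower x E (suc m)) (trans (conv-linear p E x (shift E) (suc m))
        (addˡ _ (mulˡ x (conv-shift p E m)))))
        (solve 4 (λ x e a b → x :* e :+ (a :+ x :* b) := a :+ x :* (e :+ b)) refl x (E m) _ _))))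

  logDeriv-δ : LogDeriv (λ _ → 0#) δ
  logDeriv-δ zero = trans (cong (_* 1#) ι-0) (zeroˡ _)
  logDeriv-δ (suc m) = trans (zeroʳ _) (sym (conv-δ (λ _ → 0#) m))

  newton-identities : ∀ xs → LogDeriv (altSum xs) (prodFactors xs)
  newton-identities [] = logDeriv-δ
  newton-identities (x ∷ xs) = logDeriv-factor x (newton-identities xs)

  prodFactors-0 : ∀ xs → prodFactors xs 0 ≡ 1#
  prodFactors-0 [] = refl
  prodFactors-0 (x ∷ xs) = trans (cong₂ _+_ (prodFactors-0 xs) (zeroʳ x)) (+-identityʳ 1#)

  prodFactors-degree : ∀ xs i → length xs ℕ.< i → prodFactors xs i ≡ 0#
  prodFactors-degree [] (suc i) p = refl
  prodFactors-degree (x ∷ xs) (suc i) (s≤s p) = trans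
    (cong₂ (λ s t → s + x * t) (prodFactors-degree xs (suc i) (ℕP.≤-trans p (ℕP.n≤1+n i)))
      (prodFactors-degree xs i p))
    (trans (+-identityˡ _) (zeroʳ _))

  -- The coefficient of index i + 1, multiplied by i + 1, is determined by the earlier ones;
  -- torsion-freeness cancels the factor.
  logDeriv-unique : ∀ {p q E F} → E 0 ≡ F 0 → (∀ i → p i ≡ q i) → LogDeriv p E → LogDeriv q F → ∀ m → E m ≡ F m
  logDeriv-unique {p} {q} {E} {F} e0 e l l' m = below (suc m) m ℕP.≤-refl
    where
    below : ∀ k i → i ℕ.< k → E i ≡ F i
    below (suc k) zero _ = e0
    below (suc k) (suc i) (s≤s i<k) = cancel i (E (suc i)) (F (suc i))
      (trans (l (suc i)) (trans (conv-cong (suc i) (λ j _ → e j) (λ j j≤i → below k j (ℕP.≤-trans j≤i i<k)))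
        (sym (l' (suc i)))))

  homogeneous : Carrier → (ℕ → Carrier) → ℕ → Carrier
  homogeneous c E zero = E 0
  homogeneous c E (suc k) = c * homogeneous c E k + E (suc k)

  homogeneous-factor : ∀ c x E k → homogeneous c (mulFactor x E) (suc k) ≡ homogeneous c E
    (suc k) + x * homogeneous c E k
  homogeneous-factor c x E zero = trans (cong (λ z → c * (E 0 + z) + (E 1 + x * E 0)) (zeroʳ x))
    (trans (cong (λ z → c * z + (E 1 + x * E 0)) (+-identityʳ _)) (sym (+-assoc _ _ _)))
  homogeneous-factor c x E (suc k) = trans (cong (λ t → c * t + (E (suc (suc k)) + x * E (suc k)))
    (homogeneous-factor c x E k))
    (solve 6 (λ c x h h' e f → c :* (h :+ x :* h') :+ (f :+ x :* e) := (c :* h :+ f) :+ x :* (c :* h' :+ e))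
      refl c x (homogeneous c E (suc k)) (homogeneous c E k) (E (suc k)) (E (suc (suc k))))

  prod-homogeneous : ∀ c xs → prodL (map (λ x → c + x) xs) ≡ homogeneous c (prodFactors xs) (length xs)
  prod-homogeneous c [] = refl
  prod-homogeneous c (x ∷ xs) = trans (mulˡ _ (prod-homogeneous c xs))
    (sym (trans (homogeneous-factor c x (prodFactors xs) (length xs))
      (trans (cong (λ t → c * h + t + x * h) (prodFactors-degree xs _ ℕP.≤-refl))
        (trans (cong (_+ x * h) (+-identityʳ _)) (sym (distribʳ h c x))))))
    where
    h : Carrier
    h = homogeneous c (prodFactors xs) (length xs)

  homogeneous-cong : ∀ c {E F} → (∀ i → E i ≡ F i) → ∀ k → homogeneous c E k ≡ homogeneous c F k
  homogeneous-cong c e zero = e 0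
  homogeneous-cong c e (suc k) = cong₂ (λ s t → c * s + t) (homogeneous-cong c e k) (e (suc k))

  -- By Newton's identities equal power sums give equal elementary symmetric functions, and the
  -- product is a combination of these.
  prod-determined : ∀ c xs ys → length xs ≡ length ys → (∀ i → altSum xs i ≡ altSum ys i) →
    prodL (map (λ x → c + x) xs) ≡ prodL (map (λ x → c + x) ys)
  prod-determined c xs ys len e = trans (prod-homogeneous c xs)
    (trans (homogeneous-cong c (logDeriv-unique (trans (prodFactors-0 xs) (sym (prodFactors-0 ys))) e
      (newton-identities xs) (newton-identities ys)) (length xs))
    (trans (cong (homogeneous c (prodFactors ys)) len) (sym (prod-homogeneous c ys))))

  partialSum : Carrier → (ℕ → Carrier) → ℕ → Carrier
  partialSum c E zero = 0#
  partialSum c E (suc k) = partialSum c E k + c ^ k * E k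

  partialSum-factor : ∀ c x E k → partialSum c (mulFactor x E) (suc k) ≡ partialSum c E
    (suc k) + c * x * partialSum c E k
  partialSum-factor c x E zero = trans (cong (λ z → 0# + 1# * (E 0 + z)) (zeroʳ x))
    (trans (cong (λ z → 0# + 1# * z) (+-identityʳ _)) (sym (trans (addˡ _ (zeroʳ (c * x))) (+-identityʳ _))))
  partialSum-factor c x E (suc k) = trans (cong (_+ c ^ suc k * mulFactor x E (suc k))
    (partialSum-factor c x E k))
    (solve 7 (λ c x s s' ck e f → (s :+ c :* x :* s') :+ (c :* ck) :* (f :+ x :* e) :=
      (s :+ (c :* ck) :* f) :+ c :* x :* (s' :+ ck :* e)) refl
      c x (partialSum c E (suc k)) (partialSum c E k) (c ^ k) (E k) (E (suc k)))

  -- The j-th elementary symmetric function enters with cʲ, so the terms beyond k are divisible by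
  -- cᵏ⁺¹, however many factors there are.
  prod-partialSum : ∀ c k xs → ∃ λ r → prodL (map (λ x → 1# + c * x) xs) ≡ partialSum c (prodFactors xs)
    (suc k) + c ^ suc k * r
  prod-partialSum c k [] = 0# , sym (trans (addˡ _ (zeroʳ _)) (trans (+-identityʳ _) (const k)))
    where
    const : ∀ k → partialSum c δ (suc k) ≡ 1#
    const zero = trans (+-identityˡ _) (*-identityʳ 1#)
    const (suc k) = trans (cong₂ _+_ (const k) (zeroʳ _)) (+-identityʳ 1#)
  prod-partialSum c k (x ∷ xs) with prod-partialSum c k xs
  ... | r , e = x * prodFactors xs k + (1# + c * x) * r ,
    trans (mulˡ (1# + c * x) e) (trans (lem c x (partialSum c (prodFactors xs) k) (c ^ k) (prodFactors xs k) r)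
      (cong (_+ c ^ suc k * (x * prodFactors xs k + (1# + c * x) * r))
        (sym (partialSum-factor c x (prodFactors xs) k))))
    where
    lem : ∀ c x s q e r → (1# + c * x) * ((s + q * e) + (c * q) * r) ≡
      ((s + q * e) + c * x * s) + (c * q) * (x * e + (1# + c * x) * r)
    lem c x s q e r = trans (cong (λ o → (o + c * x) * ((s + q * e) + (c * q) * r)) (sym ι-1))
      (trans (solve 6 (λ c x s q e r → (con (+ 1) :+ c :* x) :* ((s :+ q :* e) :+ (c :* q) :* r) :=
        ((s :+ q :* e) :+ c :* x :* s) :+ (c :* q) :* (x :* e :+ (con (+ 1) :+ c :* x) :* r)) refl c x s q e r)
        (cong (λ o → ((s + q * e) + c * x * s) + (c * q) * (x * e + (o + c * x) * r)) ι-1))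

  altPower-^ : ∀ x i → altPower x i ≡ (ι -[1+ 0 ]) ^ i * x ^ suc i
  altPower-^ x zero = sym (trans (*-identityˡ _) (*-identityʳ x))
  altPower-^ x (suc i) = trans (mulˡ (- x) (altPower-^ x i))
    (solve 3 (λ x m p → (:- x) :* (m :* (x :* p)) := (con -[1+ 0 ] :* m) :* (x :* (x :* p))) refl x
      ((ι -[1+ 0 ]) ^ i) (x ^ i))

  altSum-^ : ∀ xs i → altSum xs i ≡ (ι -[1+ 0 ]) ^ i * sumL xs (_^ suc i)
  altSum-^ [] i = sym (zeroʳ _)
  altSum-^ (x ∷ xs) i = trans (cong₂ _+_ (altPower-^ x i) (altSum-^ xs i)) (sym (distribˡ _ _ _))

  sumL-+ : {A : Set} (xs : List A) (f g : A → Carrier) → sumL xs (λ x → f x + g x) ≡ sumL xs f + sumL xs g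
  sumL-+ [] f g = sym (+-identityʳ 0#)
  sumL-+ (x ∷ xs) f g = trans (addˡ _ (sumL-+ xs f g))
    (solve 4 (λ a b c d → (a :+ b) :+ (c :+ d) := (a :+ c) :+ (b :+ d)) refl (f x) (g x) _ _)

  sumL-* : {A : Set} (c : Carrier) (xs : List A) (f : A → Carrier) → sumL xs (λ x → c * f x) ≡ c * sumL xs f
  sumL-* c [] f = sym (zeroʳ c)
  sumL-* c (x ∷ xs) f = trans (addˡ _ (sumL-* c xs f)) (sym (distribˡ _ _ _))

  sumL-pairs : {A : Set} (F : Carrier → Carrier) (f : A → A → Carrier) (xs : List A) →
    sumL (pairs f xs) F ≡ sumL (pairs (λ x y → F (f x y)) xs) (λ z → z)
  sumL-pairs F f [] = refl
  sumL-pairs F f (x ∷ xs) = trans (sumL-++ (map (f x) xs) _ F)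
    (trans (cong₂ _+_ (trans (sumL-map (f x) xs F) (sym (sumL-map _ xs (λ z → z)))) (sumL-pairs F f xs))
      (sym (sumL-++ (map (λ y → F (f x y)) xs) _ (λ z → z))))

  pairSum : {A : Set} → (A → A → Carrier) → List A → Carrier
  pairSum f xs = sumL (pairs f xs) (λ z → z)

  double-sum : (f : Carrier → Carrier → Carrier) → (∀ x y → f x y ≡ f y x) → ∀ xs →
    sumL xs (λ x → sumL xs (f x)) ≡ sumL xs (λ x → f x x) + (pairSum f xs + pairSum f xs)
  double-sum f f-sym [] = sym (trans (+-identityˡ _) (+-identityʳ 0#))
  double-sum f f-sym (x ∷ xs) = trans
    (cong₂ (λ s t → (f x x + s) + t) refl (trans (sumL-+ xs (λ y → f y x) (λ y → sumL xs (f y)))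
      (cong₂ _+_ (sumL-cong xs (λ y → f-sym y x)) (double-sum f f-sym xs))))
    (trans (solve 4 (λ d r p q → (d :+ r) :+ (r :+ (p :+ (q :+ q))) := (d :+ p) :+ ((r :+ q) :+ (r :+ q)))
      refl (f x x) (sumL xs (f x)) _ _)
      (cong (λ t → (f x x + sumL xs (λ x → f x x)) + (t + t))
        (trans (cong (_+ pairSum f xs) (sym (sumL-map (f x) xs (λ z → z))))
          (sym (sumL-++ (map (f x) xs) _ (λ z → z))))))

-- Roots of unity

open import Data.Integer.Divisibility.Signed as ℤ∣
  using (_∣_; divides; ∣m∣n⇒∣m+n; ∣m∣n⇒∣m-n; ∣n⇒∣m*n; ∣m⇒∣m*n; ∣ᵤ⇒∣; ∣⇒∣ᵤ)

odd : ℕ → ℕ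
odd n = suc (dbl n)

module Spectrum (S : Alg) where
  open AlgTheory S
  open Transfer S using (sumL; sumL-cong; sumL-++; sumL-map; sumL-zero)
  open Roots S
  open Series S

  -- chebL k (z + 1/z) = zᵏ + z⁻ᵏ.
  chebL : ℕ → Carrier → Carrier
  chebL zero x = two
  chebL (suc zero) x = x
  chebL (suc (suc k)) x = x * chebL (suc k) x + - chebL k x

  chebL-from : ℕ → Carrier → ℕ → Carrier
  chebL-from a x zero = chebL (suc a) x
  chebL-from a x (suc i) = chebL-from (suc a) x i

  chebL-from-≡ : ∀ a x i → chebL-from a x i ≡ chebL (suc (a ℕ.+ i)) x
  chebL-from-≡ a x zero = cong (λ k → chebL (suc k) x) (sym (ℕP.+-identityʳ a))
  chebL-from-≡ a x (suc i) = trans (chebL-from-≡ (suc a) x i)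
    (cong (λ k → chebL (suc k) x) (sym (ℕP.+-suc a i)))

  mulQuadratic : Carrier → (ℕ → Carrier) → ℕ → Carrier
  mulQuadratic γ E i = (E i + shift (shift E) i) + (- γ) * shift E i

  shift-cong : ∀ {E F} → (∀ i → E i ≡ F i) → ∀ i → shift E i ≡ shift F i
  shift-cong e zero = refl
  shift-cong e (suc i) = e i

  shift-linear : ∀ E c F i → shift (λ i → E i + c * F i) i ≡ shift E i + c * shift F i
  shift-linear E c F zero = sym (trans (+-identityˡ _) (zeroʳ c))
  shift-linear E c F (suc i) = refl

  shift-+ : ∀ E F i → shift (λ i → E i + F i) i ≡ shift E i + shift F i
  shift-+ E F zero = sym (+-identityʳ 0#)
  shift-+ E F (suc i) = refl

  shift-* : ∀ c F i → shift (λ i → c * F i) i ≡ c * shift F i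
  shift-* c F zero = sym (zeroʳ c)
  shift-* c F (suc i) = refl

  conv-mulQuadratic : ∀ p γ E m → conv p (mulQuadratic γ E) m ≡ (conv p E m + conv p (shift (shift E)) m) +
    (- γ) * conv p (shift E) m
  conv-mulQuadratic p γ E m = trans (conv-linear p _ (- γ) (shift E) m) (cong (_+ (- γ) * conv p (shift E) m)
    (trans (conv-cong {F = λ i → E i + 1# * shift (shift E) i} m (λ _ _ → refl)
      (λ i _ → addˡ (E i) (sym (*-identityˡ _))))
      (trans (conv-linear p E 1# _ m) (addˡ _ (*-identityˡ _)))))

  -- By the recurrence of `chebL`, multiplying its generating series by 1 - γu + u² leaves only two
  -- boundary terms.
  conv-chebL : ∀ a γ E m → conv (chebL-from a γ) (mulQuadratic γ E) m ≡ chebL (suc a) γ * shift E m +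
    (- chebL a γ) * shift (shift E) m
  conv-chebL a γ E zero = sym (trans (cong₂ _+_ (zeroʳ _) (zeroʳ _)) (+-identityʳ 0#))
  conv-chebL a γ E (suc m) = trans (addˡ _ (conv-chebL (suc a) γ E m))
    (solve 6 (λ γ l l' e s t → l :* ((e :+ t) :+ (:- γ) :* s) :+
      ((γ :* l :+ :- l') :* s :+ (:- l) :* t) := l :* e :+ (:- l') :* s) refl
      γ (chebL (suc a) γ) (chebL a γ) (E m) (shift E m) (shift (shift E) m))

  -- For γ = z + 1/z one has 1 - γu + u² = (1 - zu)(1 - u/z), with logarithmic derivative given by
  -- -(zᵏ + z⁻ᵏ). The telescoping of `conv-chebL` proves this without adjoining z.
  logDeriv-quadratic : ∀ γ {p E} → LogDeriv p E → LogDeriv (λ i → p i + ι -[1+ 0 ] * chebL-from 0 γ i)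
    (mulQuadratic γ E)
  logDeriv-quadratic γ {p} {E} l zero = trans (cong (_* mulQuadratic γ E 0) ι-0) (zeroˡ _)
  logDeriv-quadratic γ {p} {E} l (suc m) = trans
    (trans (solve 5 (λ k γ e e' s → k :* ((e :+ s) :+ (:- γ) :* e') := (k :* e :+ k :* s) :+ (:- γ) :*
      (k :* e')) refl (ι (+ suc m)) γ (E (suc m)) (E m) (shift E m))
      (cong₂ (λ s t → s + (- γ) * t) (cong₂ _+_ (l (suc m)) (twice m))
        (trans (cong (_* E m) (ι-suc m)) (trans (distribʳ (E m) 1# (ι (+ m)))
          (cong₂ _+_ (*-identityˡ _) (l m))))))
    (sym (trans (conv-+ p (λ i → ι -[1+ 0 ] * chebL-from 0 γ i) _ (suc m))
      (trans (cong₂ _+_ (conv-mulQuadratic p γ E (suc m))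
        (trans (conv-scale _ (chebL-from 0 γ) _ (suc m)) (mulˡ _ (conv-chebL 0 γ E (suc m)))))
      (trans (cong₂ (λ s t → ((conv p E (suc m) + s) + (- γ) * t) + ι -[1+ 0 ] *
        (γ * E m + (- two) * shift E m)) (conv-shift p (shift E) m) (conv-shift p E m))
        (solve 6 (λ γ e s a b c → ((a :+ b) :+ (:- γ) :* c) :+ con -[1+ 0 ] :*
          (γ :* e :+ (:- con (+ 2)) :* s) := (a :+ (con (+ 2) :* s :+ b)) :+ (:- γ) :* (e :+ c)) refl
          γ (E m) (shift E m) (conv p E (suc m)) (conv p (shift E) m) (conv p E m))))))
    where
    twice : ∀ m → ι (+ suc m) * shift E m ≡ two * shift E m + conv p (shift E) m
    twice zero = trans (zeroʳ _) (sym (trans (+-identityʳ _) (zeroʳ _)))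
    twice (suc m) = trans (cong (_* E m) (ι-+ (+ 2) (+ m)))
      (trans (distribʳ (E m) two (ι (+ m))) (addˡ _ (trans (l m) (sym (conv-shift p E m)))))

  -- Power series in u with a = 1 + u² and b = u: here ∏ (a - γb) = ∏ (1 - γu + u²), and bⁿ V_n(a /
  -- b) = 1 + u + ... + u²ⁿ.
  seqMod : LinMod
  seqMod = record
    { X = ℕ → Carrier ; _≈_ = λ E F → ∀ i → E i ≡ F i
    ; ≈-refl = λ i → refl ; ≈-sym = λ e i → sym (e i) ; ≈-trans = λ e f i → trans (e i) (f i)
    ; _⊞_ = λ E F i → E i + F i ; _⊡_ = λ c E i → c * E i ; 𝟎 = λ i → 0#
    ; ⊞-cong = λ e f i → cong₂ _+_ (e i) (f i) ; ⊡-cong = λ c e i → mulˡ c (e i)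
    ; ⊞-comm = λ E F i → +-comm _ _
    ; ⊞-interchange = λ x y z w i → solve 4 (λ x y z w → (x :+ y) :+ (z :+ w) := (x :+ z) :+ (y :+ w)) refl
      (x i) (y i) (z i) (w i)
    ; ⊞-identityˡ = λ x i → +-identityˡ _
    ; ⊡-⊞ = λ c x y i → distribˡ _ _ _ ; +-⊡ = λ a b x i → distribʳ _ _ _ ; *-⊡ = λ a b x i → *-assoc _ _ _
    ; 1-⊡ = λ x i → *-identityˡ _ ; 0-⊡ = λ x i → zeroˡ _
    ; a = λ E i → E i + shift (shift E) i ; b = shift
    ; a-cong = λ e i → cong₂ _+_ (e i) (shift-cong (shift-cong e) i) ; b-cong = shift-cong
    ; a-⊞ = λ x y i → trans (addˡ _ (trans (shift-cong (shift-+ x y) i) (shift-+ _ _ i)))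
        (solve 4 (λ x y z w → (x :+ y) :+ (z :+ w) := (x :+ z) :+ (y :+ w)) refl (x i) (y i) _ _)
    ; b-⊞ = shift-+
    ; a-⊡ = λ c x i → trans (addˡ _ (trans (shift-cong (shift-* c x) i) (shift-* c _ i))) (sym (distribˡ _ _ _))
    ; b-⊡ = shift-*
    ; ab-comm = λ x i → shift-+ x _ i }

  open Evaluation seqMod using (applyRoots; applyRoots-cheb; cheb)

  monomial : ℕ → ℕ → Carrier
  monomial zero = δ
  monomial (suc j) = shift (monomial j)

  monomial-≡ : ∀ j → monomial j j ≡ 1#
  monomial-≡ zero = refl
  monomial-≡ (suc j) = monomial-≡ j

  monomial-< : ∀ j i → i ℕ.< j → monomial j i ≡ 0#
  monomial-< (suc j) zero _ = refl
  monomial-< (suc j) (suc i) (s≤s p) = monomial-< j i p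

  monomial-> : ∀ j i → monomial j (j ℕ.+ suc i) ≡ 0#
  monomial-> zero i = refl
  monomial-> (suc j) i = monomial-> j i

  -1# : Carrier
  -1# = ι -[1+ 0 ]

  conv-monomial-≤ : ∀ p j m → m ℕ.≤ j → conv p (monomial j) m ≡ 0#
  conv-monomial-≤ p j zero q = refl
  conv-monomial-≤ p (suc j) (suc m) (s≤s q) = trans (conv-shift p (monomial j) m) (conv-monomial-≤ p j m q)

  conv-monomial-> : ∀ p j i → conv p (monomial j) (suc (j ℕ.+ i)) ≡ p i
  conv-monomial-> p zero i = conv-δ p i
  conv-monomial-> p (suc j) i = trans (conv-shift p (monomial j) (suc (j ℕ.+ i))) (conv-monomial-> p j i)

  -- The coefficients of 1 − uᴺ for N = 2k + 1.
  binomial : ℕ → ℕ → Carrier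
  binomial k i = δ i + -1# * monomial (odd k) i

  shift²-linear : ∀ E c F i → shift (shift (λ i → E i + c * F i)) i ≡ shift (shift E) i + c * shift (shift F) i
  shift²-linear E c F i = trans (shift-cong (shift-linear E c F) i) (shift-linear _ c _ i)

  -- The factor 1 - u closes the geometric sum 1 + u + ... + u²ᵏ. The induction follows the
  -- recurrence of `cheb`, which the binomials also satisfy.
  binomial-cheb : ∀ k i → mulFactor -1# (cheb k δ) i ≡ binomial k i
  binomial-cheb zero i = refl
  binomial-cheb (suc zero) zero = trans (cong₂ _+_ (trans (cong (_+ 0#) (+-identityʳ 1#)) (+-identityʳ 1#))
    (zeroʳ _)) (addˡ 1# (sym (zeroʳ _)))
  binomial-cheb (suc zero) (suc i) =
    solve 4 (λ z d s t → ((z :+ s) :+ d) :+ con -[1+ 0 ] :* ((d :+ t) :+ s) := z :+ con -[1+ 0 ] :* t) refl 0#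
      (δ i) (shift δ i) (shift (shift δ) i)
  binomial-cheb (suc (suc k)) i = trans
    (trans (addˡ _ (mulˡ -1# (trans (shift-linear (λ i → E₁ i + shift (shift E₁) i) -1# (shift (shift E₀)) i)
        (cong (_+ -1# * shift (shift (shift E₀)) i) (shift-+ E₁ (shift (shift E₁)) i)))))
      (solve 6 (λ e e' f f' g g' → ((e :+ f) :+ con -[1+ 0 ] :* g) :+ con -[1+ 0 ] :*
        ((e' :+ f') :+ con -[1+ 0 ] :* g')
        := ((e :+ con -[1+ 0 ] :* e') :+ (f :+ con -[1+ 0 ] :* f')) :+ con -[1+ 0 ] :*
          (g :+ con -[1+ 0 ] :* g')) refl
        (E₁ i) (shift E₁ i) (shift (shift E₁) i) (shift (shift (shift E₁)) i) (shift (shift E₀) i)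
          (shift (shift (shift E₀)) i)))
    (trans (cong₂ _+_ (cong₂ _+_ (binomial-cheb (suc k) i) (push (suc k))) (mulˡ -1# (push k)))
      (solve 4 (λ d d' A A' → ((d :+ con -[1+ 0 ] :* A) :+ (d' :+ con -[1+ 0 ] :* A')) :+ con -[1+ 0 ] :*
        (d' :+ con -[1+ 0 ] :* A)
        := d :+ con -[1+ 0 ] :* A') refl (δ i) (shift (shift δ) i) (monomial (odd (suc k)) i)
          (monomial (odd (suc (suc k))) i)))
    where
    E₀ E₁ : ℕ → Carrier
    E₀ = cheb k δ
    E₁ = cheb (suc k) δ
    push : ∀ k → shift (shift (cheb k δ)) i + -1# * shift (shift (shift (cheb k δ))) i ≡ shift
      (shift δ) i + -1# * monomial (odd (suc k)) i
    push k = trans (sym (shift²-linear (cheb k δ) -1# (shift (cheb k δ)) i))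
      (trans (shift-cong (shift-cong (binomial-cheb k)) i) (shift²-linear δ -1# (monomial (odd k)) i))

  -- The sum of zᵃ over all N-th roots of unity z.
  chebSum : List Carrier → ℕ → Carrier
  chebSum γs a = 1# + sumL γs (chebL a)

  quadraticSum : List Carrier → ℕ → Carrier
  quadraticSum [] i = 0#
  quadraticSum (γ ∷ γs) i = quadraticSum γs i + -1# * chebL-from 0 γ i

  logDeriv-quadratics : ∀ γs → LogDeriv (quadraticSum γs) (applyRoots γs δ)
  logDeriv-quadratics [] = logDeriv-δ
  logDeriv-quadratics (γ ∷ γs) = logDeriv-quadratic γ (logDeriv-quadratics γs)

  quadraticSum-chebSum : ∀ γs i → altPower -1# i + quadraticSum γs i ≡ -1# * chebSum γs (suc i)
  quadraticSum-chebSum γs i = trans (cong₂ _+_ (alt i) (sums γs))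
    (sym (trans (distribˡ _ _ _) (cong (_+ -1# * sumL γs (chebL (suc i))) (*-identityʳ -1#))))
    where
    alt : ∀ i → altPower -1# i ≡ -1#
    alt zero = refl
    alt (suc i) = trans (mulˡ _ (alt i)) (solve 0 ((:- con -[1+ 0 ]) :* con -[1+ 0 ] := con -[1+ 0 ]) refl)
    sums : ∀ γs → quadraticSum γs i ≡ -1# * sumL γs (chebL (suc i))
    sums [] = sym (zeroʳ _)
    sums (γ ∷ γs) = trans (cong₂ (λ s t → s + -1# * t) (sums γs) (chebL-from-≡ 0 γ i))
      (trans (+-comm _ _) (sym (distribˡ _ _ _)))

  module _ (γs : List Carrier) (roots : IsRoots γs) where

    private
      n N : ℕ
      n = length γs
      N = odd n
      t : ℕ → Carrier
      t = chebSum γs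

    -- Logarithmic derivatives of both sides of (1 - u) ∏ (1 - γⱼu + u²) = 1 - uᴺ.
    binomial-logDeriv : ∀ m → ι (+ m) * binomial n m ≡ -1# * conv (λ i → t (suc i)) (binomial n) m
    binomial-logDeriv m = trans (mulˡ (ι (+ m)) (sym (eq m)))
      (trans (logDeriv-factor -1# (logDeriv-quadratics γs) m)
      (trans (conv-cong m (λ i _ → quadraticSum-chebSum γs i) (λ i _ → eq i))
        (conv-scale -1# _ (binomial n) m)))
      where
      eq : ∀ i → mulFactor -1# (applyRoots γs δ) i ≡ binomial n i
      eq i = trans (cong₂ (λ s t → s + -1# * t) (applyRoots-cheb γs roots δ i)
        (shift-cong (applyRoots-cheb γs roots δ) i)) (binomial-cheb n i)

    chebSum-equation : ∀ m → t (suc m) ≡ -1# * (ι (+ suc m) * (-1# * monomial N (suc m))) + conv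
      (λ i → t (suc i)) (monomial N) (suc m)
    chebSum-equation m = trans
      (solve 2 (λ s c → s := con -[1+ 0 ] :* (con -[1+ 0 ] :* (s :+ con -[1+ 0 ] :* c)) :+ c) refl (t (suc m))
        (conv (λ i → t (suc i)) (monomial N) (suc m)))
      (cong (λ z → -1# * z + conv (λ i → t (suc i)) (monomial N) (suc m))
        (trans (mulˡ -1# (sym (trans (conv-linear (λ i → t (suc i)) δ -1# (monomial N) (suc m))
          (cong (_+ -1# * conv (λ i → t (suc i)) (monomial N) (suc m)) (conv-δ (λ i → t (suc i)) m)))))
          (trans (sym (binomial-logDeriv (suc m))) (mulˡ (ι (+ suc m)) (+-identityˡ _)))))

    chebSum-small : ∀ m → suc m ℕ.< N → t (suc m) ≡ 0#
    chebSum-small m l = trans (chebSum-equation m)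
      (trans (cong₂ (λ x y → -1# * (ι (+ suc m) * (-1# * x)) + y) (monomial-< N (suc m) l)
        (conv-monomial-≤ (λ i → t (suc i)) N (suc m) (ℕP.<⇒≤ l)))
        (trans (+-identityʳ _) (trans (mulˡ _ (trans (mulˡ _ (zeroʳ _)) (zeroʳ _))) (zeroʳ _))))

    chebSum-N : t N ≡ ι (+ N)
    chebSum-N = trans (chebSum-equation (dbl n))
      (trans (cong₂ (λ x y → -1# * (ι (+ N) * (-1# * x)) + y) (monomial-≡ N)
        (conv-monomial-≤ (λ i → t (suc i)) N N ℕP.≤-refl))
        (trans (+-identityʳ _) (trans (mulˡ -1# (mulˡ _ (*-identityʳ -1#)))
          (solve 1 (λ x → con -[1+ 0 ] :* (x :* con -[1+ 0 ]) := x) refl (ι (+ N))))))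

    chebSum-0 : t 0 ≡ ι (+ N)
    chebSum-0 = trans (addˡ 1# (count γs)) (sym (ι-suc (dbl n)))
      where
      count : ∀ γs → sumL γs (chebL 0) ≡ ι (+ dbl (length γs))
      count [] = sym ι-0
      count (γ ∷ γs) = trans (addˡ two (count γs)) (sym (ι-+ (+ 2) (+ dbl (length γs))))

    chebSum-period : ∀ a → t (N ℕ.+ a) ≡ t a
    chebSum-period zero = trans (cong t (ℕP.+-identityʳ N)) (trans chebSum-N (sym chebSum-0))
    chebSum-period (suc i) = trans (chebSum-equation (dbl n ℕ.+ suc i))
      (trans (cong₂ (λ x y → -1# * (ι (+ (N ℕ.+ suc i)) * (-1# * x)) + y) (monomial-> N i)
          (trans (cong (λ k → conv (λ i → t (suc i)) (monomial N) (suc k)) (ℕP.+-suc (dbl n) i))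
            (conv-monomial-> (λ i → t (suc i)) N i)))
        (trans (cong (_+ t (suc i)) (trans (mulˡ _ (trans (mulˡ _ (zeroʳ _)) (zeroʳ _))) (zeroʳ _)))
          (+-identityˡ _)))

    chebSum-mod : ∀ a → t a ≡ t (a % N)
    chebSum-mod a = trans (cong t (trans (m≡m%n+[m/n]*n a N) (ℕP.+-comm (a % N) _))) (periods (a ℕD./ N))
      where
      periods : ∀ q → t (q ℕ.* N ℕ.+ a % N) ≡ t (a % N)
      periods zero = refl
      periods (suc q) = trans (cong t (ℕP.+-assoc N (q ℕ.* N) (a % N))) (trans (chebSum-period _) (periods q))

    tℤ : ℤ → Carrier
    tℤ a = t ∣ a ∣

    Multiple : ℤ → Set
    Multiple a = (+ N) ∣ a

    -- With `tℤ-no` this is the orthogonality of the characters of ℤ/N.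
    tℤ-yes : ∀ a → Multiple a → tℤ a ≡ ι (+ N)
    tℤ-yes a d = trans (chebSum-mod ∣ a ∣) (trans (cong t (ℕ∣.n∣m⇒m%n≡0 ∣ a ∣ N (∣⇒∣ᵤ d))) chebSum-0)

    tℤ-no : ∀ a → ¬ Multiple a → tℤ a ≡ 0#
    tℤ-no a ¬d = trans (chebSum-mod ∣ a ∣) (small (∣ a ∣ % N) refl (m%n<n ∣ a ∣ N))
      where
      small : ∀ r → ∣ a ∣ % N ≡ r → r ℕ.< N → t r ≡ 0#
      small zero e l = ⊥-elim (¬d (∣ᵤ⇒∣ (ℕ∣.m%n≡0⇒n∣m ∣ a ∣ N e)))
      small (suc r) e l = chebSum-small r l

    -- N = 1 + 2n is odd, and a = N a - n (a + a).
    halve : ∀ a → Multiple (a ℤ.+ a) → Multiple a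
    halve a d = subst Multiple (sym (trans (lem a (+ n))
      (cong (λ k → (k ℤ.* a) ℤ.- (+ n) ℤ.* (a ℤ.+ a)) oddness)))
      (∣m∣n⇒∣m-n (ℤ∣.∣m⇒∣m*n a (ℤ∣.∣-refl)) (∣n⇒∣m*n (+ n) d))
      where
      lem : ∀ a k → a ≡ ((+ 1 ℤ.+ (k ℤ.+ k)) ℤ.* a) ℤ.- k ℤ.* (a ℤ.+ a)
      lem = solve-∀
      dbl-+ : ∀ n → dbl n ≡ n ℕ.+ n
      dbl-+ zero = refl
      dbl-+ (suc n) = cong suc (trans (cong suc (dbl-+ n)) (sym (ℕP.+-suc n n)))
      oddness : + 1 ℤ.+ (+ n ℤ.+ + n) ≡ + N
      oddness = cong (λ k → + suc k) (sym (dbl-+ n))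

    multiple-rotate : ∀ a b → Multiple (a ℤ.+ b) → Multiple (a ℤ.- b) → Multiple a × Multiple b
    multiple-rotate a b p q = halve a (subst Multiple (lem₁ a b) (∣m∣n⇒∣m+n p q)) , halve b
      (subst Multiple (lem₂ a b) (∣m∣n⇒∣m-n p q))
      where
      lem₁ : ∀ a b → (a ℤ.+ b) ℤ.+ (a ℤ.- b) ≡ a ℤ.+ a
      lem₁ = solve-∀
      lem₂ : ∀ a b → (a ℤ.+ b) ℤ.- (a ℤ.- b) ≡ b ℤ.+ b
      lem₂ = solve-∀

    tℤ-zeroʳ : ∀ a b → ¬ (Multiple a × Multiple b) → tℤ a * tℤ b ≡ 0#
    tℤ-zeroʳ a b ¬p with (+ N) ℤ∣.∣? a | (+ N) ℤ∣.∣? b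
    ... | yes p | yes q = ⊥-elim (¬p (p , q))
    ... | no ¬q | _ = trans (cong (_* tℤ b) (tℤ-no a ¬q)) (zeroˡ _)
    ... | yes _ | no ¬q = trans (mulˡ (tℤ a) (tℤ-no b ¬q)) (zeroʳ _)

    -- Both sides are N² if N divides a and b, and 0 otherwise: as N is odd, it divides a and b
    -- exactly when it divides a + b and a - b.
    tℤ-rotate : ∀ a b → tℤ a * tℤ b ≡ tℤ (a ℤ.+ b) * tℤ (a ℤ.- b)
    tℤ-rotate a b with (+ N) ℤ∣.∣? a | (+ N) ℤ∣.∣? b
    ... | yes p | yes q = trans (cong₂ _*_ (tℤ-yes a p) (tℤ-yes b q))
      (sym (cong₂ _*_ (tℤ-yes _ (∣m∣n⇒∣m+n p q)) (tℤ-yes _ (∣m∣n⇒∣m-n p q))))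
    ... | no ¬p | _ = trans (tℤ-zeroʳ a b (λ r → ¬p (proj₁ r)))
      (sym (tℤ-zeroʳ _ _ (λ r → ¬p (proj₁ (multiple-rotate a b (proj₁ r) (proj₂ r))))))
    ... | yes _ | no ¬p = trans (tℤ-zeroʳ a b (λ r → ¬p (proj₂ r)))
      (sym (tℤ-zeroʳ _ _ (λ r → ¬p (proj₂ (multiple-rotate a b (proj₁ r) (proj₂ r))))))

    tℤ-double : ∀ a → tℤ a ≡ tℤ (a ℤ.+ a)
    tℤ-double a with (+ N) ℤ∣.∣? a
    ... | yes p = trans (tℤ-yes a p) (sym (tℤ-yes _ (∣m∣n⇒∣m+n p p)))
    ... | no ¬p = trans (tℤ-no a ¬p) (sym (tℤ-no _ (λ q → ¬p (halve a q))))

-- Equality of the power sums of γⱼ + γₖ and γⱼγₖ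

module Isospectral (S : Alg) (γs : List (Alg.Carrier S)) (roots : Roots.IsRoots S γs) where
  open AlgTheory S
  open Transfer S using (sumL; sumL-cong)
  open Roots S
  open Series S
  open Spectrum S

  T : ℤ → Carrier
  T = tℤ γs roots

  -- The sum over all N-th roots of unity z of f (z + 1/z).
  sumX : (Carrier → Carrier) → Carrier
  sumX f = f two + (sumL γs f + sumL γs f)

  sumX-cong : ∀ {f f'} → (∀ x → f x ≡ f' x) → sumX f ≡ sumX f'
  sumX-cong e = cong₂ (λ s t → s + (t + t)) (e two) (sumL-cong γs e)

  sumX-+ : ∀ f f' → sumX (λ x → f x + f' x) ≡ sumX f + sumX f'
  sumX-+ f f' = trans (cong (λ t → f two + f' two + (t + t)) (sumL-+ γs f f'))
    (solve 4 (λ a b c d → (a :+ b) :+ ((c :+ d) :+ (c :+ d)) := (a :+ (c :+ c)) :+ (b :+ (d :+ d))) refl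
      (f two) (f' two) (sumL γs f) (sumL γs f'))

  sumX-* : ∀ c f → sumX (λ x → c * f x) ≡ c * sumX f
  sumX-* c f = trans (cong (λ t → c * f two + (t + t)) (sumL-* c γs f))
    (solve 3 (λ c a b → c :* a :+ (c :* b :+ c :* b) := c :* (a :+ (b :+ b))) refl c (f two) (sumL γs f))

  sumXX : (Carrier → Carrier → Carrier) → Carrier
  sumXX f = sumX (λ x → sumX (f x))

  sumXX-cong : ∀ {f f'} → (∀ x y → f x y ≡ f' x y) → sumXX f ≡ sumXX f'
  sumXX-cong e = sumX-cong (λ x → sumX-cong (e x))

  sumXX-+ : ∀ f f' → sumXX (λ x y → f x y + f' x y) ≡ sumXX f + sumXX f'
  sumXX-+ f f' = trans (sumX-cong (λ x → sumX-+ (f x) (f' x))) (sumX-+ _ _)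

  sumXX-4 : ∀ f₁ f₂ f₃ f₄ → sumXX (λ x y → (f₁ x y + f₂ x y) + (f₃ x y + f₄ x y)) ≡ (sumXX f₁ + sumXX f₂) +
    (sumXX f₃ + sumXX f₄)
  sumXX-4 f₁ f₂ f₃ f₄ = trans (sumXX-+ _ _) (cong₂ _+_ (sumXX-+ f₁ f₂) (sumXX-+ f₃ f₄))

  sumXX-* : ∀ c f → sumXX (λ x y → f x y * c) ≡ c * sumXX f
  sumXX-* c f = trans (sumX-cong (λ x → trans (sumX-cong (λ y → *-comm _ c)) (sumX-* c (f x)))) (sumX-* c _)

  sumXX-product : ∀ f f' → sumXX (λ x y → f x * f' y) ≡ sumX f * sumX f'
  sumXX-product f f' = trans (sumX-cong (λ x → trans (sumX-* (f x) f') (*-comm _ _)))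
    (trans (sumX-* _ f) (*-comm _ _))

  L : ℤ → Carrier → Carrier
  L a = chebL ∣ a ∣

  L-step : ∀ a x → x * L a x ≡ L (ℤ.suc a) x + L (ℤ.pred a) x
  L-step (+ zero) x = solve 1 (λ x → x :* con (+ 2) := x :+ x) refl x
  L-step (+ suc k) x = solve 3 (λ x a b → x :* a := (x :* a :+ :- b) :+ b) refl x (chebL (suc k) x) (chebL k x)
  L-step -[1+ zero ] x = solve 1 (λ x → x :* x := con (+ 2) :+ (x :* x :+ :- con (+ 2))) refl x
  L-step -[1+ suc k ] x = solve 3 (λ x a b → x :* a := b :+ (x :* a :+ :- b)) refl x (chebL (suc (suc k)) x)
    (chebL (suc k) x)

  L-two : ∀ a → L a two ≡ two
  L-two a = at-two ∣ a ∣
    where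
    at-two : ∀ k → chebL k two ≡ two
    at-two zero = refl
    at-two (suc zero) = refl
    at-two (suc (suc k)) = trans (cong₂ (λ s t → two * s + - t) (at-two (suc k)) (at-two k))
      (solve 0 (con (+ 2) :* con (+ 2) :+ :- con (+ 2) := con (+ 2)) refl)

  sumX-L : ∀ a → sumX (L a) ≡ two * T a
  sumX-L a = trans (cong (_+ (s + s)) (L-two a))
    (trans (solve 1 (λ s → con (+ 2) :+ (s :+ s) := con (+ 2) :* (con (+ 1) :+ s)) refl s)
      (cong (λ o → two * (o + s)) ι-1))
    where
    s : Carrier
    s = sumL γs (L a)

  -- Closed walks on the torus (ℤ/N)² with steps (±1,0), (0,±1), respectively (±1,±1), weighted by their
  -- starting points; the rotation (a, b) ↦ (a + b, a − b) exchanges the two kinds of steps, and it is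
  -- invertible because N is odd.
  axial diagonal : ℕ → ℤ → ℤ → Carrier
  axial i a b = sumXX (λ x y → (x + y) ^ i * (L a x * L b y))
  diagonal i a b = sumXX (λ x y → (x * y) ^ i * (L a x * L b y))

  axial-step : ∀ i a b → axial (suc i) a b ≡ (axial i (ℤ.suc a) b + axial i (ℤ.pred a) b) +
    (axial i a (ℤ.suc b) + axial i a (ℤ.pred b))
  axial-step i a b = trans (sumXX-cong λ x y → trans
    (solve 5 (λ x y p l m → ((x :+ y) :* p) :* (l :* m) := p :* ((x :* l) :* m) :+ p :* (l :* (y :* m))) refl
      x y ((x + y) ^ i) (L a x) (L b y))
    (trans (cong₂ (λ s t → (x + y) ^ i * (s * L b y) + (x + y) ^ i * (L a x * t)) (L-step a x) (L-step b y))
      (solve 7 (λ p l l₁ l₂ m m₁ m₂ → p :* ((l₁ :+ l₂) :* m) :+ p :* (l :* (m₁ :+ m₂)) :=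
        (p :* (l₁ :* m) :+ p :* (l₂ :* m)) :+ (p :* (l :* m₁) :+ p :* (l :* m₂))) refl
        ((x + y) ^ i) (L a x) (L (ℤ.suc a) x) (L (ℤ.pred a) x) (L b y) (L (ℤ.suc b) y) (L (ℤ.pred b) y))))
    (sumXX-4 _ _ _ _)

  diagonal-step : ∀ i a b → diagonal (suc i) a b ≡
    (diagonal i (ℤ.suc a) (ℤ.suc b) + diagonal i (ℤ.suc a) (ℤ.pred b)) +
      (diagonal i (ℤ.pred a) (ℤ.suc b) + diagonal i (ℤ.pred a) (ℤ.pred b))
  diagonal-step i a b = trans (sumXX-cong λ x y → trans
    (solve 5 (λ x y p l m → ((x :* y) :* p) :* (l :* m) := p :* ((x :* l) :* (y :* m))) refl x y ((x * y) ^ i)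
      (L a x) (L b y))
    (trans (cong₂ (λ s t → (x * y) ^ i * (s * t)) (L-step a x) (L-step b y))
      (solve 5 (λ p l₁ l₂ m₁ m₂ → p :* ((l₁ :+ l₂) :* (m₁ :+ m₂)) := (p :* (l₁ :* m₁) :+ p :* (l₁ :* m₂)) :+
        (p :* (l₂ :* m₁) :+ p :* (l₂ :* m₂))) refl
        ((x * y) ^ i) (L (ℤ.suc a) x) (L (ℤ.pred a) x) (L (ℤ.suc b) y) (L (ℤ.pred b) y))))
    (sumXX-4 _ _ _ _)

  axial-zero : ∀ a b → axial 0 a b ≡ (two * two) * (T a * T b)
  axial-zero a b = trans (sumXX-cong (λ x y → *-identityˡ _)) (trans (sumXX-product (L a) (L b))
    (trans (cong₂ _*_ (sumX-L a) (sumX-L b)) (solve 3 (λ c x y → (c :* x) :* (c :* y) := (c :* c) :* (x :* y))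
      refl two (T a) (T b))))

  -- The rotation carries the four axial neighbours of (a, b) to the four diagonal neighbours of (a
  -- + b, a - b); walks without steps are compared by `tℤ-rotate`.
  axial-diagonal : ∀ i a b → axial i a b ≡ diagonal i (a ℤ.+ b) (a ℤ.- b)
  axial-diagonal zero a b = trans (axial-zero a b) (trans (mulˡ _ (tℤ-rotate γs roots a b))
    (sym (axial-zero (a ℤ.+ b) (a ℤ.- b))))
  axial-diagonal (suc i) a b = trans (axial-step i a b)
    (trans (cong₂ _+_
      (cong₂ _+_ (go (ℤ.suc a) b (r₁ a b) (r₂ a b)) (go (ℤ.pred a) b (r₃ a b) (r₄ a b)))
      (cong₂ _+_ (go a (ℤ.suc b) (r₅ a b) (r₆ a b)) (go a (ℤ.pred b) (r₇ a b) (r₈ a b))))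
    (trans (solve 4 (λ p q r s → (p :+ q) :+ (r :+ s) := (p :+ r) :+ (s :+ q)) refl
      (diagonal i (ℤ.suc s) (ℤ.suc d)) (diagonal i (ℤ.pred s) (ℤ.pred d)) (diagonal i (ℤ.suc s) (ℤ.pred d))
        (diagonal i (ℤ.pred s) (ℤ.suc d)))
      (sym (diagonal-step i s d))))
    where
    s d : ℤ
    s = a ℤ.+ b
    d = a ℤ.- b
    go : ∀ a b {p q} → a ℤ.+ b ≡ p → a ℤ.- b ≡ q → axial i a b ≡ diagonal i p q
    go a b refl refl = axial-diagonal i a b
    r₁ : ∀ a b → (+ 1 ℤ.+ a) ℤ.+ b ≡ + 1 ℤ.+ (a ℤ.+ b)
    r₁ = solve-∀
    r₂ : ∀ a b → (+ 1 ℤ.+ a) ℤ.- b ≡ + 1 ℤ.+ (a ℤ.- b)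
    r₂ = solve-∀
    r₃ : ∀ a b → (-[1+ 0 ] ℤ.+ a) ℤ.+ b ≡ -[1+ 0 ] ℤ.+ (a ℤ.+ b)
    r₃ = solve-∀
    r₄ : ∀ a b → (-[1+ 0 ] ℤ.+ a) ℤ.- b ≡ -[1+ 0 ] ℤ.+ (a ℤ.- b)
    r₄ = solve-∀
    r₅ : ∀ a b → a ℤ.+ (+ 1 ℤ.+ b) ≡ + 1 ℤ.+ (a ℤ.+ b)
    r₅ = solve-∀
    r₆ : ∀ a b → a ℤ.- (+ 1 ℤ.+ b) ≡ -[1+ 0 ] ℤ.+ (a ℤ.- b)
    r₆ = solve-∀
    r₇ : ∀ a b → a ℤ.+ (-[1+ 0 ] ℤ.+ b) ≡ -[1+ 0 ] ℤ.+ (a ℤ.+ b)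
    r₇ = solve-∀
    r₈ : ∀ a b → a ℤ.- (-[1+ 0 ] ℤ.+ b) ≡ + 1 ℤ.+ (a ℤ.- b)
    r₈ = solve-∀

  -- The one-dimensional analogue: z ↦ z² permutes the N-th roots of unity, and x² = 2 + z² + z⁻²
  -- for x = z + 1/z. It serves to remove the terms in which one of two roots of unity is 1.
  linear squared : ℕ → ℤ → Carrier
  linear i a = sumX (λ x → (two + x) ^ i * L a x)
  squared i a = sumX (λ x → (x * x) ^ i * L a x)

  linear-step : ∀ i a → linear (suc i) a ≡ two * linear i a + (linear i (ℤ.suc a) + linear i (ℤ.pred a))
  linear-step i a = trans (sumX-cong λ x → trans
    (solve 3 (λ x p l → ((con (+ 2) :+ x) :* p) :* l := con (+ 2) :* (p :* l) :+ p :* (x :* l)) refl x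
      ((two + x) ^ i) (L a x))
    (addˡ _ (trans (mulˡ _ (L-step a x)) (distribˡ _ _ _))))
    (trans (sumX-+ _ _) (cong₂ _+_ (sumX-* two _) (sumX-+ _ _)))

  squared-step : ∀ i a → squared (suc i) a ≡ two * squared i a +
    (squared i (ℤ.suc (ℤ.suc a)) + squared i (ℤ.pred (ℤ.pred a)))
  squared-step i a = trans (sumX-cong λ x → trans
    (solve 3 (λ x p l → ((x :* x) :* p) :* l := p :* (x :* (x :* l))) refl x ((x * x) ^ i) (L a x))
    (trans (mulˡ _ (trans (mulˡ x (L-step a x)) (trans (distribˡ _ _ _)
      (cong₂ _+_ (trans (L-step (ℤ.suc a) x) (addˡ _ (cong (λ c → L c x) (back a))))
        (trans (L-step (ℤ.pred a) x) (cong (_+ L (ℤ.pred (ℤ.pred a)) x) (cong (λ c → L c x) (forth a))))))))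
      (solve 4 (λ p l m n → p :* ((m :+ l) :+ (l :+ n)) := con (+ 2) :* (p :* l) :+ (p :* m :+ p :* n)) refl
        ((x * x) ^ i) (L a x) (L (ℤ.suc (ℤ.suc a)) x) (L (ℤ.pred (ℤ.pred a)) x))))
    (trans (sumX-+ _ _) (cong₂ _+_ (sumX-* two _) (sumX-+ _ _)))
    where
    back : ∀ a → -[1+ 0 ] ℤ.+ (+ 1 ℤ.+ a) ≡ a
    back = solve-∀
    forth : ∀ a → + 1 ℤ.+ (-[1+ 0 ] ℤ.+ a) ≡ a
    forth = solve-∀

  linear-squared : ∀ i a → linear i a ≡ squared i (a ℤ.+ a)
  linear-squared zero a = trans (sumX-cong (λ x → *-identityˡ _))
    (trans (sumX-L a) (trans (mulˡ two (tℤ-double γs roots a))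
    (sym (trans (sumX-cong (λ x → *-identityˡ _)) (sumX-L (a ℤ.+ a))))))
  linear-squared (suc i) a = trans (linear-step i a) (trans
    (cong₂ (λ s t → two * s + t) (linear-squared i a) (cong₂ _+_
      (trans (linear-squared i (ℤ.suc a)) (cong (squared i) (twice-suc a)))
        (trans (linear-squared i (ℤ.pred a)) (cong (squared i) (twice-pred a)))))
    (sym (squared-step i (a ℤ.+ a))))
    where
    twice-suc : ∀ a → (+ 1 ℤ.+ a) ℤ.+ (+ 1 ℤ.+ a) ≡ + 1 ℤ.+ (+ 1 ℤ.+ (a ℤ.+ a))
    twice-suc = solve-∀
    twice-pred : ∀ a → (-[1+ 0 ] ℤ.+ a) ℤ.+ (-[1+ 0 ] ℤ.+ a) ≡ -[1+ 0 ] ℤ.+ (-[1+ 0 ] ℤ.+ (a ℤ.+ a))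
    twice-pred = solve-∀

  -- The root of unity 1 gives the point 2 once, while each γ comes from z and from 1/z. So a mixed
  -- term f(2, γ) counts four times, as does every ordered pair of γs.
  sumXX-symmetric : ∀ f → (∀ x y → f x y ≡ f y x) → sumXX f ≡
    (f two two + four * sumL γs (f two)) + four * (sumL γs (λ x → f x x) + two * pairSum f γs)
  sumXX-symmetric f f-sym = trans
    (cong (λ t → (f two two + (a + a)) + (t + t)) (trans (sumL-+ γs _ _)
      (cong₂ _+_ (sumL-cong γs (λ x → f-sym x two))
      (trans (sumL-+ γs _ _) (cong₂ _+_ (double-sum f f-sym γs) (double-sum f f-sym γs))))))
    (solve 4 (λ c a d p → (c :+ (a :+ a)) :+ ((a :+ ((d :+ (p :+ p)) :+ (d :+ (p :+ p)))) :+
      (a :+ ((d :+ (p :+ p)) :+ (d :+ (p :+ p)))))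
      := (c :+ con (+ 4) :* a) :+ con (+ 4) :* (d :+ con (+ 2) :* p)) refl (f two two) a
        (sumL γs (λ x → f x x)) (pairSum f γs))
    where
    a : Carrier
    a = sumL γs (f two)

  -- In the equality of the two double sums, the terms (2γ)ⁱ occur on both sides, once as diagonal
  -- and once as mixed terms. The remaining mixed terms (2 + γ)ⁱ and diagonal terms γ²ⁱ have equal
  -- sums by `linear-squared`.
  pair-powers : ∀ i → pairSum (λ x y → (x + y) ^ i) γs ≡ pairSum (λ x y → (x * y) ^ i) γs
  -- `cancel 31` cancels 32 = 4 · 4 · 2: the value of `L` at 0 taken twice, the choices of z or 1/z,
  -- and the two orders of a pair.
  pair-powers i = cancel 31 Pp Pm (combine c A A' C Pp Pm e₁ e₂)
    where
    c A A' C Pp Pm : Carrier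
    c = (two * two) ^ i
    A = sumL γs (λ x → (two + x) ^ i)
    A' = sumL γs (λ x → (two * x) ^ i)
    C = sumL γs (λ x → (x * x) ^ i)
    Pp = pairSum (λ x y → (x + y) ^ i) γs
    Pm = pairSum (λ x y → (x * y) ^ i) γs
    e₁ : (two * two) * ((c + four * A) + four * (A' + two * Pp)) ≡ (two * two) *
      ((c + four * A') + four * (C + two * Pm))
    e₁ = trans (mulˡ (two * two) (sym (trans (sumXX-symmetric (λ x y → (x + y) ^ i)
      (λ x y → cong (_^ i) (+-comm x y)))
        (cong₂ (λ s t → (s + four * A) + four * (t + two * Pp))
          (cong (_^ i) (solve 0 (con (+ 2) :+ con (+ 2) := con (+ 2) :* con (+ 2)) refl))
          (sumL-cong γs (λ x → cong (_^ i) (solve 1 (λ x → x :+ x := con (+ 2) :* x) refl x)))))))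
      (trans (sym (sumXX-* (two * two) _)) (trans (axial-diagonal i (+ 0) (+ 0)) (trans (sumXX-* (two * two) _)
        (mulˡ (two * two) (sumXX-symmetric (λ x y → (x * y) ^ i) (λ x y → cong (_^ i) (*-comm x y)))))))
    e₂ : two * (c + (A + A)) ≡ two * (c + (C + C))
    e₂ = trans (mulˡ two (cong (λ s → s + (A + A)) (cong (_^ i)
      (solve 0 (con (+ 2) :* con (+ 2) := con (+ 2) :+ con (+ 2)) refl))))
      (trans (sym (sumX-* two (λ x → (two + x) ^ i))) (trans (sumX-cong (λ x → *-comm two _))
        (trans (linear-squared i (+ 0))
        (trans (sumX-cong (λ x → *-comm _ two)) (sumX-* two (λ x → (x * x) ^ i))))))
    combine : ∀ c A A' C p q → (two * two) * ((c + four * A) + four * (A' + two * p)) ≡ (two * two) *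
      ((c + four * A') + four * (C + two * q)) →
      two * (c + (A + A)) ≡ two * (c + (C + C)) → ι (+ 32) * p ≡ ι (+ 32) * q
    combine c A A' C p q e e' = trans
      (solve 4 (λ c A A' p → con (+ 32) :* p := con (+ 2) :* con (+ 2) :*
        ((c :+ con (+ 4) :* A) :+ con (+ 4) :* (A' :+ con (+ 2) :* p))
        :- (con (+ 4) :* A' :* con (+ 4) :- con (+ 4) :* c) :- con (+ 4) :* (con (+ 2) :* (c :+ (A :+ A))))
          refl c A A' p)
      (trans (cong₂ (λ s t → s + - (four * A' * four + - (four * c)) + - (four * t)) e e')
        (solve 4 (λ c A' C q → con (+ 2) :* con (+ 2) :*
          ((c :+ con (+ 4) :* A') :+ con (+ 4) :* (C :+ con (+ 2) :* q))
          :- (con (+ 4) :* A' :* con (+ 4) :- con (+ 4) :* c) :- con (+ 4) :*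
            (con (+ 2) :* (c :+ (C :+ C))) := con (+ 32) :* q) refl c A' C q))

  prodPairs-isospectral : prodPairs (λ x y → four + (x + y)) γs ≡ prodPairs (λ x y → four + x * y) γs
  prodPairs-isospectral = trans (sym (prodL-pairs (λ z → four + z) _+_ γs))
    (trans (prod-determined four (pairs _+_ γs) (pairs _*_ γs) (pairs-length _+_ _*_ γs)
      (λ i → trans (altSum-^ (pairs _+_ γs) i) (trans (mulˡ _
        (trans (sumL-pairs (_^ suc i) _+_ γs) (trans (pair-powers (suc i))
          (sym (sumL-pairs (_^ suc i) _*_ γs)))))
        (sym (altSum-^ (pairs _*_ γs) i)))))
      (prodL-pairs (λ z → four + z) _*_ γs))

-- Signs and the expansion in powers of 4

parity : ℕ → ℤ
parity zero = + 1
parity (suc n) = ℤ.- parity n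

parity² : ∀ n → parity n ℤ.* parity n ≡ + 1
parity² zero = refl
parity² (suc n) = trans (lem (parity n)) (parity² n)
  where
  lem : ∀ a → (ℤ.- a) ℤ.* (ℤ.- a) ≡ a ℤ.* a
  lem = solve-∀

chebV-0² : ∀ n → chebV n 0 ℤ.* chebV n 0 ≡ + 1
chebV-0² zero = refl
chebV-0² (suc zero) = refl
chebV-0² (suc (suc n)) = trans (lem (chebV n 0)) (chebV-0² n)
  where
  lem : ∀ a → (+ 0 ℤ.- a) ℤ.* (+ 0 ℤ.- a) ≡ a ℤ.* a
  lem = solve-∀

-- The product of the roots of V_n.
rootsProduct : ℕ → ℤ
rootsProduct n = parity n ℤ.* chebV n 0

rootsProduct² : ∀ n → rootsProduct n ℤ.* rootsProduct n ≡ + 1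
rootsProduct² n = trans (lem (parity n) (chebV n 0)) (cong₂ ℤ._*_ (parity² n) (chebV-0² n))
  where
  lem : ∀ a b → (a ℤ.* b) ℤ.* (a ℤ.* b) ≡ (a ℤ.* a) ℤ.* (b ℤ.* b)
  lem = solve-∀

-- The product of the γⱼγₖ with j < k.
sign : ℕ → ℤ
sign n = rootsProduct n ℤ.^ suc n

sign² : ∀ n → sign n ℤ.* sign n ≡ + 1
sign² n = power² (suc n)
  where
  r : ℤ
  r = rootsProduct n
  lem : ∀ r p → (r ℤ.* p) ℤ.* (r ℤ.* p) ≡ (r ℤ.* r) ℤ.* (p ℤ.* p)
  lem = solve-∀
  power² : ∀ k → (r ℤ.^ k) ℤ.* (r ℤ.^ k) ≡ + 1
  power² zero = refl
  power² (suc k) = trans (lem r (r ℤ.^ k)) (cong₂ ℤ._*_ (rootsProduct² n) (power² k))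

module Expansions (S : Alg) (γs : List (Alg.Carrier S)) (roots : Roots.IsRoots S γs) where
  open AlgTheory S
  open Exterior S using (V; m1)
  open Transfer S using (sumL; sumL-cong; sumL-map)
  open Square S using (·v-+v; ·v-comm)
  open Roots S
  open Determinants S hiding (n; βs)
  open Positivity S using (IsNat; nat-krylov; nat-top)
  open Series S
  open Isospectral S γs roots using (prodPairs-isospectral)

  n : ℕ
  n = length γs

  βs : List Carrier
  βs = betas γs

  discriminant : Carrier
  discriminant = prodPairs (λ x y → four + (x + y)) γs

  betas-pairs : ∀ γs → prodPairs _+_ (betas γs) ≡ prodPairs (λ x y → four + (x + y)) γs
  betas-pairs [] = refl
  betas-pairs (γ ∷ γs) = cong₂ _*_ (row γs) (betas-pairs γs)
    where
    row : ∀ ys → prodL (map (λ y → (two + γ) + y) (betas ys)) ≡ prodL (map (λ y → four + (γ + y)) ys)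
    row [] = refl
    row (y ∷ ys) = cong₂ _*_ (solve 2 (λ x y → (con (+ 2) :+ x) :+ (con (+ 2) :+ y) := con (+ 4) :+ (x :+ y))
      refl γ y) (row ys)

  krylov-value-pairs : ∀ pre βs → krylov-value pre βs ≡ prodL (map (values pre) βs) * prodPairs _+_ βs
  krylov-value-pairs pre [] = sym (*-identityˡ 1#)
  krylov-value-pairs pre (β ∷ βs) = trans (mulˡ (values pre β) (trans (krylov-value-pairs (β ∷ pre) βs)
    (cong (_* prodPairs _+_ βs) (prodL-map-* (λ y → y + β) (values pre) βs))))
    (trans (cong (λ t → values pre β * ((t * prodL (map (values pre) βs)) * prodPairs _+_ βs))
      (prodL-cong (λ y → +-comm y β) βs))
      (solve 4 (λ v r p q → v :* ((r :* p) :* q) := (v :* p) :* (r :* q)) refl (values pre β) _ _ _))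

  discriminant-nat : IsNat discriminant
  discriminant-nat = subst IsNat
    (trans (krylov-top γs roots) (trans (krylov-value-pairs [] βs)
      (trans (cong₂ _*_ (ones βs) (betas-pairs γs)) (*-identityˡ _))))
    (nat-top _ (nat-krylov n))
    where
    ones : ∀ (xs : List Carrier) → prodL (map (values []) xs) ≡ 1#
    ones [] = refl
    ones (x ∷ xs) = trans (*-identityˡ _) (ones xs)

  private
    scalarMod : LinMod
    scalarMod = vecMod {1} (two ·v_) (m1 ·v_) (·v-+v two) (·v-+v m1) (·v-comm two) (·v-comm m1) (·v-comm m1 two)
      where open Exterior S using (_·v_)

  -- At a = 2 and b = -1 the homogenized factorization reads ∏ (2 + γⱼ) = (-1)ⁿ V_n(-2), and V_n(-2)
  -- = (-1)ⁿ. Hence the diagonal factors 2βⱼ multiply to 2ⁿ exactly.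
  betas-product : prodL βs ≡ 1#
  betas-product = trans (sym (apply γs)) (cong head (trans
    (Evaluation.applyRoots-cheb scalarMod γs roots (1# ∷ [])) (cheb-1 n)))
    where
    head : V 1 → Carrier
    head (x ∷ []) = x
    cheb-1 : ∀ k → Evaluation.cheb scalarMod k (1# ∷ []) ≡ 1# ∷ []
    cheb-1 zero = refl
    cheb-1 (suc zero) = cong (_∷ []) (solve 1 (λ x → con (+ 2) :* x :+ con -[1+ 0 ] :* x := x) refl 1#)
    cheb-1 (suc (suc k)) = trans (cong₂ (λ u v → (two ·v u) +v m1 ·v m1 ·v m1 ·v v) (cheb-1 (suc k)) (cheb-1 k))
      (cong (_∷ []) (solve 1 (λ x → con (+ 2) :* x :+ con -[1+ 0 ] :*
        (con -[1+ 0 ] :* (con -[1+ 0 ] :* x)) := x) refl 1#))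
      where open Exterior S using (_·v_; _+v_)
    apply : ∀ γs → head (Evaluation.applyRoots scalarMod γs (1# ∷ [])) ≡ prodL (betas γs)
    apply [] = refl
    apply (γ ∷ γs) with Evaluation.applyRoots scalarMod γs (1# ∷ []) | apply γs
    ... | x ∷ [] | e = trans (solve 2 (λ γ x → con (+ 2) :* x :+ (:- γ) :* (con -[1+ 0 ] :* x) :=
      (con (+ 2) :+ γ) :* x) refl γ x) (mulˡ (two + γ) e)

  tilings-square : ι (+ tilings (2 ℕ.* n)) ≡ two ^ n * (discriminant * discriminant)
  tilings-square = trans (tilings-product γs roots) (trans (prod-square _+_ +-comm βs)
    (cong₂ _*_ (trans (diagonal γs) (trans (mulˡ (two ^ n) betas-product) (*-identityʳ _)))
      (cong₂ _*_ (betas-pairs γs) (betas-pairs γs))))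
    where
    diagonal : ∀ γs → prodL (map (λ x → x + x) (betas γs)) ≡ two ^ length γs * prodL (betas γs)
    diagonal [] = sym (*-identityʳ 1#)
    diagonal (γ ∷ γs) = trans (mulˡ _ (diagonal γs))
      (solve 3 (λ b p q → (b :+ b) :* (p :* q) := (con (+ 2) :* p) :* (b :* q)) refl (two + γ)
        (two ^ length γs) (prodL (betas γs)))

  two-^ : ∀ k → two ^ k ≡ ι (+ (2 ℕ.^ k))
  two-^ zero = sym ι-1
  two-^ (suc k) = trans (mulˡ two (two-^ k)) (trans (sym (ι-* (+ 2) (+ (2 ℕ.^ k))))
    (cong ι (sym (ℤP.pos-* 2 (2 ℕ.^ k)))))

  ι-ℤ^ : ∀ a k → ι a ^ k ≡ ι (a ℤ.^ k)
  ι-ℤ^ a zero = sym ι-1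
  ι-ℤ^ a (suc k) = trans (mulˡ (ι a) (ι-ℤ^ a k)) (sym (ι-* a _))

  square-injective : ∀ a b → a ℕ.* a ≡ b ℕ.* b → a ≡ b
  square-injective a b e = ℕP.≤-antisym (leq a b (ℕP.≤-reflexive e)) (leq b a (ℕP.≤-reflexive (sym e)))
    where
    leq : ∀ a b → a ℕ.* a ℕ.≤ b ℕ.* b → a ℕ.≤ b
    leq a b p = ℕP.≮⇒≥ (λ b<a → ℕP.<⇒≱ (ℕP.*-mono-< b<a b<a) p)

  -- The squares agree, and both roots are natural numbers; this is where the nonnegativity of D
  -- fixes the sign.
  tilings-root : ∀ f → tilings (2 ℕ.* n) ≡ 2 ℕ.^ n ℕ.* (f ℕ.* f) → ι (+ f) ≡ discriminant
  tilings-root f e with discriminant-nat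
  ... | d , eq = trans (cong (λ k → ι (+ k)) (square-injective f d
    (ℕP.*-cancelˡ-≡ (f ℕ.* f) (d ℕ.* d) (2 ℕ.^ n) {{ℕP.m^n≢0 2 n}}
    (trans (sym e) (ℤP.+-injective (ι-injective (trans tilings-square (trans
      (cong₂ _*_ (two-^ n) (trans (cong₂ _*_ eq eq) (trans (sym (ι-* (+ d) (+ d)))
        (cong ι (sym (ℤP.pos-* d d))))))
      (trans (sym (ι-* (+ (2 ℕ.^ n)) (+ (d ℕ.* d)))) (cong ι (sym (ℤP.pos-* (2 ℕ.^ n) (d ℕ.* d)))))))))))))
    (sym eq)

  prodRoots-0 : ∀ γs → prodRoots γs 0 ≡ ι (parity (length γs)) * prodL γs
  prodRoots-0 [] = sym (trans (*-identityʳ _) ι-1)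
  prodRoots-0 (γ ∷ γs) = trans (+-identityˡ _) (trans (mulˡ (- γ) (prodRoots-0 γs))
    (trans (solve 3 (λ g p q → (:- g) :* (p :* q) := (:- p) :* (g :* q)) refl γ (ι (parity (length γs)))
      (prodL γs))
      (cong (_* (γ * prodL γs)) (sym (ι-neg _)))))

  roots-product : prodL γs ≡ ι (rootsProduct n)
  roots-product = trans (sym (trans (sym (*-assoc _ _ _))
    (trans (cong (_* prodL γs) (trans (sym (ι-* (parity n) (parity n))) (trans (cong ι (parity² n)) ι-1)))
      (*-identityˡ _))))
    (trans (mulˡ (ι (parity n)) (trans (sym (prodRoots-0 γs)) (roots 0))) (sym (ι-* _ _)))

  roots-product² : prodL γs * prodL γs ≡ 1#
  roots-product² = trans (cong₂ _*_ roots-product roots-product)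
    (trans (sym (ι-* _ _)) (trans (cong ι (rootsProduct² n)) ι-1))

  -- Every element lies in one pair less than the length of the list; the extra factor avoids the
  -- subtraction.
  pairs-product : ∀ xs → prodPairs _*_ xs * prodL xs ≡ prodL xs ^ length xs
  pairs-product [] = *-identityˡ 1#
  pairs-product (x ∷ xs) = trans (cong (λ t → t * prodPairs _*_ xs * (x * prodL xs)) (row xs))
    (trans (solve 4 (λ p l q x → p :* l :* q :* (x :* l) := (x :* p) :* (l :* (q :* l))) refl (x ^ length xs)
      (prodL xs) (prodPairs _*_ xs) x)
      (trans (mulˡ _ (mulˡ (prodL xs) (pairs-product xs))) (sym (^-* x (prodL xs) (suc (length xs))))))
    where
    row : ∀ ys → prodL (map (x *_) ys) ≡ x ^ length ys * prodL ys
    row [] = sym (*-identityˡ 1#)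
    row (y ∷ ys) = trans (mulˡ (x * y) (row ys)) (solve 4
      (λ x y p q → (x :* y) :* (p :* q) := (x :* p) :* (y :* q)) refl x y _ _)

  -- Since (∏ γⱼ)² = 1, the exponent n - 1 may be replaced by n + 1.
  pairs-product-sign : prodPairs _*_ γs ≡ ι (sign n)
  pairs-product-sign = trans (sym (trans (*-assoc _ _ _) (trans (mulˡ _ roots-product²) (*-identityʳ _))))
    (trans (cong (_* prodL γs) (pairs-product γs)) (trans (*-comm _ _)
      (trans (cong (_^ suc n) roots-product) (ι-ℤ^ _ (suc n)))))

  -- If `u` inverts the whole product, the inverse of an element is `u` times the product of the
  -- others; the elements already passed are collected in `u`.
  inverses : List Carrier → Carrier → List Carrier
  inverses [] u = []
  inverses (γ ∷ γs) u = prodL γs * u ∷ inverses γs (γ * u)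

  Inverses : List Carrier → List Carrier → Set
  Inverses [] [] = ⊤
  Inverses (x ∷ xs) (y ∷ ys) = x * y ≡ 1# × Inverses xs ys
  Inverses _ _ = ⊥

  inverses-inverse : ∀ γs u → prodL γs * u ≡ 1# → Inverses γs (inverses γs u)
  inverses-inverse [] u e = tt
  inverses-inverse (γ ∷ γs) u e = trans (sym (*-assoc _ _ _)) e ,
    inverses-inverse γs (γ * u) (trans (solve 3 (λ p g u → p :* (g :* u) := (g :* p) :* u) refl
      (prodL γs) γ u) e)

  Xs : List Carrier
  Xs = inverses γs (prodL γs)

  Xs-inverse : Inverses γs Xs
  Xs-inverse = inverses-inverse γs (prodL γs) roots-product²

  -- Each factor splits as 4 + xz = xz (1 + 4 x⁻¹z⁻¹).
  scale-pairs : ∀ xs ys → Inverses xs ys → prodPairs (λ x y → four + x * y) xs ≡ prodPairs _*_ xs * prodPairs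
    (λ x y → 1# + four * (x * y)) ys
  scale-pairs [] [] _ = sym (*-identityˡ 1#)
  scale-pairs (x ∷ xs) (y ∷ ys) (e , i) = trans (cong₂ _*_ (row xs ys i) (scale-pairs xs ys i))
    (solve 4 (λ a b c d → (a :* b) :* (c :* d) := (a :* c) :* (b :* d)) refl _ _ _ _)
    where
    row : ∀ zs ws → Inverses zs ws → prodL (map (λ z → four + x * z) zs) ≡ prodL (map (x *_) zs) * prodL
      (map (λ w → 1# + four * (y * w)) ws)
    row [] [] _ = sym (*-identityˡ 1#)
    row (z ∷ zs) (w ∷ ws) (e' , i) = trans (cong₂ _*_ entry (row zs ws i))
      (solve 4 (λ a b c d → (a :* b) :* (c :* d) := (a :* c) :* (b :* d)) refl _ _ _ _)
      where
      entry : four + x * z ≡ (x * z) * (1# + four * (y * w))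
      entry = sym (trans (distribˡ _ _ _) (trans (cong₂ _+_ (*-identityʳ _)
        (trans (solve 4 (λ x z y w → (x :* z) :* (con (+ 4) :* (y :* w)) := con (+ 4) :*
          ((x :* y) :* (z :* w))) refl x z y w)
          (trans (mulˡ four (trans (cong₂ _*_ e e') (*-identityˡ 1#))) (*-identityʳ four)))) (+-comm _ _)))

  discriminant-sign : discriminant ≡ ι (sign n) * prodPairs (λ x y → 1# + four * (x * y)) Xs
  discriminant-sign = trans prodPairs-isospectral (trans (scale-pairs γs Xs Xs-inverse)
    (cong (_* prodPairs (λ x y → 1# + four * (x * y)) Xs) pairs-product-sign))

  elementary : ℕ → Carrier
  elementary = prodFactors (map -_ Xs)

  -- Since y - γ = -γ (1 - X y), the polynomial is its constant term times ∏ (1 - Xⱼ y).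
  prodRoots-elementary : ∀ γs Xs → Inverses γs Xs → ∀ i → prodRoots γs i ≡ prodRoots γs 0 * prodFactors
    (map -_ Xs) i
  prodRoots-elementary [] [] _ i = sym (*-identityˡ _)
  prodRoots-elementary (γ ∷ γs) (X ∷ Xs) (e , inv) i = trans
    (cong₂ (λ s t → s + (- γ) * t) (shifted-case i) (prodRoots-elementary γs Xs inv i))
    (trans (cong (_+ (- γ) * (P₀ * E i)) (trans (sym (*-identityˡ _)) (cong (_* (P₀ * shift E i)) (sym e))))
      (trans (solve 5 (λ g x p a b → (g :* x) :* (p :* b) :+ (:- g) :* (p :* a) := ((:- g) :* p) :*
        (a :+ (:- x) :* b)) refl γ X P₀ (E i) (shift E i))
        (cong (_* mulFactor (- X) E i) (sym (+-identityˡ _)))))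
    where
    E : ℕ → Carrier
    E = prodFactors (map -_ Xs)
    P₀ : Carrier
    P₀ = prodRoots γs 0
    shifted-case : ∀ i → shift (prodRoots γs) i ≡ P₀ * shift E i
    shifted-case zero = sym (zeroʳ P₀)
    shifted-case (suc i) = prodRoots-elementary γs Xs inv i

  -- V_n(0) = ±1 is its own inverse, so division by it is multiplication.
  elementary-chebV : ∀ i → elementary i ≡ ι (chebV n 0 ℤ.* chebV n i)
  elementary-chebV i = trans (sym (trans (sym (*-assoc _ _ _))
    (trans (cong (_* elementary i) unit²) (*-identityˡ _))))
    (trans (mulˡ (prodRoots γs 0) (sym (prodRoots-elementary γs Xs Xs-inverse i)))
      (trans (cong₂ _*_ (roots 0) (roots i)) (sym (ι-* _ _))))
    where
    unit² : prodRoots γs 0 * prodRoots γs 0 ≡ 1#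
    unit² = trans (cong₂ _*_ (roots 0) (roots 0)) (trans (sym (ι-* _ _)) (trans (cong ι (chebV-0² n)) ι-1))

  elementary-0 : elementary 0 ≡ 1#
  elementary-0 = prodFactors-0 (map -_ Xs)

  powerSum : ℕ → Carrier
  powerSum k = sumL Xs (_^ k)

  elementary-logDeriv : LogDeriv (λ i → ι -[1+ 0 ] * powerSum (suc i)) elementary
  elementary-logDeriv m = trans (newton-identities (map -_ Xs) m)
    (conv-cong {E = elementary} m (λ i _ → trans (altSum-^ (map -_ Xs) i)
    (trans (mulˡ _ (trans (sumL-map -_ Xs (_^ suc i)) (trans (sumL-cong Xs (λ x → neg-^ x (suc i)))
      (sumL-* _ Xs (_^ suc i)))))
      (trans (sym (*-assoc _ _ _)) (cong (_* powerSum (suc i)) (signs i))))) (λ _ _ → refl))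
    where
    neg-^ : ∀ x k → (- x) ^ k ≡ ι -[1+ 0 ] ^ k * x ^ k
    neg-^ x k = trans (cong (_^ k) (solve 1 (λ x → :- x := con -[1+ 0 ] :* x) refl x)) (^-* (ι -[1+ 0 ]) x k)
    signs : ∀ i → ι -[1+ 0 ] ^ i * ι -[1+ 0 ] ^ suc i ≡ ι -[1+ 0 ]
    signs zero = trans (*-identityˡ _) (*-identityʳ _)
    signs (suc i) = trans (solve 1 (λ p → (con -[1+ 0 ] :* p) :* (con -[1+ 0 ] :* (con -[1+ 0 ] :* p)) := p :*
      (con -[1+ 0 ] :* p)) refl (ι -[1+ 0 ] ^ i)) (signs i)

  pairPowerSum : ℕ → Carrier
  pairPowerSum k = pairSum (λ x y → (x * y) ^ k) Xs

  pairPowerSum-double : ∀ k → two * pairPowerSum k ≡ powerSum k * powerSum k + - powerSum (k ℕ.+ k)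
  pairPowerSum-double k = trans
    (solve 2 (λ p d → con (+ 2) :* p := (d :+ (p :+ p)) :+ :- d) refl (pairPowerSum k)
      (sumL Xs (λ x → (x * x) ^ k)))
    (cong₂ (λ s t → s + - t) (trans (sym (double-sum (λ x y → (x * y) ^ k)
      (λ x y → cong (_^ k) (*-comm x y)) Xs))
      (trans (sumL-cong Xs (λ x → trans (sumL-cong Xs (λ y → ^-* x y k))
        (trans (sumL-* (x ^ k) Xs (_^ k)) (*-comm _ _)))) (sumL-* _ Xs (_^ k))))
      (sumL-cong Xs (λ x → trans (^-* x x k) (sym (^-+ x k k)))))
    where
    ^-+ : ∀ x j k → x ^ (j ℕ.+ k) ≡ x ^ j * x ^ k
    ^-+ x zero k = sym (*-identityˡ _)
    ^-+ x (suc j) k = trans (mulˡ x (^-+ x j k)) (sym (*-assoc _ _ _))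

  pairElementary : ℕ → Carrier
  pairElementary = prodFactors (pairs _*_ Xs)

  pairElementary-0 : pairElementary 0 ≡ 1#
  pairElementary-0 = prodFactors-0 (pairs _*_ Xs)

  pairElementary-logDeriv : LogDeriv (λ i → ι -[1+ 0 ] ^ i * pairPowerSum (suc i)) pairElementary
  pairElementary-logDeriv m = trans (newton-identities (pairs _*_ Xs) m) (conv-cong {E = pairElementary} m
    (λ i _ → trans (altSum-^ (pairs _*_ Xs) i) (mulˡ _ (sumL-pairs (_^ suc i) _*_ Xs))) (λ _ _ → refl))

  discriminant-expansion : ∀ k → ∃ λ r → discriminant ≡ ι (sign n) *
    (partialSum four pairElementary (suc k) + four ^ suc k * r)
  discriminant-expansion k with prod-partialSum four k (pairs _*_ Xs)
  ... | r , e = r , trans discriminant-sign (mulˡ (ι (sign n))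
    (trans (sym (prodL-pairs (λ z → 1# + four * z) _*_ Xs)) e))

  discriminantℤ : ℤ
  discriminantℤ = π discriminant

  discriminantℤ-ι : discriminant ≡ ι discriminantℤ
  discriminantℤ-ι with discriminant-nat
  ... | d , e = trans e (cong ι (trans (sym (π-ι (+ d))) (cong π (sym e))))

  normalized : ℤ
  normalized = sign n ℤ.* discriminantℤ

  -- The remainder of the expansion is only known to lie in the splitting ring. Since `π` is
  -- ℤ-linear, applying it keeps the factor 4ᵏ⁺¹ and makes the cofactor an integer.
  normalized-expansion : ∀ k z → partialSum four pairElementary (suc k) ≡ ι z → ∃ λ r → normalized ℤ.- z ≡
    ((+ 4) ℤ.^ suc k) ℤ.* r
  normalized-expansion k z e = π r , trans (cong (λ t → t ℤ.- z)
    (trans (sym (π-ι normalized)) (trans (cong π expanded) (trans (π-+ _ _)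
      (cong₂ ℤ._+_ (trans (cong π e) (π-ι z)) (trans (cong (λ t → π (t * r)) (ι-ℤ^ (+ 4) (suc k)))
        (π-ι* ((+ 4) ℤ.^ suc k) r)))))))
      (lem z (((+ 4) ℤ.^ suc k) ℤ.* π r))
    where
    σ P Q r : Carrier
    r = proj₁ (discriminant-expansion k)
    σ = ι (sign n)
    P = partialSum four pairElementary (suc k)
    Q = four ^ suc k * r
    expanded : ι normalized ≡ P + Q
    expanded = trans (ι-* (sign n) discriminantℤ) (trans
      (mulˡ σ (trans (sym discriminantℤ-ι) (proj₂ (discriminant-expansion k))))
      (trans (sym (*-assoc σ σ (P + Q))) (trans (cong (_* (P + Q))
        (trans (sym (ι-* (sign n) (sign n))) (trans (cong ι (sign² n)) ι-1))) (*-identityˡ _))))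
    lem : ∀ a b → (a ℤ.+ b) ℤ.- a ≡ b
    lem = solve-∀

  tilings-normalized : ∀ f → tilings (2 ℕ.* n) ≡ 2 ℕ.^ n ℕ.* (f ℕ.* f) → + f ≡ sign n ℤ.* normalized
  tilings-normalized f e = trans (ι-injective (trans (tilings-root f e) discriminantℤ-ι))
    (sym (trans (sym (ℤP.*-assoc (sign n) (sign n) discriminantℤ))
      (trans (cong (λ t → t ℤ.* discriminantℤ) (sign² n)) (ℤP.*-identityˡ _))))

-- Splitting rings

record Hom (R S : Alg) : Set where
  private
    module R = Alg R
    module S = Alg S
  field
    φ : R.Carrier → S.Carrier
    φ-+ : ∀ x y → φ (x R.+ y) ≡ φ x S.+ φ y
    φ-* : ∀ x y → φ (x R.* y) ≡ φ x S.* φ y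
    φ-neg : ∀ x → φ (R.- x) ≡ S.- φ x
    φ-0 : φ R.0# ≡ S.0#
    φ-1 : φ R.1# ≡ S.1#
    φ-ι : ∀ a → φ (R.ι a) ≡ S.ι a

idHom : ∀ R → Hom R R
idHom R = record { φ = λ x → x ; φ-+ = λ _ _ → refl ; φ-* = λ _ _ → refl ; φ-neg = λ _ → refl ; φ-0 =
  refl ; φ-1 = refl ; φ-ι = λ _ → refl }

_∘Hom_ : ∀ {R S T} → Hom S T → Hom R S → Hom R T
g ∘Hom f = record
  { φ = λ x → G.φ (F.φ x)
  ; φ-+ = λ x y → trans (cong G.φ (F.φ-+ x y)) (G.φ-+ _ _)
  ; φ-* = λ x y → trans (cong G.φ (F.φ-* x y)) (G.φ-* _ _)
  ; φ-neg = λ x → trans (cong G.φ (F.φ-neg x)) (G.φ-neg _)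
  ; φ-0 = trans (cong G.φ F.φ-0) G.φ-0
  ; φ-1 = trans (cong G.φ F.φ-1) G.φ-1
  ; φ-ι = λ a → trans (cong G.φ (F.φ-ι a)) (G.φ-ι a) }
  where
  module F = Hom f
  module G = Hom g

module Coordinates (R : Alg) where
  open AlgTheory R
  open Roots R using (δ)

  coord : ∀ {m} → Vec Carrier m → ℕ → Carrier
  coord [] i = 0#
  coord (x ∷ v) zero = x
  coord (x ∷ v) (suc i) = coord v i

  coord-≥ : ∀ {m} (v : Vec Carrier m) i → m ℕ.≤ i → coord v i ≡ 0#
  coord-≥ [] i p = refl
  coord-≥ (x ∷ v) (suc i) (s≤s p) = coord-≥ v i p

  tab : ∀ m → (ℕ → Carrier) → Vec Carrier m
  tab zero f = []
  tab (suc m) f = f 0 ∷ tab m (f ∘ suc)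

  coord-tab : ∀ m f i → i ℕ.< m → coord (tab m f) i ≡ f i
  coord-tab (suc m) f zero p = refl
  coord-tab (suc m) f (suc i) (s≤s p) = coord-tab m (f ∘ suc) i p

  coord-ext : ∀ {m} (v w : Vec Carrier m) → (∀ i → i ℕ.< m → coord v i ≡ coord w i) → v ≡ w
  coord-ext [] [] e = refl
  coord-ext (x ∷ v) (y ∷ w) e = cong₂ _∷_ (e 0 (s≤s z≤n)) (coord-ext v w (λ i p → e (suc i) (s≤s p)))

  -- The coefficients of the monic polynomial with the given lower coefficients.
  monic : ∀ {k} → Vec Carrier k → ℕ → Carrier
  monic [] = δ
  monic (c ∷ cs) zero = c
  monic (c ∷ cs) (suc i) = monic cs i

-- R[x]/(p) for the monic polynomial p with lower coefficients c, on coordinates with respect to 1, x, …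
module Adjoin (R : Alg) (d : ℕ) (c : Vec (Alg.Carrier R) (suc d)) where
  open AlgTheory R
  open Exterior R using (V; 0v; _+v_; _·v_; e₀; m1; hd)
  open Square R using (+v-assoc; +v-comm; +v-identityˡ; +v-identityʳ; +v-interchange; ·v-0v; ·v-+v; +-·v;
    *-·v; ·v-comm; 1-·v; 0-·v; hd-+; hd-·)
  open Roots R using (δ; shift)
  open Spectrum R using (monomial; monomial-<; monomial->)
  open Coordinates R

  n : ℕ
  n = suc d

  coord-+v : ∀ {m} (u v : V m) i → coord (u +v v) i ≡ coord u i + coord v i
  coord-+v [] [] i = sym (+-identityʳ 0#)
  coord-+v (a ∷ u) (b ∷ v) zero = refl
  coord-+v (a ∷ u) (b ∷ v) (suc i) = coord-+v u v i

  coord-·v : ∀ {m} a (v : V m) i → coord (a ·v v) i ≡ a * coord v i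
  coord-·v a [] i = sym (zeroʳ a)
  coord-·v a (b ∷ v) zero = refl
  coord-·v a (b ∷ v) (suc i) = coord-·v a v i

  abstract
    timesX : V n → V n
    timesX v = tab n (λ i → shift (coord v) i + - (coord v d * coord c i))

    coord-timesX : ∀ v i → i ℕ.< n → coord (timesX v) i ≡ shift (coord v) i + - (coord v d * coord c i)
    coord-timesX v = coord-tab n _

  one-v : V n
  one-v = e₀

  timesX-+ : ∀ u v → timesX (u +v v) ≡ timesX u +v timesX v
  timesX-+ u v = coord-ext _ _ λ i p → trans (coord-timesX (u +v v) i p)
    (trans (cong₂ (λ s t → s + - (t * coord c i)) (shift-coord i) (coord-+v u v d))
      (trans (solve 5 (λ a b x y z → (a :+ b) :+ :- ((x :+ y) :* z) := (a :+ :- (x :* z)) :+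
        (b :+ :- (y :* z))) refl (shift (coord u) i) (shift (coord v) i) (coord u d) (coord v d) (coord c i))
        (sym (trans (coord-+v (timesX u) (timesX v) i) (cong₂ _+_ (coord-timesX u i p) (coord-timesX v i p))))))
    where
    shift-coord : ∀ i → shift (coord (u +v v)) i ≡ shift (coord u) i + shift (coord v) i
    shift-coord zero = sym (+-identityʳ 0#)
    shift-coord (suc i) = coord-+v u v i

  timesX-· : ∀ a v → timesX (a ·v v) ≡ a ·v timesX v
  timesX-· a v = coord-ext _ _ λ i p → trans (coord-timesX (a ·v v) i p)
    (trans (cong₂ (λ s t → s + - (t * coord c i)) (shift-coord i) (coord-·v a v d))
      (trans (solve 4 (λ a s x z → a :* s :+ :- ((a :* x) :* z) := a :* (s :+ :- (x :* z))) refl a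
        (shift (coord v) i) (coord v d) (coord c i))
        (sym (trans (coord-·v a (timesX v) i) (mulˡ a (coord-timesX v i p))))))
    where
    shift-coord : ∀ i → shift (coord (a ·v v)) i ≡ a * shift (coord v) i
    shift-coord zero = sym (zeroʳ a)
    shift-coord (suc i) = coord-·v a v i

  timesX-0 : timesX 0v ≡ 0v
  timesX-0 = trans (cong timesX (sym (0-·v (0v {n})))) (trans (timesX-· 0# 0v) (0-·v _))

  -- The polynomial with coefficients `p`, evaluated at the operator `timesX` and applied to `w`.
  mul : ∀ {k} → V k → V n → V n
  mul [] w = 0v
  mul (a ∷ p) w = (a ·v w) +v timesX (mul p w)

  mul-+ʳ : ∀ {k} (p : V k) v w → mul p (v +v w) ≡ mul p v +v mul p w
  mul-+ʳ [] v w = sym (+v-identityˡ 0v)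
  mul-+ʳ (a ∷ p) v w = trans (cong₂ _+v_ (·v-+v a v w) (trans (cong timesX (mul-+ʳ p v w)) (timesX-+ _ _)))
    (+v-interchange _ _ _ _)

  mul-·ʳ : ∀ {k} (p : V k) b w → mul p (b ·v w) ≡ b ·v mul p w
  mul-·ʳ [] b w = sym (·v-0v b)
  mul-·ʳ (a ∷ p) b w = trans (cong₂ _+v_ (·v-comm a b w) (trans (cong timesX (mul-·ʳ p b w)) (timesX-· b _)))
    (sym (·v-+v b _ _))

  mul-timesX : ∀ {k} (p : V k) w → mul p (timesX w) ≡ timesX (mul p w)
  mul-timesX [] w = sym timesX-0
  mul-timesX (a ∷ p) w = trans (cong₂ _+v_ (sym (timesX-· a w)) (cong timesX (mul-timesX p w)))
    (sym (timesX-+ _ _))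

  mul-·ˡ : ∀ {k} b (p : V k) w → mul (b ·v p) w ≡ b ·v mul p w
  mul-·ˡ b [] w = sym (·v-0v b)
  mul-·ˡ b (a ∷ p) w = trans (cong₂ _+v_ (*-·v b a w) (trans (cong timesX (mul-·ˡ b p w)) (timesX-· b _)))
    (sym (·v-+v b _ _))

  -- Polynomials in one operator commute. Together with `mul-one` this gives commutativity and then
  -- associativity without structure constants.
  mul-mul : ∀ {k l} (p : V k) (q : V l) w → mul p (mul q w) ≡ mul q (mul p w)
  mul-mul [] q w = sym (trans (cong (mul q) (sym (0-·v (0v {n})))) (trans (mul-·ʳ q 0# 0v) (0-·v _)))
  mul-mul (a ∷ p) q w = trans (cong (λ t → (a ·v mul q w) +v timesX t) (mul-mul p q w))
    (sym (trans (mul-+ʳ q _ _) (cong₂ _+v_ (mul-·ʳ q a w) (mul-timesX q _))))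

  coord-0v : ∀ {m} i → coord (0v {m}) i ≡ 0#
  coord-0v {zero} i = refl
  coord-0v {suc m} zero = refl
  coord-0v {suc m} (suc i) = coord-0v {m} i

  coord-one : ∀ i → i ℕ.< n → coord one-v i ≡ δ i
  coord-one zero p = refl
  coord-one (suc i) p = coord-0v {d} i

  coord-mul-one : ∀ {k} (p : V k) → k ℕ.≤ n → ∀ i → i ℕ.< n → coord (mul p one-v) i ≡ coord p i
  coord-mul-one [] k≤n i p = coord-0v {n} i
  coord-mul-one (a ∷ p) (s≤s k≤d) i i<n = trans (coord-+v (a ·v one-v) (timesX (mul p one-v)) i)
    (trans (cong₂ _+_ (trans (coord-·v a one-v i) (mulˡ a (coord-one i i<n)))
      (trans (coord-timesX (mul p one-v) i i<n)
      (cong (λ t → shift (coord (mul p one-v)) i + - (t * coord c i))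
        (trans (coord-mul-one p k≤n d ℕP.≤-refl) (coord-≥ p d k≤d)))))
      (entry i i<n))
    where
    k≤n : _ ℕ.≤ n
    k≤n = ℕP.≤-trans k≤d (ℕP.n≤1+n d)
    entry : ∀ i → i ℕ.< n → a * δ i + (shift (coord (mul p one-v)) i + - (0# * coord c i)) ≡ coord (a ∷ p) i
    entry i i<n = trans (cong (λ t → a * δ i + (shift (coord (mul p one-v)) i + t))
      (trans (cong -_ (zeroˡ _)) (trans (sym (+-identityˡ _)) (-‿inverseʳ 0#))))
      (trans (addˡ _ (+-identityʳ _)) (case i i<n))
      where
      case : ∀ i → i ℕ.< n → a * δ i + shift (coord (mul p one-v)) i ≡ coord (a ∷ p) i
      case zero _ = trans (+-identityʳ _) (*-identityʳ a)
      case (suc i) (s≤s i<d) = trans (cong₂ _+_ (zeroʳ a)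
        (coord-mul-one p k≤n i (ℕP.≤-trans i<d (ℕP.n≤1+n d)))) (+-identityˡ _)

  mul-one : ∀ (v : V n) → mul v one-v ≡ v
  mul-one v = coord-ext _ _ (coord-mul-one v ℕP.≤-refl)

  mul-comm : ∀ (v w : V n) → mul v w ≡ mul w v
  mul-comm v w = trans (cong (mul v) (sym (mul-one w))) (trans (mul-mul v w one-v) (cong (mul w) (mul-one v)))

  mul-assoc : ∀ (u v w : V n) → mul (mul u v) w ≡ mul u (mul v w)
  mul-assoc u v w = trans (mul-comm (mul u v) w) (trans (mul-mul w u v) (cong (mul u) (mul-comm w v)))

  one-mul : ∀ (w : V n) → mul one-v w ≡ w
  one-mul w = trans (mul-comm one-v w) (mul-one w)

  scalar-mul : ∀ a (w : V n) → mul (a ·v one-v) w ≡ a ·v w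
  scalar-mul a w = trans (mul-·ˡ a one-v w) (cong (a ·v_) (one-mul w))

  inverseʳ : ∀ {m} (v : V m) → v +v m1 ·v v ≡ 0v
  inverseʳ [] = refl
  inverseʳ (a ∷ v) = cong₂ _∷_ (trans (solve 1 (λ a → a :+ con -[1+ 0 ] :* a := a :- a) refl a)
    (-‿inverseʳ a)) (inverseʳ v)

  torsion-v : ∀ {m} k (v : V m) → ι (+ suc k) ·v v ≡ 0v → v ≡ 0v
  torsion-v k [] e = refl
  torsion-v k (a ∷ v) e = cong₂ _∷_ (torsion k a (cong hd e)) (torsion-v k v (cong Vec.tail e))

  algebra : Alg
  algebra = record
    { Carrier = V n ; _+_ = _+v_ ; _*_ = mul ; -_ = m1 ·v_ ; 0# = 0v ; 1# = one-v
    ; isCommutativeRing = record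
        { isRing = record
            { +-isAbelianGroup = record
                { isGroup = record
                    { isMonoid = record
                        { isSemigroup = record { isMagma =
                          record { isEquivalence = isEquivalence ; ∙-cong = cong₂ _+v_ } ; assoc = +v-assoc }
                        ; identity = +v-identityˡ , +v-identityʳ }
                    ; inverse = (λ v → trans (+v-comm _ v) (inverseʳ v)) , inverseʳ
                    ; ⁻¹-cong = cong (m1 ·v_) }
                ; comm = +v-comm }
            ; *-cong = cong₂ mul
            ; *-assoc = mul-assoc
            ; *-identity = one-mul , mul-one
            ; distrib = mul-+ʳ , λ u v w → trans (mul-comm (v +v w) u)
              (trans (mul-+ʳ u v w) (cong₂ _+v_ (mul-comm u v) (mul-comm u w))) }
        ; *-comm = mul-comm }
    ; ι = λ a → ι a ·v one-v
    ; ι-+ = λ a b → trans (cong (_·v one-v) (ι-+ a b)) (+-·v _ _ _)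
    ; ι-* = λ a b → trans (cong (_·v one-v) (ι-* a b)) (trans (*-·v _ _ _) (sym (scalar-mul (ι a) _)))
    ; ι-neg = λ a → trans (cong (_·v one-v) (trans (ι-neg a)
      (solve 1 (λ x → :- x := con -[1+ 0 ] :* x) refl (ι a)))) (*-·v m1 (ι a) one-v)
    ; ι-0 = trans (cong (_·v one-v) ι-0) (0-·v one-v)
    ; ι-1 = trans (cong (_·v one-v) ι-1) (1-·v one-v)
    ; π = λ v → π (hd v)
    ; π-+ = λ u v → trans (cong π (hd-+ u v)) (π-+ _ _)
    ; π-ι* = λ a v → trans (cong (λ t → π (hd t)) (scalar-mul (ι a) v))
      (trans (cong π (hd-· (ι a) v)) (π-ι* a (hd v)))
    ; π-1 = π-1
    ; torsion = λ k v e → torsion-v k v (trans (sym (scalar-mul (ι (+ suc k)) v)) e) }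

  embed : Hom R algebra
  embed = record
    { φ = _·v one-v
    ; φ-+ = λ a b → +-·v a b one-v
    ; φ-* = λ a b → trans (*-·v a b one-v) (sym (scalar-mul a (b ·v one-v)))
    ; φ-neg = λ a → trans (cong (_·v one-v) (solve 1 (λ x → :- x := con -[1+ 0 ] :* x) refl a))
      (*-·v m1 a one-v)
    ; φ-0 = 0-·v one-v ; φ-1 = 1-·v one-v ; φ-ι = λ a → refl }

  root : V n
  root = timesX one-v

  root-mul : ∀ w → mul root w ≡ timesX w
  root-mul w = trans (mul-comm root w) (trans (mul-timesX w one-v) (cong timesX (mul-one w)))

  power : ℕ → V n
  power zero = one-v
  power (suc k) = timesX (power k)

  horner : ∀ {k} → Vec (V n) k → V n
  horner [] = one-v
  horner (a ∷ p) = a +v mul root (horner p)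

  horner-embed : ∀ {k} (p : V k) → horner (Vec.map (_·v one-v) p) ≡ mul p one-v +v power k
  horner-embed [] = sym (+v-identityˡ one-v)
  horner-embed (a ∷ p) = trans (cong ((a ·v one-v) +v_)
    (trans (root-mul _) (trans (cong timesX (horner-embed p)) (timesX-+ _ _)))) (sym (+v-assoc _ _ _))

  coord-power : ∀ k → k ℕ.≤ d → ∀ i → i ℕ.< n → coord (power k) i ≡ monomial k i
  coord-power zero k≤d i i<n = coord-one i i<n
  coord-power (suc k) k<d i i<n = trans (coord-timesX (power k) i i<n)
    (trans (cong (λ t → shift (coord (power k)) i + - (t * coord c i))
      (trans (coord-power k (ℕP.<⇒≤ k<d) d ℕP.≤-refl) (above k<d)))
      (trans (addˡ _ (trans (cong -_ (zeroˡ _)) (trans (sym (+-identityˡ _)) (-‿inverseʳ 0#))))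
        (trans (+-identityʳ _) (shift-coord i i<n))))
    where
    above : k ℕ.< d → monomial k d ≡ 0#
    above k<d = trans (cong (monomial k) (sym (trans (ℕP.+-suc k _) (ℕP.m+[n∸m]≡n k<d))))
      (monomial-> k (d ℕ.∸ suc k))
    shift-coord : ∀ i → i ℕ.< n → shift (coord (power k)) i ≡ monomial (suc k) i
    shift-coord zero _ = refl
    shift-coord (suc i) (s≤s i<d) = coord-power k (ℕP.<⇒≤ k<d) i (ℕP.≤-trans i<d (ℕP.n≤1+n d))

  monomial-d : monomial d d ≡ 1#
  monomial-d = Spectrum.monomial-≡ R d

  -- The powers 1, x, ..., xᵈ are the basis vectors, and `timesX`, the companion matrix, sends the
  -- last of them to -c.
  horner-root : horner (Vec.map (_·v one-v) c) ≡ 0v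
  horner-root = trans (horner-embed c) (trans (cong₂ _+v_ (mul-one c) last-power) (inverseʳ c))
    where
    last-power : power n ≡ m1 ·v c
    last-power = coord-ext _ _ λ i i<n → trans (coord-timesX (power d) i i<n)
      (trans (cong₂ (λ s t → s + - (t * coord c i)) (shift-coord i i<n)
        (trans (coord-power d ℕP.≤-refl d ℕP.≤-refl) monomial-d))
        (trans (+-identityˡ _) (trans (trans (cong -_ (*-identityˡ _))
          (solve 1 (λ x → :- x := con -[1+ 0 ] :* x) refl (coord c i))) (sym (coord-·v m1 c i)))))
      where
      shift-coord : ∀ i → i ℕ.< n → shift (coord (power d)) i ≡ 0#
      shift-coord zero _ = refl
      shift-coord (suc i) (s≤s i<d) = trans (coord-power d ℕP.≤-refl i (ℕP.≤-trans i<d (ℕP.n≤1+n d)))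
        (monomial-< d i i<d)

module Quotient (R : Alg) (ξ : Alg.Carrier R) where
  open AlgTheory R
  open Coordinates R
  open Roots R using (δ; shift; mulRoot)

  hornerAt : ∀ {k} → Vec Carrier k → Carrier
  hornerAt [] = 1#
  hornerAt (c ∷ cs) = c + ξ * hornerAt cs

  -- Synthetic division: the intermediate values of Horner's scheme at ξ are the coefficients of the
  -- quotient by x - ξ.
  quotient : ∀ {k} → Vec Carrier (suc k) → Vec Carrier k
  quotient (c ∷ []) = []
  quotient (c ∷ c' ∷ cs) = hornerAt (c' ∷ cs) ∷ quotient (c' ∷ cs)

  quotient-0 : ∀ {k} c (cs : Vec Carrier k) → monic (quotient (c ∷ cs)) 0 ≡ hornerAt cs
  quotient-0 c [] = refl
  quotient-0 c (c' ∷ cs) = refl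

  quotient-suc : ∀ {k} c (cs : Vec Carrier k) i → monic cs i ≡ mulRoot ξ (monic (quotient (c ∷ cs))) (suc i)
  quotient-suc c [] i = sym (trans (addˡ _ (zeroʳ _)) (+-identityʳ _))
  quotient-suc c (c' ∷ cs) zero = sym (trans (cong (λ t → (c' + ξ * hornerAt cs) + (- ξ) * t)
    (quotient-0 c' cs))
    (solve 3 (λ c x h → (c :+ x :* h) :+ (:- x) :* h := c) refl c' ξ (hornerAt cs)))
  quotient-suc c (c' ∷ cs) (suc i) = quotient-suc c' cs i

  quotient-root : ∀ {k} c (cs : Vec Carrier k) → hornerAt (c ∷ cs) ≡ 0# → ∀ i → monic (c ∷ cs) i ≡ mulRoot ξ
    (monic (quotient (c ∷ cs))) i
  quotient-root c cs e zero = trans (solve 3 (λ c x h → c := (c :+ x :* h) :+ (:- x) :* h) refl c ξ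
    (hornerAt cs))
    (cong₂ _+_ e (mulˡ (- ξ) (sym (quotient-0 c cs))))
  quotient-root c cs e (suc i) = quotient-suc c cs i

record Splitting (R : Alg) {k} (cs : Vec (Alg.Carrier R) k) : Set₁ where
  field
    S : Alg
    hom : Hom R S
    γs : List (Alg.Carrier S)
    γs-length : length γs ≡ k
    γs-roots : ∀ i → Roots.prodRoots S γs i ≡ Hom.φ hom (Coordinates.monic R cs i)

-- A root is adjoined, its linear factor divided out, and the quotient split over the larger ring.
split : ∀ k (R : Alg) (cs : Vec (Alg.Carrier R) k) → Splitting R cs
split zero R [] = record { S = R ; hom = idHom R ; γs = [] ; γs-length = refl ; γs-roots = λ i → refl }
split (suc k) R cs = record
  { S = S
  ; hom = hom ∘Hom embed
  ; γs = φ root ∷ γs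
  ; γs-length = cong suc γs-length
  ; γs-roots = λ i → trans (cong₂ (λ s t → s S.+ (S.- φ root) S.* t) (shift-φ i) (γs-roots i))
      (trans (sym (trans (φ-+ _ _) (cong (λ t → φ (shift q i) S.+ t)
        (trans (φ-* _ _) (cong (S._* φ (q i)) (φ-neg root))))))
        (cong φ (trans (sym (factor (Vec.map e cs) horner-zero i)) (monic-map cs i)))) }
  where
  open Adjoin R k cs using (algebra; embed; root; horner-root; horner)
  open Quotient algebra root
  open Roots algebra using (shift)
  e : Alg.Carrier R → Alg.Carrier algebra
  e = Hom.φ embed
  qs : Vec (Alg.Carrier algebra) k
  qs = quotient (Vec.map e cs)
  q : ℕ → Alg.Carrier algebra
  q = Coordinates.monic algebra qs
  open Splitting (split k algebra qs)
  open Hom hom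
  module S = Alg S
  shift-φ : ∀ i → Roots.shift S (Roots.prodRoots S γs) i ≡ φ (shift q i)
  shift-φ zero = sym φ-0
  shift-φ (suc i) = γs-roots i
  horner-≡ : ∀ {j} (v : Vec (Alg.Carrier algebra) j) → hornerAt v ≡ horner v
  horner-≡ [] = refl
  horner-≡ (x ∷ v) = cong (λ t → Alg._+_ algebra x (Alg._*_ algebra root t)) (horner-≡ v)
  horner-zero : hornerAt (Vec.map e cs) ≡ Alg.0# algebra
  horner-zero = trans (horner-≡ (Vec.map e cs)) horner-root
  factor : ∀ (v : Vec (Alg.Carrier algebra) (suc k)) → hornerAt v ≡ Alg.0# algebra → ∀ i →
    Coordinates.monic algebra v i ≡ Roots.mulRoot algebra root (Coordinates.monic algebra (quotient v)) i
  factor (x ∷ v) h i = quotient-root x v h i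
  monic-map : ∀ {j} (v : Vec (Alg.Carrier R) j) i → Coordinates.monic algebra (Vec.map e v) i ≡ e
    (Coordinates.monic R v i)
  monic-map [] zero = sym (Hom.φ-1 embed)
  monic-map [] (suc i) = sym (Hom.φ-0 embed)
  monic-map (x ∷ v) zero = refl
  monic-map (x ∷ v) (suc i) = monic-map v i

chebV-lead : ∀ n → chebV n n ≡ + 1
chebV-lead zero = refl
chebV-lead (suc zero) = refl
chebV-lead (suc (suc n)) = cong₂ ℤ._-_ (chebV-lead (suc n)) (chebV-degree n (suc (suc n)) (ℕP.n≤1+n _))

module _ where
  open Coordinates ℤ-alg

  monic-< : ∀ n (f : ℕ → ℤ) i → i ℕ.< n → monic (tab n f) i ≡ f i
  monic-< (suc n) f zero p = refl
  monic-< (suc n) f (suc i) (s≤s p) = monic-< n (f ∘ suc) i p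

  monic-≡ : ∀ n (f : ℕ → ℤ) → monic (tab n f) n ≡ + 1
  monic-≡ zero f = refl
  monic-≡ (suc n) f = monic-≡ n (f ∘ suc)

  monic-> : ∀ n (f : ℕ → ℤ) i → n ℕ.< i → monic (tab n f) i ≡ + 0
  monic-> zero f (suc i) p = refl
  monic-> (suc n) f (suc i) (s≤s p) = monic-> n (f ∘ suc) i p

  monic-chebV : ∀ n i → monic (tab n (chebV n)) i ≡ chebV n i
  monic-chebV n i with ℕP.<-cmp i n
  ... | tri< p _ _ = monic-< n (chebV n) i p
  ... | tri≈ _ refl _ = trans (monic-≡ n (chebV n)) (sym (chebV-lead n))
  ... | tri> _ _ p = trans (monic-> n (chebV n) i p) (sym (chebV-degree n i p))

  abstract
    -- Abstract, so that the iterated extension is never unfolded; only the properties in the type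
    -- are used.
    roots-exist : ∀ n → Σ Alg λ S → Σ (List (Alg.Carrier S)) λ γs → Roots.IsRoots S γs × length γs ≡ n
    roots-exist n = S , γs ,
      (λ i → trans (γs-roots i) (trans (φ-ι _) (cong (Alg.ι S)
        (trans (monic-chebV n i) (cong (λ k → chebV k i) (sym γs-length)))))) ,
      γs-length
      where
      open Splitting (split n ℤ-alg (tab n (chebV n)))
      open Hom hom

-- 2-adic continuity

2^ : ℕ → ℤ
2^ k = + (2 ℕ.^ k)

2^-suc : ∀ k → 2^ (suc k) ≡ + 2 ℤ.* 2^ k
2^-suc k = ℤP.pos-* 2 (2 ℕ.^ k)

infix 4 _≡_[mod2^_]
record _≡_[mod2^_] (a b : ℤ) (k : ℕ) : Set where
  constructor mod
  field divisible : 2^ k ∣ a ℤ.- b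
open _≡_[mod2^_]

module _ {k : ℕ} where

  ≡⇒mod : ∀ {a b} → a ≡ b → a ≡ b [mod2^ k ]
  ≡⇒mod {a} refl = mod (divides (+ 0) (ℤP.+-inverseʳ a))

  mod-trans : ∀ {a b c} → a ≡ b [mod2^ k ] → b ≡ c [mod2^ k ] → a ≡ c [mod2^ k ]
  mod-trans {a} {b} {c} (mod p) (mod q) = mod (subst (2^ k ∣_) (lem a b c) (∣m∣n⇒∣m+n p q))
    where
    lem : ∀ a b c → (a ℤ.- b) ℤ.+ (b ℤ.- c) ≡ a ℤ.- c
    lem = solve-∀

  mod-neg : ∀ {a b} → a ≡ b [mod2^ k ] → ℤ.- a ≡ ℤ.- b [mod2^ k ]
  mod-neg {a} {b} (mod p) = mod (subst (2^ k ∣_) (lem a b) (ℤ∣.∣m⇒∣-m p))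
    where
    lem : ∀ a b → ℤ.- (a ℤ.- b) ≡ (ℤ.- a) ℤ.- (ℤ.- b)
    lem = solve-∀

  mod-sym : ∀ {a b} → a ≡ b [mod2^ k ] → b ≡ a [mod2^ k ]
  mod-sym {a} {b} (mod p) = mod (subst (2^ k ∣_) (lem a b) (ℤ∣.∣m⇒∣-m p))
    where
    lem : ∀ a b → ℤ.- (a ℤ.- b) ≡ b ℤ.- a
    lem = solve-∀

  mod-+ : ∀ {a b c d} → a ≡ b [mod2^ k ] → c ≡ d [mod2^ k ] → a ℤ.+ c ≡ b ℤ.+ d [mod2^ k ]
  mod-+ {a} {b} {c} {d} (mod p) (mod q) = mod (subst (2^ k ∣_) (lem a b c d) (∣m∣n⇒∣m+n p q))
    where
    lem : ∀ a b c d → (a ℤ.- b) ℤ.+ (c ℤ.- d) ≡ (a ℤ.+ c) ℤ.- (b ℤ.+ d)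
    lem = solve-∀

  mod-- : ∀ {a b c d} → a ≡ b [mod2^ k ] → c ≡ d [mod2^ k ] → a ℤ.- c ≡ b ℤ.- d [mod2^ k ]
  mod-- p q = mod-+ p (mod-neg q)

  mod-* : ∀ {a b c d} → a ≡ b [mod2^ k ] → c ≡ d [mod2^ k ] → a ℤ.* c ≡ b ℤ.* d [mod2^ k ]
  mod-* {a} {b} {c} {d} (mod p) (mod q) = mod (subst (2^ k ∣_) (lem a b c d)
    (∣m∣n⇒∣m+n (∣n⇒∣m*n a q) (∣m⇒∣m*n d p)))
    where
    lem : ∀ a b c d → a ℤ.* (c ℤ.- d) ℤ.+ (a ℤ.- b) ℤ.* d ≡ a ℤ.* c ℤ.- b ℤ.* d
    lem = solve-∀

-- `above` and `below` express n ≡ m modulo 2^ℓ without subtraction; `opposite` expresses m ≡ -1 -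
-- n.
data Near (ℓ n m : ℕ) : Set where
  above : ∀ q → n ≡ q ℕ.* 2 ℕ.^ ℓ ℕ.+ m → Near ℓ n m
  below : ∀ q → m ≡ q ℕ.* 2 ℕ.^ ℓ ℕ.+ n → Near ℓ n m
  opposite : ∀ q → suc (n ℕ.+ m) ≡ q ℕ.* 2 ℕ.^ ℓ → Near ℓ n m

near-mono : ∀ {ℓ ℓ' n m} → ℓ ℕ.≤ ℓ' → Near ℓ' n m → Near ℓ n m
near-mono {ℓ} {ℓ'} p = go
  where
  multiple : ∀ q → q ℕ.* 2 ℕ.^ ℓ' ≡ (q ℕ.* 2 ℕ.^ (ℓ' ℕ.∸ ℓ)) ℕ.* 2 ℕ.^ ℓ
  multiple q = trans (cong (λ j → q ℕ.* 2 ℕ.^ j) (sym (ℕP.m∸n+n≡m p)))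
    (trans (cong (q ℕ.*_) (ℕP.^-distribˡ-+-* 2 (ℓ' ℕ.∸ ℓ) ℓ)) (sym (ℕP.*-assoc q _ _)))
  go : ∀ {n m} → Near ℓ' n m → Near ℓ n m
  go {n} {m} (above q e) = above (q ℕ.* 2 ℕ.^ (ℓ' ℕ.∸ ℓ)) (trans e (cong (ℕ._+ m) (multiple q)))
  go {n} {m} (below q e) = below (q ℕ.* 2 ℕ.^ (ℓ' ℕ.∸ ℓ)) (trans e (cong (ℕ._+ n) (multiple q)))
  go (opposite q e) = opposite (q ℕ.* 2 ℕ.^ (ℓ' ℕ.∸ ℓ)) (trans e (multiple q))

-- Uniform 2-adic continuity together with invariance under n ↦ −1 − n of the continuous extension.
Good : (ℕ → ℤ) → Set
Good s = ∀ k → ∃ λ ℓ → ∀ n m → Near ℓ n m → s n ≡ s m [mod2^ k ]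

good-const : ∀ a → Good (λ _ → a)
good-const a k = 0 , λ n m _ → ≡⇒mod refl

good-cong : ∀ {s t} → (∀ n → s n ≡ t n) → Good s → Good t
good-cong e g k = proj₁ (g k) , λ n m p → subst₂ (λ a b → a ≡ b [mod2^ k ]) (e n) (e m) (proj₂ (g k) n m p)

private
  good-op : ∀ (_∙_ : ℤ → ℤ → ℤ) → (∀ {k a b c d} → a ≡ b [mod2^ k ] → c ≡ d [mod2^ k ] → (a ∙ c) ≡
    (b ∙ d) [mod2^ k ]) →
    ∀ {s t} → Good s → Good t → Good (λ n → s n ∙ t n)
  good-op _∙_ ∙-mod g h k with g k | h k
  ... | ℓ , p | ℓ' , q = ℓ ℕ.⊔ ℓ' , λ n m r →
    ∙-mod (p n m (near-mono (ℕP.m≤m⊔n ℓ ℓ') r)) (q n m (near-mono (ℕP.m≤n⊔m ℓ ℓ') r))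

good-+ : ∀ {s t} → Good s → Good t → Good (λ n → s n ℤ.+ t n)
good-+ = good-op ℤ._+_ mod-+

good-- : ∀ {s t} → Good s → Good t → Good (λ n → s n ℤ.- t n)
good-- = good-op ℤ._-_ mod--

good-* : ∀ {s t} → Good s → Good t → Good (λ n → s n ℤ.* t n)
good-* = good-op ℤ._*_ mod-*

private
  halves : ∀ c → (∃ λ e → c ≡ e ℕ.+ e) ⊎ (∃ λ e → c ≡ suc (e ℕ.+ e))
  halves zero = inj₁ (0 , refl)
  halves (suc c) with halves c
  ... | inj₁ (e , p) = inj₂ (e , cong suc p)
  ... | inj₂ (e , p) = inj₁ (suc e , cong suc (trans p (sym (ℕP.+-suc e e))))

  cancel-2 : ∀ k x → 2^ (suc k) ∣ + 2 ℤ.* x → 2^ k ∣ x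
  cancel-2 k x p = ℤ∣.*-cancelˡ-∣ (+ 2) (subst (_∣ + 2 ℤ.* x) (2^-suc k) p)

  -- With c = 1 + 2e, x = cx - 2ex shows that x is even once cx is; one factor 2 is then removed
  -- from x and from the modulus.
  cancel-odd : ∀ e k x → 2^ k ∣ (+ 1 ℤ.+ (e ℤ.+ e)) ℤ.* x → 2^ k ∣ x
  cancel-odd e zero x p = divides x (sym (ℤP.*-identityʳ x))
  cancel-odd e (suc k) x p with ℤ∣.∣-trans (subst (+ 2 ∣_) (sym (2^-suc k)) (ℤ∣.∣m⇒∣m*n (2^ k) ℤ∣.∣-refl)) p
  ... | divides q eq = subst (2^ (suc k) ∣_) (sym half)
      (subst (_∣ + 2 ℤ.* (q ℤ.- e ℤ.* x)) (sym (2^-suc k)) (ℤ∣.*-monoʳ-∣ (+ 2) (cancel-odd e k _ (cancel-2 k _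
        (subst (2^ (suc k) ∣_) (trans (cong ((+ 1 ℤ.+ (e ℤ.+ e)) ℤ.*_) half)
          (lem₂ (+ 1 ℤ.+ (e ℤ.+ e)) (q ℤ.- e ℤ.* x))) p)))))
    where
    lem : ∀ e x → x ≡ (+ 1 ℤ.+ (e ℤ.+ e)) ℤ.* x ℤ.- + 2 ℤ.* (e ℤ.* x)
    lem = solve-∀
    lem₁ : ∀ q y → q ℤ.* + 2 ℤ.- + 2 ℤ.* y ≡ + 2 ℤ.* (q ℤ.- y)
    lem₁ = solve-∀
    lem₂ : ∀ c y → c ℤ.* (+ 2 ℤ.* y) ≡ + 2 ℤ.* (c ℤ.* y)
    lem₂ = solve-∀
    half : x ≡ + 2 ℤ.* (q ℤ.- e ℤ.* x)
    half = trans (lem e x) (trans (cong (λ t → t ℤ.- + 2 ℤ.* (e ℤ.* x)) eq) (lem₁ q (e ℤ.* x)))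

-- `K` exceeds `k` by the number of factors 2 in `suc c`; in particular it does not depend on `x`.
cancel-mod : ∀ c k → ∃ λ K → ∀ x → 2^ K ∣ + suc c ℤ.* x → 2^ k ∣ x
cancel-mod c k = go (suc c) c ℕP.≤-refl
  where
  go : ∀ fuel c → c ℕ.< fuel → ∃ λ K → ∀ x → 2^ K ∣ + suc c ℤ.* x → 2^ k ∣ x
  go (suc fuel) c (s≤s p) with halves (suc c)
  ... | inj₂ (e , eq) = k , λ x d → cancel-odd (+ e) k x (subst (λ t → 2^ k ∣ + t ℤ.* x) eq d)
  ... | inj₁ (suc e , eq) with go fuel e (ℕP.≤-trans (subst (suc e ℕ.≤_)
    (sym (trans (ℕP.suc-injective eq) (ℕP.+-suc e e))) (s≤s (ℕP.m≤m+n e e))) p)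
  ... | K , f = suc K , λ x d → f x (cancel-2 K _ (subst (2^ (suc K) ∣_)
    (trans (cong (λ t → + t ℤ.* x) eq) (lem (+ suc e) x)) d))
    where
    lem : ∀ a x → (a ℤ.+ a) ℤ.* x ≡ + 2 ℤ.* (a ℤ.* x)
    lem = solve-∀

-- Division by a fixed positive integer costs a fixed number of binary digits, which a finer modulus
-- of continuity supplies.
good-cancel : ∀ c {s} → Good (λ n → + suc c ℤ.* s n) → Good s
good-cancel c {s} g k with cancel-mod c k
... | K , f with g K
... | ℓ , h = ℓ , λ n m p → mod (f _ (subst (2^ K ∣_) (lem (+ suc c) (s n) (s m)) (divisible (h n m p))))
  where
  lem : ∀ c a b → c ℤ.* a ℤ.- c ℤ.* b ≡ c ℤ.* (a ℤ.- b)
  lem = solve-∀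

Periodic : ℕ → ℕ → (ℕ → ℤ) → Set
Periodic ℓ k h = ∀ n → h (2 ℕ.^ ℓ ℕ.+ n) ≡ h n [mod2^ k ]

periodic-multiple : ∀ ℓ k h → Periodic ℓ k h → ∀ q n → h (q ℕ.* 2 ℕ.^ ℓ ℕ.+ n) ≡ h n [mod2^ k ]
periodic-multiple ℓ k h p zero n = ≡⇒mod refl
periodic-multiple ℓ k h p (suc q) n = mod-trans (≡⇒mod (cong h (ℕP.+-assoc (2 ℕ.^ ℓ) (q ℕ.* 2 ℕ.^ ℓ) n)))
  (mod-trans (p _) (periodic-multiple ℓ k h p q n))

periodic-mono : ∀ {ℓ ℓ'} k h → ℓ ℕ.≤ ℓ' → Periodic ℓ k h → Periodic ℓ' k h
periodic-mono {ℓ} {ℓ'} k h l p n = mod-trans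
  (≡⇒mod (cong (λ t → h (t ℕ.+ n)) (trans (cong (2 ℕ.^_) (sym (ℕP.m∸n+n≡m l)))
    (ℕP.^-distribˡ-+-* 2 (ℓ' ℕ.∸ ℓ) ℓ))))
  (periodic-multiple ℓ k h p (2 ℕ.^ (ℓ' ℕ.∸ ℓ)) n)

-- If h(n+2) + h(n) = g(n+1) and g has period L = 2^ℓ with 4 ∣ L, then d(n) = h(L+n) − h(n) satisfies
-- d(n+2) = −d(n), hence has period L, so that h(jL+n) = h(n) + j d(n).
periodic-step : ∀ ℓ k (g h : ℕ → ℤ) → (∀ n → h (suc (suc n)) ≡ g (suc n) ℤ.- h n) →
  Periodic (suc (suc ℓ)) k g → Periodic (k ℕ.+ suc (suc ℓ)) k h
periodic-step ℓ k g h rec p n = mod-trans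
  (≡⇒mod (cong (λ t → h (t ℕ.+ n)) (ℕP.^-distribˡ-+-* 2 k (suc (suc ℓ)))))
  (mod-trans (steps (2 ℕ.^ k)) (mod (subst (2^ k ∣_) (sym (lem₃ (h n) (2^ k ℤ.* d n)))
    (∣m⇒∣m*n (d n) ℤ∣.∣-refl))))
  where
  L : ℕ
  L = 2 ℕ.^ suc (suc ℓ)
  d : ℕ → ℤ
  d n = h (L ℕ.+ n) ℤ.- h n
  lem₁ : ∀ g h g' h' → (g ℤ.- h) ℤ.- (g' ℤ.- h') ≡ (g ℤ.- g') ℤ.- (h ℤ.- h')
  lem₁ = solve-∀
  lem₂ : ∀ a b → (+ 0 ℤ.- (+ 0 ℤ.- a)) ≡ a
  lem₂ = solve-∀
  lem₃ : ∀ a b → (a ℤ.+ b) ℤ.- a ≡ b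
  lem₃ = solve-∀
  d-step : ∀ n → d (suc (suc n)) ≡ + 0 ℤ.- d n [mod2^ k ]
  d-step n = mod-trans (≡⇒mod (trans
      (cong₂ ℤ._-_ (trans (cong h (trans (ℕP.+-suc L (suc n)) (cong suc (ℕP.+-suc L n)))) (rec (L ℕ.+ n)))
        (rec n))
      (lem₁ (g (suc (L ℕ.+ n))) (h (L ℕ.+ n)) (g (suc n)) (h n))))
    (mod-- {a = g (suc (L ℕ.+ n)) ℤ.- g (suc n)} {b = + 0} {c = d n} {d = d n}
      (mod (subst (2^ k ∣_) (sym (ℤP.+-identityʳ _)) (divisible
        (subst (λ t → g t ≡ g (suc n) [mod2^ k ]) (ℕP.+-suc L n) (p (suc n)))))) (≡⇒mod refl))
  d-4 : ∀ n → d (4 ℕ.+ n) ≡ d n [mod2^ k ]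
  d-4 n = mod-trans (d-step (suc (suc n))) (mod-trans (mod-- {a = + 0} {b = + 0} (≡⇒mod refl) (d-step n))
    (≡⇒mod (lem₂ (d n) (d n))))
  d-4q : ∀ q n → d (q ℕ.* 4 ℕ.+ n) ≡ d n [mod2^ k ]
  d-4q zero n = ≡⇒mod refl
  d-4q (suc q) n = mod-trans (≡⇒mod (cong d (ℕP.+-assoc 4 (q ℕ.* 4) n))) (mod-trans (d-4 _) (d-4q q n))
  d-L : ∀ j n → d (j ℕ.* L ℕ.+ n) ≡ d n [mod2^ k ]
  d-L j n = subst (λ t → d (t ℕ.+ n) ≡ d n [mod2^ k ]) (sym
    (trans (cong (j ℕ.*_) (trans (sym (ℕP.*-assoc 2 2 (2 ℕ.^ ℓ))) (ℕP.*-comm 4 (2 ℕ.^ ℓ))))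
      (sym (ℕP.*-assoc j (2 ℕ.^ ℓ) 4)))) (d-4q (j ℕ.* 2 ℕ.^ ℓ) n)
  steps : ∀ j → h (j ℕ.* L ℕ.+ n) ≡ h n ℤ.+ + j ℤ.* d n [mod2^ k ]
  steps zero = ≡⇒mod (lem₄ (h n) (d n))
    where
    lem₄ : ∀ a b → a ≡ a ℤ.+ + 0 ℤ.* b
    lem₄ = solve-∀
  steps (suc j) = mod-trans (≡⇒mod (trans (cong h (ℕP.+-assoc L (j ℕ.* L) n))
    (lem₅ (h (L ℕ.+ (j ℕ.* L ℕ.+ n))) (h (j ℕ.* L ℕ.+ n)))))
    (mod-trans (mod-+ (d-L j n) (steps j)) (≡⇒mod (lem₆ (h n) (+ j) (d n))))
    where
    lem₅ : ∀ a b → a ≡ (a ℤ.- b) ℤ.+ b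
    lem₅ = solve-∀
    lem₆ : ∀ a j b → b ℤ.+ (a ℤ.+ j ℤ.* b) ≡ a ℤ.+ (+ 1 ℤ.+ j) ℤ.* b
    lem₆ = solve-∀

-- The coefficients of yⁱ⁺¹ satisfy the recurrence of `periodic-step` with those of yⁱ as
-- inhomogeneity, and each step multiplies the period by 2ᵏ. The exponent is kept in the form ℓ + 2
-- because the step needs a period divisible by 4.
chebV-periodic : ∀ k i → ∃ λ ℓ → ∀ j → j ℕ.≤ i → Periodic (suc (suc ℓ)) k (λ n → chebV n j)
chebV-periodic k zero = k ℕ.+ 0 , λ { zero z≤n → subst (λ e → Periodic e k (λ n → chebV n 0))
  (trans (ℕP.+-suc k 1) (cong suc (ℕP.+-suc k 0)))
  (periodic-step 0 k (λ _ → + 0) (λ n → chebV n 0) (λ n → refl) (λ n → ≡⇒mod refl)) }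
chebV-periodic k (suc i) with chebV-periodic k i
... | ℓ , p = k ℕ.+ ℓ , λ j j≤ → case j j≤
  where
  exponent : k ℕ.+ suc (suc ℓ) ≡ suc (suc (k ℕ.+ ℓ))
  exponent = trans (ℕP.+-suc k (suc ℓ)) (cong suc (ℕP.+-suc k ℓ))
  case : ∀ j → j ℕ.≤ suc i → Periodic (suc (suc (k ℕ.+ ℓ))) k (λ n → chebV n j)
  case j j≤ with ℕP.m≤n⇒m<n∨m≡n j≤
  ... | inj₁ (s≤s j≤i) = periodic-mono k _ (s≤s (s≤s (ℕP.m≤n+m ℓ k))) (p j j≤i)
  ... | inj₂ refl = subst (λ e → Periodic e k (λ n → chebV n (suc i))) exponent
    (periodic-step ℓ k (λ n → chebV n i) (λ n → chebV n (suc i)) (λ n → refl) (p i ℕP.≤-refl))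

-- The recurrence is run backwards from a multiple of the period, where V agrees with V₀ and V₁; the
-- step before V₀ gives y - (1 + y) = -V₀, and the sign then persists.
chebV-reflect : ∀ ℓ k i → (∀ j → j ℕ.≤ i → Periodic ℓ k (λ n → chebV n j)) →
  ∀ n m q j → j ℕ.≤ i → suc (n ℕ.+ m) ≡ q ℕ.* 2 ℕ.^ ℓ → chebV m j ≡ ℤ.- chebV n j [mod2^ k ]
chebV-reflect ℓ k i per = go
  where
  back : ∀ m j → chebV m j ≡ shiftℤ (chebV (suc m)) j ℤ.- chebV (suc (suc m)) j
  back m j = lem (shiftℤ (chebV (suc m)) j) (chebV m j)
    where
    lem : ∀ s a → a ≡ s ℤ.- (s ℤ.- a)
    lem = solve-∀
  at-multiple : ∀ q a j → j ℕ.≤ i → ∀ {N} → N ≡ q ℕ.* 2 ℕ.^ ℓ ℕ.+ a → chebV N j ≡ chebV a j [mod2^ k ]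
  at-multiple q a j j≤ refl = periodic-multiple ℓ k _ (per j j≤) q a
  shift-mod : ∀ (P Q : ℕ → ℤ) → (∀ j → j ℕ.≤ i → P j ≡ Q j [mod2^ k ]) → ∀ j → j ℕ.≤ i → shiftℤ P j ≡
    shiftℤ Q j [mod2^ k ]
  shift-mod P Q e zero j≤ = ≡⇒mod refl
  shift-mod P Q e (suc j) j≤ = e j (ℕP.<⇒≤ j≤)
  shift-neg : ∀ (P : ℕ → ℤ) j → shiftℤ (λ j → ℤ.- P j) j ≡ ℤ.- shiftℤ P j
  shift-neg P zero = refl
  shift-neg P (suc j) = refl
  lem₀ : ∀ d s → s ℤ.- (d ℤ.+ s) ≡ ℤ.- d
  lem₀ = solve-∀
  lem₁ : ∀ d s → (ℤ.- s) ℤ.- d ≡ ℤ.- (d ℤ.+ s)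
  lem₁ = solve-∀
  lem₂ : ∀ s a → (ℤ.- s) ℤ.- (ℤ.- a) ≡ ℤ.- (s ℤ.- a)
  lem₂ = solve-∀
  go : ∀ n m q j → j ℕ.≤ i → suc (n ℕ.+ m) ≡ q ℕ.* 2 ℕ.^ ℓ → chebV m j ≡ ℤ.- chebV n j [mod2^ k ]
  go zero m q j j≤ e = mod-trans (≡⇒mod (back m j)) (mod-trans
    (mod-- (shift-mod _ _ (λ j j≤ → at-multiple q 0 j j≤ (trans e (sym (ℕP.+-identityʳ _)))) j j≤)
      (at-multiple q 1 j j≤ (trans (cong suc e) (ℕP.+-comm 1 _))))
    (≡⇒mod (lem₀ (δℤ j) (shiftℤ δℤ j))))
  go (suc zero) m q j j≤ e = mod-trans (≡⇒mod (back m j)) (mod-trans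
    (mod-- (shift-mod _ (λ j → ℤ.- δℤ j) (λ j j≤ → go zero (suc m) q j j≤ e) j j≤)
      (at-multiple q 0 j j≤ (trans e (sym (ℕP.+-identityʳ _)))))
    (≡⇒mod (trans (cong (ℤ._- δℤ j) (shift-neg δℤ j)) (lem₁ (δℤ j) (shiftℤ δℤ j)))))
  go (suc (suc n)) m q j j≤ e = mod-trans (≡⇒mod (back m j)) (mod-trans
    (mod-- (shift-mod _ (λ j → ℤ.- chebV (suc n) j) (λ j j≤ → go (suc n) (suc m) q j j≤
      (trans (cong (λ t → suc (suc t)) (ℕP.+-suc n m)) e)) j j≤)
      (go n (suc (suc m)) q j j≤ (trans (cong suc (trans (ℕP.+-suc n (suc m)) (cong suc (ℕP.+-suc n m)))) e)))
    (≡⇒mod (trans (cong (ℤ._- (ℤ.- chebV n j)) (shift-neg (chebV (suc n)) j))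
      (lem₂ (shiftℤ (chebV (suc n)) j) (chebV n j)))))

-- The reflection negates both factors, so the product is invariant.
good-chebV : ∀ i → Good (λ n → chebV n 0 ℤ.* chebV n i)
good-chebV i k with chebV-periodic k i
... | ℓ , per = suc (suc ℓ) , λ
  { n m (above q refl) → mod-* (multiple q m 0 z≤n) (multiple q m i ℕP.≤-refl)
  ; n m (below q refl) → mod-sym (mod-* (multiple q n 0 z≤n) (multiple q n i ℕP.≤-refl))
  ; n m (opposite q e) → mod-sym (mod-trans (mod-* (reflect n m q 0 z≤n e) (reflect n m q i ℕP.≤-refl e))
    (≡⇒mod (lem (chebV n 0) (chebV n i)))) }
  where
  multiple : ∀ q n j → j ℕ.≤ i → chebV (q ℕ.* 2 ℕ.^ suc (suc ℓ) ℕ.+ n) j ≡ chebV n j [mod2^ k ]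
  multiple q n j j≤ = periodic-multiple (suc (suc ℓ)) k (λ n → chebV n j) (per j j≤) q n
  reflect : ∀ n m q j → j ℕ.≤ i → suc (n ℕ.+ m) ≡ q ℕ.* 2 ℕ.^ suc (suc ℓ) → chebV m j ≡ ℤ.- chebV n j [mod2^ k ]
  reflect = chebV-reflect (suc (suc ℓ)) k i per
  lem : ∀ a b → (ℤ.- a) ℤ.* (ℤ.- b) ≡ a ℤ.* b
  lem = solve-∀

-- Continuity of families over varying splitting rings

module Family (S : ℕ → Alg) where
  module S n = AlgTheory (S n)

  Fam : Set
  Fam = ∀ n → S.Carrier n

  -- The rings change with n, so values at different n can be compared only after they are known to
  -- be integers.
  GoodFam : Fam → Set
  GoodFam x = ∃ λ z → (∀ n → x n ≡ S.ι n (z n)) × Good z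

  fam-cong : ∀ {x y : Fam} → (∀ n → x n ≡ y n) → GoodFam x → GoodFam y
  fam-cong e (z , p , g) = z , (λ n → trans (sym (e n)) (p n)) , g

  fam-ι : ∀ a → GoodFam (λ n → S.ι n a)
  fam-ι a = (λ _ → a) , (λ n → refl) , good-const a

  fam-0 : GoodFam (λ n → S.0# n)
  fam-0 = fam-cong (λ n → S.ι-0 n) (fam-ι (+ 0))

  fam-+ : ∀ {x y : Fam} → GoodFam x → GoodFam y → GoodFam (λ n → S._+_ n (x n) (y n))
  fam-+ (z , p , g) (w , q , h) = _ , (λ n → trans (cong₂ (S._+_ n) (p n) (q n)) (sym (S.ι-+ n (z n) (w n))))
    , good-+ g h

  fam-* : ∀ {x y : Fam} → GoodFam x → GoodFam y → GoodFam (λ n → S._*_ n (x n) (y n))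
  fam-* (z , p , g) (w , q , h) = _ , (λ n → trans (cong₂ (S._*_ n) (p n) (q n)) (sym (S.ι-* n (z n) (w n))))
    , good-* g h

  fam-neg : ∀ {x : Fam} → GoodFam x → GoodFam (λ n → S.-_ n (x n))
  fam-neg (z , p , g) = _ , (λ n → trans (cong (S.-_ n) (p n)) (sym (S.ι-neg n (z n)))) ,
    good-cong (λ n → lem (z n)) (good-- (good-const (+ 0)) g)
    where
    lem : ∀ a → + 0 ℤ.- a ≡ ℤ.- a
    lem = solve-∀

  -- Torsion-freeness and the retraction make the quotient integral; `good-cancel` makes it
  -- continuous.
  fam-cancel : ∀ c {x : Fam} → GoodFam (λ n → S._*_ n (S.ι n (+ suc c)) (x n)) → GoodFam x
  fam-cancel c {x} (z , p , g) = (λ n → S.π n (x n)) , (λ n → S.pure n c (x n) (z n) (p n)) ,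
    good-cancel c (good-cong (λ n → trans (sym (S.π-ι n (z n)))
      (trans (cong (S.π n) (sym (p n))) (S.π-ι* n (+ suc c) (x n)))) g)

  fam-^ : ∀ a k → GoodFam (λ n → Series._^_ (S n) (S.ι n a) k)
  fam-^ a zero = fam-cong (λ n → S.ι-1 n) (fam-ι (+ 1))
  fam-^ a (suc k) = fam-* (fam-ι a) (fam-^ a k)

  fam-conv : ∀ m (p E : ∀ n → ℕ → S.Carrier n) → (∀ j → j ℕ.< m → GoodFam (λ n → p n j)) →
    (∀ j → j ℕ.< m → GoodFam (λ n → E n j)) →
    GoodFam (λ n → Series.conv (S n) (p n) (E n) m)
  fam-conv zero p E gp gE = fam-0
  fam-conv (suc m) p E gp gE = fam-+ (fam-* (gp 0 (s≤s z≤n)) (gE m ℕP.≤-refl))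
    (fam-conv m (λ n → p n ∘ suc) E (λ j l → gp (suc j) (s≤s l)) (λ j l → gE j (ℕP.m<n⇒m<1+n l)))

  fam-partialSum : ∀ a k (E : ∀ n → ℕ → S.Carrier n) → (∀ j → GoodFam (λ n → E n j)) → GoodFam
    (λ n → Series.partialSum (S n) (S.ι n a) (E n) k)
  fam-partialSum a zero E gE = fam-0
  fam-partialSum a (suc k) E gE = fam-+ (fam-partialSum a k E gE) (fam-* (fam-^ a k) (gE k))

module Roots-of-V where

  S : ℕ → Alg
  S n = proj₁ (roots-exist n)

  module Γ n = Expansions (S n) (proj₁ (proj₂ (roots-exist n))) (proj₁ (proj₂ (proj₂ (roots-exist n))))

  degree : ∀ n → Γ.n n ≡ n
  degree n = proj₂ (proj₂ (proj₂ (roots-exist n)))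

  open Family S

  fam-elementary : ∀ i → GoodFam (λ n → Γ.elementary n i)
  fam-elementary i = (λ n → chebV n 0 ℤ.* chebV n i) ,
    (λ n → trans (Γ.elementary-chebV n i) (cong (λ j → S.ι n (chebV j 0 ℤ.* chebV j i)) (degree n))) ,
      good-chebV i

  negPowerSum : ∀ n → ℕ → S.Carrier n
  negPowerSum n i = S._*_ n (S.ι n -[1+ 0 ]) (Γ.powerSum n (suc i))

  -- Newton's identity is solved for its last term, whose coefficient is the elementary function of
  -- index 0, that is 1; no division occurs. The bound `k` carries the strong induction.
  fam-negPowerSum : ∀ k i → i ℕ.< k → GoodFam (λ n → negPowerSum n i)
  fam-negPowerSum (suc k) i (s≤s i≤k) = fam-cong eq
    (fam-+ (fam-* (fam-ι (+ suc i)) (fam-elementary (suc i)))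
      (fam-neg (fam-conv i negPowerSum (λ n → Γ.elementary n ∘ suc)
        (λ j l → fam-negPowerSum k j (ℕP.≤-trans l i≤k)) (λ j _ → fam-elementary (suc j)))))
    where
    eq : ∀ n → S._+_ n (S._*_ n (S.ι n (+ suc i)) (Γ.elementary n (suc i)))
      (S.-_ n (Series.conv (S n) (negPowerSum n) (Γ.elementary n ∘ suc) i)) ≡ negPowerSum n i
    eq n = trans (cong (λ t → S._+_ n t (S.-_ n c)) (trans (Γ.elementary-logDeriv n (suc i))
      (trans (Series.conv-last (S n) (negPowerSum n) (Γ.elementary n) i)
        (S.addˡ n c (trans (S.mulˡ n (negPowerSum n i) (Γ.elementary-0 n)) (S.*-identityʳ n _))))))
      (Series.add-sub (S n) c (negPowerSum n i))
      where
      c : S.Carrier n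
      c = Series.conv (S n) (negPowerSum n) (Γ.elementary n ∘ suc) i

  fam-powerSum : ∀ i → GoodFam (λ n → Γ.powerSum n (suc i))
  fam-powerSum i = fam-cong (λ n → Series.negate-twice (S n) (Γ.powerSum n (suc i)))
    (fam-* (fam-ι -[1+ 0 ]) (fam-negPowerSum (suc i) i ℕP.≤-refl))

  fam-pairPowerSum : ∀ i → GoodFam (λ n → Γ.pairPowerSum n (suc i))
  -- Division by 2: squaring a power sum counts each pair in both orders.
  fam-pairPowerSum i = fam-cancel 1 (fam-cong (λ n → sym (Γ.pairPowerSum-double n (suc i)))
    (fam-+ (fam-* (fam-powerSum i) (fam-powerSum i)) (fam-neg (fam-powerSum (i ℕ.+ suc i)))))

  -- Newton's identities in the other direction, from power sums to elementary functions; here m + 1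
  -- has to be divided out.
  fam-pairElementary : ∀ k m → m ℕ.< k → GoodFam (λ n → Γ.pairElementary n m)
  fam-pairElementary (suc k) zero _ = fam-cong (λ n → trans (S.ι-1 n) (sym (Γ.pairElementary-0 n)))
    (fam-ι (+ 1))
  fam-pairElementary (suc k) (suc m) (s≤s m<k) = fam-cancel m
    (fam-cong (λ n → sym (Γ.pairElementary-logDeriv n (suc m)))
    (fam-conv (suc m) _ Γ.pairElementary (λ j _ → fam-* (fam-^ -[1+ 0 ] j) (fam-pairPowerSum j))
      (λ j j≤m → fam-pairElementary k j (ℕP.≤-trans j≤m m<k))))

  normalized : ℕ → ℤ
  normalized n = Γ.normalized n

  -- The terms up to k determine the value modulo 4ᵏ⁺¹, hence modulo 2ᵏ, for every n at once; they
  -- are finitely many good families.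
  good-normalized : Good normalized
  good-normalized k with fam-partialSum (+ 4) (suc k) Γ.pairElementary
    (λ j → fam-pairElementary (suc j) j ℕP.≤-refl)
  ... | z , e , g with g k
  ... | ℓ , h = ℓ , λ n m p → mod-trans (close n) (mod-trans (h n m p) (mod-sym (close m)))
    where
    power : ∀ k → 2^ k ∣ ((+ 4) ℤ.^ suc k)
    power zero = divides (+ 4) refl
    power (suc k) = subst (_∣ + 4 ℤ.* ((+ 4) ℤ.^ suc k)) (sym (2^-suc k))
      (ℤ∣.∣-trans (ℤ∣.*-monoʳ-∣ (+ 2) (power k)) (ℤ∣.*-monoˡ-∣ ((+ 4) ℤ.^ suc k) {+ 2} {+ 4}
        (divides (+ 2) refl)))
    close : ∀ n → normalized n ≡ z n [mod2^ k ]
    close n = mod (subst (2^ k ∣_) (sym (proj₂ (Γ.normalized-expansion n k (z n) (e n))))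
      (∣m⇒∣m*n (proj₁ (Γ.normalized-expansion n k (z n) (e n))) (power k)))

  tilings-normalized : ∀ n f → tilings (2 ℕ.* n) ≡ 2 ℕ.^ n ℕ.* (f ℕ.* f) → + f ≡ sign n ℤ.* normalized n
  tilings-normalized n f e = subst (λ j → + f ≡ sign j ℤ.* normalized n) (degree n)
    (Γ.tilings-normalized n f (subst (λ j → tilings (2 ℕ.* j) ≡ 2 ℕ.^ j ℕ.* (f ℕ.* f)) (sym (degree n)) e))

-- Extension to the 2-adic integers and the functional equation

open import Data.Nat using (_*_; _^_; _≤_; _<_)
open import Data.Nat.Tactic.RingSolver using () renaming (solve-∀ to ℕ-solve-∀)
open import Data.Nat.DivMod using ([m+kn]%n≡m%n; m∣n⇒o%n%m≡o%m; m<n⇒m%n≡m)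

-- The product of the roots has period 4 in n, and its fourth power is 1, which absorbs the shift of
-- the exponent.
sign-period : ∀ n → sign (4 ℕ.+ n) ≡ sign n
sign-period n = trans (cong (ℤ._^ suc (4 ℕ.+ n)) product-period) (trans (lem r (r ℤ.^ suc n))
  (trans (cong₂ (λ s t → (s ℤ.* t) ℤ.* (r ℤ.^ suc n)) (rootsProduct² n) (rootsProduct² n)) (ℤP.*-identityˡ _)))
  where
  r : ℤ
  r = rootsProduct n
  lem : ∀ r p → r ℤ.* (r ℤ.* (r ℤ.* (r ℤ.* p))) ≡ ((r ℤ.* r) ℤ.* (r ℤ.* r)) ℤ.* p
  lem = solve-∀
  neg-4 : ∀ p c → (ℤ.- (ℤ.- (ℤ.- (ℤ.- p)))) ℤ.* (+ 0 ℤ.- (+ 0 ℤ.- c)) ≡ p ℤ.* c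
  neg-4 = solve-∀
  product-period : rootsProduct (4 ℕ.+ n) ≡ r
  product-period = neg-4 (parity n) (chebV n 0)

sign-mod-4 : ∀ n → sign n ≡ sign (n % 4)
sign-mod-4 n = trans (cong sign (trans (m≡m%n+[m/n]*n n 4) (ℕP.+-comm (n % 4) _))) (go (n ℕD./ 4))
  where
  go : ∀ q → sign (q ℕ.* 4 ℕ.+ n % 4) ≡ sign (n % 4)
  go zero = refl
  go (suc q) = trans (sign-period (q ℕ.* 4 ℕ.+ n % 4)) (go q)

mod2^-< : ∀ k x → mod2^ k x ℕ.< 2 ^ k
mod2^-< k x = m%n<n x (2 ^ k) {{ℕP.m^n≢0 2 k}}

mod2^-split : ∀ k x → ∃ λ q → x ≡ mod2^ k x ℕ.+ q ℕ.* 2 ^ k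
mod2^-split k x = ℕD._/_ x (2 ^ k) {{ℕP.m^n≢0 2 k}} , m≡m%n+[m/n]*n x (2 ^ k) {{ℕP.m^n≢0 2 k}}

mod2^-+ : ∀ k x q → mod2^ k (x ℕ.+ q ℕ.* 2 ^ k) ≡ mod2^ k x
mod2^-+ k x q = [m+kn]%n≡m%n x q (2 ^ k) {{ℕP.m^n≢0 2 k}}

2^-∣ℕ : ∀ {j k} → j ℕ.≤ k → (2 ^ j) ℕ∣.∣ (2 ^ k)
2^-∣ℕ {j} {k} p = ℕ∣.divides (2 ^ (k ℕ.∸ j)) (trans (cong (2 ^_) (sym (ℕP.m∸n+n≡m p)))
  (ℕP.^-distribˡ-+-* 2 (k ℕ.∸ j) j))

mod2^-mod2^ : ∀ {j k} → j ℕ.≤ k → ∀ x → mod2^ j (mod2^ k x) ≡ mod2^ j x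
mod2^-mod2^ {j} {k} p x = m∣n⇒o%n%m≡o%m (2 ^ j) (2 ^ k) x {{ℕP.m^n≢0 2 j}} {{ℕP.m^n≢0 2 k}} (2^-∣ℕ p)

mod2^-small : ∀ k {x} → x ℕ.< 2 ^ k → mod2^ k x ≡ x
mod2^-small k p = m<n⇒m%n≡m {{ℕP.m^n≢0 2 k}} p

mod⇒mod2^ : ∀ k a b → + a ≡ + b [mod2^ k ] → mod2^ k a ≡ mod2^ k b
mod⇒mod2^ k a b (mod (divides q e)) = go q e
  where
  lem : ∀ a b → a ≡ b ℤ.+ (a ℤ.- b)
  lem = solve-∀
  lem' : ∀ a b → b ≡ a ℤ.- (a ℤ.- b)
  lem' = solve-∀
  go : ∀ q → + a ℤ.- + b ≡ q ℤ.* 2^ k → mod2^ k a ≡ mod2^ k b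
  go (+ c) e = trans (cong (mod2^ k) (ℤP.+-injective {a} {b ℕ.+ c ℕ.* 2 ^ k}
    (trans (lem (+ a) (+ b)) (cong (λ t → + b ℤ.+ t) (trans e (sym (ℤP.pos-* c (2 ^ k)))))))) (mod2^-+ k b c)
  go -[1+ c ] e = sym (trans (cong (mod2^ k) (ℤP.+-injective {b} {a ℕ.+ suc c ℕ.* 2 ^ k}
    (trans (lem' (+ a) (+ b)) (cong (λ t → + a ℤ.+ t) (trans (cong ℤ.-_ e)
      (trans (ℤP.neg-distribˡ-* -[1+ c ] (2^ k)) (sym (ℤP.pos-* (suc c) (2 ^ k)))))))))
    (mod2^-+ k a (suc c)))

regroup : ∀ {p q r N} → p ≤ q → r ℕ.+ q * N ≡ (q ℕ.∸ p) * N ℕ.+ (r ℕ.+ p * N)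
regroup {p} {q} {r} {N} l = trans (cong (λ t → r ℕ.+ t)
  (trans (cong (_* N) (sym (ℕP.m∸n+n≡m l))) (ℕP.*-distribʳ-+ N (q ℕ.∸ p) p)))
  (trans (sym (ℕP.+-assoc r ((q ℕ.∸ p) * N) (p * N))) (trans (cong (ℕ._+ p * N) (ℕP.+-comm r ((q ℕ.∸ p) * N)))
    (ℕP.+-assoc ((q ℕ.∸ p) * N) r (p * N))))

mod2^⇒near : ∀ ℓ n m → mod2^ ℓ n ≡ mod2^ ℓ m → Near ℓ n m
mod2^⇒near ℓ n m e with mod2^-split ℓ n | mod2^-split ℓ m
... | p , en | q , em with ℕP.≤-total p q
... | inj₁ p≤q = below (q ℕ.∸ p) (trans em (trans (regroup p≤q)
  (cong (λ t → (q ℕ.∸ p) * 2 ^ ℓ ℕ.+ t) (trans (cong (λ t → t ℕ.+ p * 2 ^ ℓ) (sym e)) (sym en)))))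
... | inj₂ q≤p = above (p ℕ.∸ q) (trans en (trans (regroup q≤p)
  (cong (λ t → (p ℕ.∸ q) * 2 ^ ℓ ℕ.+ t) (trans (cong (λ t → t ℕ.+ q * 2 ^ ℓ) e) (sym em)))))

res-mod2^ : ∀ (x : ℤ₂) {j k} → j ≤ k → mod2^ j (res x k) ≡ res x j
res-mod2^ x {j} {k} j≤k = subst (λ t → mod2^ j (res x t) ≡ res x j) (ℕP.m∸n+n≡m j≤k) (go (k ℕ.∸ j))
  where
  go : ∀ d → mod2^ j (res x (d ℕ.+ j)) ≡ res x j
  go zero = mod2^-small j (res-< x j)
  go (suc d) = trans (sym (mod2^-mod2^ (ℕP.m≤n+m j d) _))
    (trans (cong (mod2^ j) (res-compat x (d ℕ.+ j))) (go d))

natural : ℕ → ℤ₂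
natural n = record { res = λ k → mod2^ k n ; res-< = λ k → mod2^-< k n ; res-compat = λ k → mod2^-mod2^
  (ℕP.n≤1+n k) n }

module Interpolation (f : ℕ → ℕ) (s : ℕ → ℤ) (good : Good s) (f-s : ∀ n → 1 ≤ n → + f n ≡ sign n ℤ.* s n) where

  -- The added 2 makes the argument known modulo 4, on which `sign` depends.
  modulus : ℕ → ℕ
  modulus k = 2 ℕ.+ proj₁ (good k)

  s-near : ∀ k n m → Near (modulus k) n m → s n ≡ s m [mod2^ k ]
  s-near k n m p = proj₂ (good k) n m (near-mono (ℕP.m≤n+m _ 2) p)

  uniform : ∀ k n m → 1 ≤ n → 1 ≤ m → mod2^ (modulus k) n ≡ mod2^ (modulus k) m → mod2^ k (f n) ≡ mod2^ k (f m)
  uniform k n m n≥1 m≥1 e = mod⇒mod2^ k (f n) (f m) (subst₂ (λ a b → a ≡ b [mod2^ k ]) (sym (f-s n n≥1))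
    (sym (f-s m m≥1))
    (mod-* (≡⇒mod signs) (s-near k n m (mod2^⇒near (modulus k) n m e))))
    where
    2≤ : 2 ≤ modulus k
    2≤ = ℕP.m≤m+n 2 _
    signs : sign n ≡ sign m
    signs = trans (sign-mod-4 n) (trans (cong sign (trans (sym (mod2^-mod2^ 2≤ n))
      (trans (cong (mod2^ 2) e) (mod2^-mod2^ 2≤ m)))) (sym (sign-mod-4 m)))

  -- Cumulative, so that the levels increase: compatibility of the residues at k and k + 1 needs the
  -- later approximation to be fine enough for k as well.
  level : ℕ → ℕ
  level zero = modulus 0
  level (suc k) = level k ℕ.+ modulus (suc k)

  modulus≤level : ∀ k → modulus k ≤ level k
  modulus≤level zero = ℕP.≤-refl
  modulus≤level (suc k) = ℕP.m≤n+m _ (level k)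

  2≤level : ∀ k → 2 ≤ level k
  2≤level k = ℕP.≤-trans (ℕP.m≤m+n 2 _) (modulus≤level k)

  -- The summand 2^ℓ is there because f is constrained at positive arguments only.
  approx : ℤ₂ → ℕ → ℕ
  approx x ℓ = res x ℓ ℕ.+ 1 ℕ.* 2 ^ ℓ

  approx≥1 : ∀ x ℓ → 1 ≤ approx x ℓ
  approx≥1 x ℓ = ℕP.≤-trans (subst (1 ≤_) (sym (ℕP.*-identityˡ (2 ^ ℓ))) (ℕP.m^n>0 2 ℓ))
    (ℕP.m≤n+m (1 ℕ.* 2 ^ ℓ) (res x ℓ))

  approx-mod : ∀ x {j ℓ} → j ≤ ℓ → mod2^ j (approx x ℓ) ≡ res x j
  approx-mod x {j} {ℓ} p = trans (sym (mod2^-mod2^ p (approx x ℓ)))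
    (trans (cong (mod2^ j) (trans (mod2^-+ ℓ (res x ℓ) 1) (mod2^-small ℓ (res-< x ℓ)))) (res-mod2^ x p))

  Fres : ℤ₂ → ℕ → ℕ
  Fres x k = mod2^ k (f (approx x (level k)))

  Fres-unique : ∀ x k n → 1 ≤ n → mod2^ (modulus k) n ≡ res x (modulus k) → mod2^ k (f n) ≡ Fres x k
  Fres-unique x k n n≥1 e = uniform k n _ n≥1 (approx≥1 x (level k))
    (trans e (sym (approx-mod x (modulus≤level k))))

  F : ℤ₂ → ℤ₂
  F x = record
    { res = Fres x
    ; res-< = λ k → mod2^-< k _
    ; res-compat = λ k → trans (mod2^-mod2^ (ℕP.n≤1+n k) _)
        (Fres-unique x k _ (approx≥1 x (level (suc k)))
          (approx-mod x (ℕP.≤-trans (modulus≤level k) (ℕP.m≤m+n (level k) _)))) }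

  F-continuous : Continuous F
  F-continuous x k = level k , λ y e → cong (λ r → mod2^ k (f (r ℕ.+ 1 ℕ.* 2 ^ level k))) e

  F-extends : Extends F f
  F-extends n n≥1 x rep k = sym (Fres-unique x k n n≥1 (sym (rep (modulus k))))

  -- Positive integers are dense: one integer is chosen so close to x that it serves both the
  -- continuity of `G` and the definition of `F`.
  F-unique : ∀ (G : ℤ₂ → ℤ₂) → Continuous G → Extends G f → ∀ x → G x ≈₂ F x
  F-unique G cont ext x k with cont x k
  ... | ℓ , agree = trans (agree (natural n) (sym (approx-mod x (ℕP.m≤m+n ℓ (level k)))))
    (trans (ext n n≥1 (natural n) (λ _ → refl) k)
      (Fres-unique x k n n≥1 (approx-mod x (ℕP.≤-trans (modulus≤level k) (ℕP.m≤n+m (level k) ℓ)))))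
    where
    n : ℕ
    n = approx x (ℓ ℕ.+ level k)
    n≥1 : 1 ≤ n
    n≥1 = approx≥1 x (ℓ ℕ.+ level k)

  module _ (x y : ℤ₂) (neg : IsNegSuc y x) (k : ℕ) where

    private
      ℓ a b : ℕ
      ℓ = level k
      a = approx x ℓ
      b = approx y ℓ

    s-opposite : s a ≡ s b [mod2^ k ]
    -- The residues of x and y at level ℓ add up to 2^ℓ - 1, and `a` and `b` contain a further 2^ℓ
    -- each; this gives the multiplier 3.
    s-opposite = s-near k a b (near-mono (modulus≤level k) (opposite 3 total))
      where
      r N : ℕ
      r = res x ℓ
      N = 2 ^ ℓ
      complement : suc (r ℕ.+ res y ℓ) ≡ N
      complement = trans (cong (λ t → suc (r ℕ.+ t)) (trans (neg ℓ) (ℕP.∸-+-assoc N 1 r)))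
        (ℕP.m+[n∸m]≡n (res-< x ℓ))
      rearrange : ∀ a b c → suc ((a ℕ.+ 1 * c) ℕ.+ (b ℕ.+ 1 * c)) ≡ suc (a ℕ.+ b) ℕ.+ 2 * c
      rearrange = ℕ-solve-∀
      total : suc ((r ℕ.+ 1 ℕ.* N) ℕ.+ (res y ℓ ℕ.+ 1 ℕ.* N)) ≡ 3 ℕ.* N
      total = trans (rearrange r (res y ℓ) N) (cong (λ t → t ℕ.+ 2 * N) complement)

    sign-of : ∀ (z : ℤ₂) {r} → res z 2 ≡ r → sign (approx z ℓ) ≡ sign r
    sign-of z e = trans (sign-mod-4 (approx z ℓ)) (cong sign (trans (approx-mod z (2≤level k)) e))

    opposite-residue : ∀ {r} → res x 2 ≡ r → res y 2 ≡ 3 ℕ.∸ r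
    opposite-residue e = trans (neg 2) (cong (λ t → 3 ℕ.∸ t) e)

    f-approx : ∀ (z : ℤ₂) → + f (approx z ℓ) ≡ sign (approx z ℓ) ℤ.* s (approx z ℓ)
    f-approx z = f-s (approx z ℓ) (approx≥1 z ℓ)

    same-sign : ∀ {r} → res x 2 ≡ r → sign (3 ℕ.∸ r) ≡ sign r → res (F y) k ≡ res (F x) k
    same-sign e σ = sym (mod⇒mod2^ k (f a) (f b) (subst₂ (λ p q → p ≡ q [mod2^ k ]) (sym (f-approx x))
      (sym (f-approx y))
      (mod-* (≡⇒mod (trans (sign-of x e) (trans (sym σ) (sym (sign-of y (opposite-residue e)))))) s-opposite)))

    opposite-sign : ∀ {r} → res x 2 ≡ r → sign (3 ℕ.∸ r) ≡ ℤ.- sign r → res (F y) k ≡ negres (F x) k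
    opposite-sign e σ = mod⇒mod2^ k (f b) (2 ^ k ℕ.∸ mod2^ k (f a))
      (mod-trans b≡-a (complement (mod2^-split k (f a))))
      where
      b≡-a : + f b ≡ ℤ.- (+ f a) [mod2^ k ]
      b≡-a = subst₂ (λ p q → p ≡ q [mod2^ k ]) (sym (f-approx y)) (cong ℤ.-_ (sym (f-approx x)))
        (mod-trans (mod-* (≡⇒mod (trans (sign-of y (opposite-residue e))
          (trans σ (cong ℤ.-_ (sym (sign-of x e)))))) (mod-sym s-opposite))
          (≡⇒mod (sym (ℤP.neg-distribˡ-* (sign a) (s a)))))
      complement : (∃ λ q → f a ≡ mod2^ k (f a) ℕ.+ q ℕ.* 2 ^ k) → ℤ.- (+ f a) ≡ +
        (2 ^ k ℕ.∸ mod2^ k (f a)) [mod2^ k ]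
      -- If f a = r + qN with N = 2ᵏ, then -f a - (N - r) = -(1 + q) N.
      complement (q , e) = mod (divides (ℤ.- (+ suc q)) (trans
        (cong₂ (λ s t → ℤ.- s ℤ.- t) (trans (cong +_ e)
          (cong (λ t → + mod2^ k (f a) ℤ.+ t) (ℤP.pos-* q (2 ^ k))))
          (trans (sym (ℤP.⊖-≥ (ℕP.<⇒≤ (mod2^-< k (f a))))) (sym (ℤP.m-n≡m⊖n (2 ^ k) (mod2^ k (f a))))))
        (lem (+ mod2^ k (f a)) (+ q) (2^ k))))
        where
        lem : ∀ r q N → ℤ.- (r ℤ.+ q ℤ.* N) ℤ.- (N ℤ.- r) ≡ (ℤ.- (+ 1 ℤ.+ q)) ℤ.* N
        lem = solve-∀

  F-equation : FunctionalEquation F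
  F-equation x y neg =
    -- The signs at 0, 1, 2, 3 compute to 1, 1, -1, 1, so r and 3 - r have equal signs for r = 0, 3
    -- and opposite ones for r = 1, 2.
    (λ { (inj₁ e) k → same-sign x y neg k e refl ; (inj₂ e) k → same-sign x y neg k e refl }) ,
    (λ { (inj₁ e) k → opposite-sign x y neg k e refl ; (inj₂ e) k → opposite-sign x y neg k e refl })

theorem1 : (f : ℕ → ℕ) →
    (∀ (n : ℕ) → 1 ≤ n → (tilings (2 * n) ≡ 2 ^ n * (f n * f n)) × Odd (f n)) →
    UniformlyContinuous₂ f ×
    (Σ (ℤ₂ → ℤ₂) λ F → Continuous F × Extends F f ×
    (∀ (G : ℤ₂ → ℤ₂) → Continuous G → Extends G f → ∀ x → G x ≈₂ F x) ×
    FunctionalEquation F)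
theorem1 f count = (λ k → modulus k , uniform k) , F , F-continuous , F-extends , F-unique , F-equation
  where
  open Roots-of-V using (normalized; good-normalized; tilings-normalized)
  open Interpolation f normalized good-normalized (λ n n≥1 → tilings-normalized n (f n) (proj₁ (count n n≥1)))
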